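{- Let $T$ be a rosy theory. Then þ-independence is an independence relation on (small subsets of) the monster model of $T$; more precisely, the following hold for all tuples $a,b$, all sets $A,B,C$ and all types. 1. Existence: if $p\in S(A)$, then $p$ does not þ-fork over $A$. 2. Extension: every partial type over $B\supseteq A$ which does not þ-fork over $A$ can be extended to a complete type $p(x)$ over $B$ which does not þ-fork over $A$. 3. Reflexivity: $B\perp^{þ}_A B$ if and only if $B\subseteq \mathrm{acl}(A)$. 4. Monotonicity: if $p$ and $q$ are types with $p\supseteq q$ and $p$ does not þ-fork over $A$, then $q$ does not þ-fork over $A$. 5. Finite character: $C\perp^{þ}_A B$ if and only if $c\perp^{þ}_A B$ for every finite $c\subset C$. 6. Symmetry: $C\perp^{þ}_A B$ if and only if $B\perp^{þ}_A C$. 7. Transitivity: if $A\subseteq B\subseteq C$, then $b\perp^{þ}_A C$ if and only if $b\perp^{þ}_A B$ and $b\perp^{þ}_B C$. 8. If $a\perp^{þ}_A b$ and, for some formula $\delta(x,y)$, $\delta(x,a)$ þ-forks over $A$, then $\delta(x,a)$ þ-forks over $Ab$. 9. If $A\subseteq B$ and $a\perp^{þ}_A B$, then $a\perp^{þ}_A \mathrm{acl}(B)$.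
   Context: $T$ is a complete first-order theory with monster model $\mathcal C$ (saturated, of large cardinality); all sets, tuples, types and models are small and live inside $\mathcal C$. One works in $\mathcal C^{eq}$, so tuples are tuples of imaginaries and $\mathrm{acl}$ is computed in $\mathcal C^{eq}$. A family $\{\delta(x,a')\}_{a'\in S}$ is $k$-inconsistent if $\bigwedge_{i=1}^k\delta(x,a_i)$ is inconsistent for all pairwise distinct $a_1,\dots,a_k\in S$. A formula $\delta(x,a)$ strongly divides over $A$ if $tp(a/A)$ is non-algebraic and $\{\delta(x,a')\}_{a'\models tp(a/A)}$ is $k$-inconsistent for some $k\in\mathbb N$. It þ-divides over $A$ if there is a tuple $c$ such that $\delta(x,a)$ strongly divides over $Ac$. A formula þ-forks over $A$ if it implies a finite disjunction of formulas (with parameters) each of which þ-divides over $A$. A type þ-divides (þ-forks) over $A$ if it contains a formula which þ-divides (þ-forks) over $A$; partial types are understood to be closed under finite conjunctions. $a\perp^{þ}_A b$ (þ-independence) means that $tp(a/Ab)$ does not þ-fork over $A$; similarly for sets, using (enumerations of) the sets. þ-rank: for a formula $\phi$ (with parameters) in $x$, a set $\Delta$ of parameter-free formulas in variables $x;y$, a set $\Pi$ of parameter-free formulas in variables $y;z$ ($z$ possibly of infinite length), and $k\in\mathbb N$, define þ$(\phi,\Delta,\Pi,k)$ inductively: (1) þ$(\phi,\Delta,\Pi,k)\ge 0$ if $\phi$ is consistent; (2) for $\lambda$ a limit ordinal, þ$(\phi,\Delta,\Pi,k)\ge\lambda$ iff þ$(\phi,\Delta,\Pi,k)\ge\alpha$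 for all $\alpha<\lambda$; (3) þ$(\phi,\Delta,\Pi,k)\ge\alpha+1$ iff there are $\delta\in\Delta$, $\pi(y;z)\in\Pi$ and parameters $c$ such that þ$(\phi\wedge\delta(x,a),\Delta,\Pi,k)\ge\alpha$ for infinitely many $a\models\pi(y;c)$, and $\{\delta(x,a)\}_{a\models\pi(y;c)}$ is $k$-inconsistent. For a type $p$, þ$(p,\Delta,\Pi,k)=\min\{$þ$(\phi,\Delta,\Pi,k):\phi\in p\}$. $T$ is rosy if þ$(p,\Delta,\Pi,k)$ is finite for every type $p$, all finite sets $\Delta,\Pi$ of formulas and every $k\in\mathbb N$. -}

module Defs where

open import Level using (Level; _⊔_; Lift) renaming (suc to lsuc)
open import Data.Nat.Base using (ℕ; zero; suc)
open import Data.Fin.Base using (Fin; zero; suc)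
open import Data.Empty using (⊥)
open import Data.Product.Base using (Σ; ∃; ∃-syntax; _×_; _,_; proj₁; proj₂)
open import Data.Sum.Base using (_⊎_; inj₁; inj₂)
open import Data.List.Base using (List)
open import Data.List.Relation.Unary.All using (All)
open import Data.List.Relation.Unary.Any using (Any)
open import Data.List.Membership.Propositional using (_∈_)
open import Function.Base using (_∘_)
open import Function.Bundles using (_⇔_; mk⇔; Equivalence)
open import Relation.Binary.Structures using (IsEquivalence)
open import Relation.Binary.PropositionalEquality using (_≡_; _≢_; refl)
open import Relation.Nullary.Negation using (¬_)
open import Relation.Unary using (Pred)

open Equivalence using (to; from)

-- Throughout, "small" means: indexed by a type in Set ℓ, where ℓ is the
-- level of the language.  The monster model lives at another level c
-- (c = suc ℓ being the intended case).

record Signature {ℓ} (S : Set ℓ) : Set (lsuc ℓ) where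
  field
    Fun Rel  : Set ℓ
    funArity : Fun → ℕ
    dom      : (f : Fun) → Fin (funArity f) → S
    cod      : Fun → S
    relArity : Rel → ℕ
    rdom     : (R : Rel) → Fin (relArity R) → S

-- A context is a small tuple of sorted variables, finite or infinite:
-- Γ s is the type of its variables of sort s.

Ctx : ∀ {ℓ} → Set ℓ → Set (lsuc ℓ)
Ctx {ℓ} S = S → Set ℓ

module _ {ℓ} {S : Set ℓ} where

  infixl 6 _⊕_ _▸_

  ∅ : Ctx S
  ∅ _ = Lift ℓ ⊥

  _⊕_ : Ctx S → Ctx S → Ctx S
  (Γ ⊕ Δ) s = Γ s ⊎ Δ s

  _▸_ : Ctx S → S → Ctx S
  (Γ ▸ s) t = Γ t ⊎ s ≡ t

  data Pos {n} (ss : Fin n → S) : Ctx S where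
    pos : (i : Fin n) → Pos ss (ss i)

  FiniteCtx : Ctx S → Set ℓ
  FiniteCtx Γ = Σ (List (Σ S Γ)) λ vs → ∀ s (v : Γ s) → (s , v) ∈ vs

  Ren : Ctx S → Ctx S → Set ℓ
  Ren Γ Δ = ∀ s → Γ s → Δ s

  [_,_]ʳ : ∀ {Γ Γ′ Δ} → Ren Γ Δ → Ren Γ′ Δ → Ren (Γ ⊕ Γ′) Δ
  [ r , r′ ]ʳ s (inj₁ v) = r s v
  [ r , r′ ]ʳ s (inj₂ v) = r′ s v

  lift : ∀ {Γ Δ s} → Ren Γ Δ → Ren (Γ ▸ s) (Δ ▸ s)
  lift r t (inj₁ v) = inj₁ (r t v)
  lift r t (inj₂ e) = inj₂ e

  shift : ∀ {Γ n} {ss : Fin (suc n) → S} →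
          Ren (Γ ⊕ Pos ss) ((Γ ▸ ss zero) ⊕ Pos (ss ∘ suc))
  shift _ (inj₁ v)             = inj₁ (inj₁ v)
  shift _ (inj₂ (pos zero))    = inj₁ (inj₂ refl)
  shift _ (inj₂ (pos (suc i))) = inj₂ (pos i)

  unit : ∀ {Γ} {ss : Fin zero → S} → Ren (Γ ⊕ Pos ss) Γ
  unit _ (inj₁ v)        = v
  unit _ (inj₂ (pos ()))

module _ {ℓ} {S : Set ℓ} (L : Signature S) where
  open Signature L

  data Term (Γ : Ctx S) : S → Set ℓ where
    var : ∀ {s} → Γ s → Term Γ s
    app : (f : Fun) → ((i : Fin (funArity f)) → Term Γ (dom f i)) → Term Γ (cod f)

  infix  8 _≐_
  infixr 7 _∧′_
  infixr 6 _∨′_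
  infixr 5 _⇒′_

  data Formula (Γ : Ctx S) : Set ℓ where
    _≐_            : ∀ {s} → Term Γ s → Term Γ s → Formula Γ
    rel            : (R : Rel) → ((i : Fin (relArity R)) → Term Γ (rdom R i)) → Formula Γ
    ⊥′             : Formula Γ
    _∧′_ _∨′_ _⇒′_ : Formula Γ → Formula Γ → Formula Γ
    ∀′ ∃′          : (s : S) → Formula (Γ ▸ s) → Formula Γ

  Sentence : Set ℓ
  Sentence = Formula ∅

  Theory : Set (lsuc ℓ)
  Theory = Pred Sentence ℓ

module _ {ℓ} {S : Set ℓ} {L : Signature S} where

  ⊤′ : ∀ {Γ} → Formula L Γ
  ⊤′ = ⊥′ ⇒′ ⊥′

  ¬′_ : ∀ {Γ} → Formula L Γ → Formula L Γ
  ¬′ φ = φ ⇒′ ⊥′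

  renameᵗ : ∀ {Γ Δ s} → Ren Γ Δ → Term L Γ s → Term L Δ s
  renameᵗ r (var v)    = var (r _ v)
  renameᵗ r (app f ts) = app f λ i → renameᵗ r (ts i)

  rename : ∀ {Γ Δ} → Ren Γ Δ → Formula L Γ → Formula L Δ
  rename r (t ≐ u)    = renameᵗ r t ≐ renameᵗ r u
  rename r (rel R ts) = rel R λ i → renameᵗ r (ts i)
  rename r ⊥′         = ⊥′
  rename r (φ ∧′ ψ)   = rename r φ ∧′ rename r ψ
  rename r (φ ∨′ ψ)   = rename r φ ∨′ rename r ψ
  rename r (φ ⇒′ ψ)   = rename r φ ⇒′ rename r ψ
  rename r (∀′ s φ)   = ∀′ s (rename (lift r) φ)
  rename r (∃′ s φ)   = ∃′ s (rename (lift r) φ)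

  ∀* : ∀ {Γ n} (ss : Fin n → S) → Formula L (Γ ⊕ Pos ss) → Formula L Γ
  ∀* {n = zero}  ss φ = rename unit φ
  ∀* {n = suc n} ss φ = ∀′ (ss zero) (∀* (ss ∘ suc) (rename shift φ))

  module _ {n} (ss : Fin n → S) (E : Formula L (Pos ss ⊕ Pos ss)) where

    reflexivity symmetry transitivity equivalence : Sentence L
    reflexivity = ∀* ss (rename [ x , x ]ʳ E)
      where
      x : Ren (Pos ss) (∅ ⊕ Pos ss)
      x _ = inj₂
    symmetry = ∀* ss (∀* ss (rename [ x , y ]ʳ E ⇒′ rename [ y , x ]ʳ E))
      where
      x y : Ren (Pos ss) (∅ ⊕ Pos ss ⊕ Pos ss)
      x _ = inj₁ ∘ inj₂
      y _ = inj₂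
    transitivity = ∀* ss (∀* ss (∀* ss
      (rename [ x , y ]ʳ E ⇒′ rename [ y , z ]ʳ E ⇒′ rename [ x , z ]ʳ E)))
      where
      x y z : Ren (Pos ss) (∅ ⊕ Pos ss ⊕ Pos ss ⊕ Pos ss)
      x _ = inj₁ ∘ inj₁ ∘ inj₂
      y _ = inj₁ ∘ inj₂
      z _ = inj₂
    equivalence = reflexivity ∧′ symmetry ∧′ transitivity

-- Equality on each sort is an arbitrary congruence, so that quotients
-- can be formed.

record Structure {ℓ} {S : Set ℓ} (L : Signature S) c : Set (ℓ ⊔ lsuc c) where
  open Signature L
  infix 4 _≈_
  field
    ∣_∣           : S → Set c
    _≈_           : ∀ {s} → ∣_∣ s → ∣_∣ s → Set c
    isEquivalence : ∀ {s} → IsEquivalence (_≈_ {s})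
    fun           : (f : Fun) → ((i : Fin (funArity f)) → ∣_∣ (dom f i)) → ∣_∣ (cod f)
    fun-cong      : ∀ f {as bs} → (∀ i → as i ≈ bs i) → fun f as ≈ fun f bs
    relation      : (R : Rel) → ((i : Fin (relArity R)) → ∣_∣ (rdom R i)) → Set c
    relation-resp : ∀ R {as bs} → (∀ i → as i ≈ bs i) → relation R as → relation R bs

  module ≈ {s} = IsEquivalence (isEquivalence {s})

module Semantics {ℓ c} {S : Set ℓ} {L : Signature S} (M : Structure L c) where
  open Structure M

  Env : Ctx S → Set (ℓ ⊔ c)
  Env Γ = ∀ s → Γ s → ∣_∣ s

  _≋_ : ∀ {Γ} → Env Γ → Env Γ → Set (ℓ ⊔ c)
  ρ ≋ ρ′ = ∀ s v → ρ s v ≈ ρ′ s v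

  ε : Env ∅
  ε s ()

  infixl 6 _++_ _,,_

  _++_ : ∀ {Γ Δ} → Env Γ → Env Δ → Env (Γ ⊕ Δ)
  (ρ ++ σ) s (inj₁ v) = ρ s v
  (ρ ++ σ) s (inj₂ v) = σ s v

  _,,_ : ∀ {Γ s} → Env Γ → ∣_∣ s → Env (Γ ▸ s)
  (ρ ,, a) s (inj₁ v)    = ρ s v
  (ρ ,, a) _ (inj₂ refl) = a

  args : ∀ {n} {ss : Fin n → S} → (∀ i → ∣_∣ (ss i)) → Env (Pos ss)
  args as _ (pos i) = as i

  ⟦_⟧ : ∀ {Γ s} → Term L Γ s → Env Γ → ∣_∣ s
  ⟦ var v ⟧    ρ = ρ _ v
  ⟦ app f ts ⟧ ρ = fun f λ i → ⟦ ts i ⟧ ρ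

  infix 3 ⊨_[_]

  ⊨_[_] : ∀ {Γ} → Formula L Γ → Env Γ → Set c
  ⊨ t ≐ u    [ ρ ] = ⟦ t ⟧ ρ ≈ ⟦ u ⟧ ρ
  ⊨ rel R ts [ ρ ] = relation R λ i → ⟦ ts i ⟧ ρ
  ⊨ ⊥′       [ ρ ] = Lift c ⊥
  ⊨ φ ∧′ ψ   [ ρ ] = (⊨ φ [ ρ ]) × (⊨ ψ [ ρ ])
  ⊨ φ ∨′ ψ   [ ρ ] = (⊨ φ [ ρ ]) ⊎ (⊨ ψ [ ρ ])
  ⊨ φ ⇒′ ψ   [ ρ ] = (⊨ φ [ ρ ]) → (⊨ ψ [ ρ ])
  ⊨ ∀′ s φ   [ ρ ] = ∀ a → ⊨ φ [ ρ ,, a ]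
  ⊨ ∃′ s φ   [ ρ ] = ∃ λ a → ⊨ φ [ ρ ,, a ]

  Models : Theory L → Set (ℓ ⊔ c)
  Models T = ∀ φ → T φ → ⊨ φ [ ε ]

  Consistent : ∀ {X Γ} → Env Γ → Pred (Formula L (X ⊕ Γ)) c → Set (ℓ ⊔ c)
  Consistent {X} ρ p = ∀ φs → All p φs → ∃[ x ] All (λ φ → ⊨ φ [ x ++ ρ ]) φs

  -- Every small type over a small set of parameters is realised; as
  -- everywhere below, the variables of a type form any small tuple.
  Saturated : Set (lsuc ℓ ⊔ lsuc c)
  Saturated = ∀ {X A : Ctx S} (ρ : Env A) (p : Pred (Formula L (X ⊕ A)) c) →
              Consistent ρ p → ∃[ x ] (∀ φ → p φ → ⊨ φ [ x ++ ρ ])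

  ⟦⟧-rename : ∀ {Γ Δ s} (t : Term L Γ s) (r : Ren Γ Δ) {ρ : Env Γ} {σ : Env Δ} →
              (∀ u v → ρ u v ≈ σ u (r u v)) → ⟦ t ⟧ ρ ≈ ⟦ renameᵗ r t ⟧ σ
  ⟦⟧-rename (var v)    r h = h _ v
  ⟦⟧-rename (app f ts) r h = fun-cong f λ i → ⟦⟧-rename (ts i) r h

  lift-≈ : ∀ {Γ Δ s} (r : Ren Γ Δ) {ρ : Env Γ} {σ : Env Δ} (a : ∣_∣ s) →
           (∀ u v → ρ u v ≈ σ u (r u v)) →
           ∀ u v → (ρ ,, a) u v ≈ (σ ,, a) u (lift r u v)
  lift-≈ r a h u  (inj₁ v)    = h u v
  lift-≈ r a h _ (inj₂ refl) = ≈.refl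

  ⊨-rename : ∀ {Γ Δ} (φ : Formula L Γ) (r : Ren Γ Δ) {ρ : Env Γ} {σ : Env Δ} →
             (∀ u v → ρ u v ≈ σ u (r u v)) → (⊨ φ [ ρ ]) ⇔ (⊨ rename r φ [ σ ])
  ⊨-rename (t ≐ u) r h = mk⇔
    (λ e → ≈.trans (≈.sym (⟦⟧-rename t r h)) (≈.trans e (⟦⟧-rename u r h)))
    (λ e → ≈.trans (⟦⟧-rename t r h) (≈.trans e (≈.sym (⟦⟧-rename u r h))))
  ⊨-rename (rel R ts) r h = mk⇔
    (relation-resp R λ i → ⟦⟧-rename (ts i) r h)
    (relation-resp R λ i → ≈.sym (⟦⟧-rename (ts i) r h))
  ⊨-rename ⊥′ r h = mk⇔ (λ z → z) (λ z → z)
  ⊨-rename (φ ∧′ ψ) r h = mk⇔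
    (λ (p , q) → to (⊨-rename φ r h) p , to (⊨-rename ψ r h) q)
    (λ (p , q) → from (⊨-rename φ r h) p , from (⊨-rename ψ r h) q)
  ⊨-rename (φ ∨′ ψ) r h = mk⇔
    (λ { (inj₁ p) → inj₁ (to (⊨-rename φ r h) p) ; (inj₂ q) → inj₂ (to (⊨-rename ψ r h) q) })
    (λ { (inj₁ p) → inj₁ (from (⊨-rename φ r h) p) ; (inj₂ q) → inj₂ (from (⊨-rename ψ r h) q) })
  ⊨-rename (φ ⇒′ ψ) r h = mk⇔
    (λ g p → to (⊨-rename ψ r h) (g (from (⊨-rename φ r h) p)))
    (λ g p → from (⊨-rename ψ r h) (g (to (⊨-rename φ r h) p)))
  ⊨-rename (∀′ s φ) r h = mk⇔
    (λ g a → to (⊨-rename φ (lift r) (lift-≈ r a h)) (g a))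
    (λ g a → from (⊨-rename φ (lift r) (lift-≈ r a h)) (g a))
  ⊨-rename (∃′ s φ) r h = mk⇔
    (λ (a , p) → a , to (⊨-rename φ (lift r) (lift-≈ r a h)) p)
    (λ (a , p) → a , from (⊨-rename φ (lift r) (lift-≈ r a h)) p)

  ⊨-resp : ∀ {Γ} (φ : Formula L Γ) {ρ σ : Env Γ} → ρ ≋ σ → ⊨ φ [ ρ ] → ⊨ φ [ σ ]
  ⊨-resp φ h p = from (⊨-rename φ (λ _ v → v) (λ _ _ → ≈.refl))
                      (to (⊨-rename φ (λ _ v → v) h) p)

  ∀*-elim : ∀ {Γ n} {ss : Fin n → S} (φ : Formula L (Γ ⊕ Pos ss)) {ρ : Env Γ} →
            ⊨ ∀* ss φ [ ρ ] → ∀ as → ⊨ φ [ ρ ++ args as ]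
  ∀*-elim {Γ} {zero} {ss} φ {ρ} p as = from
    (⊨-rename φ unit {ρ ++ args as} {ρ}
      λ { _ (inj₁ v) → ≈.refl ; _ (inj₂ (pos ())) }) p
  ∀*-elim {Γ} {suc n} {ss} φ {ρ} p as = from
    (⊨-rename φ shift {ρ ++ args as} {ρ ,, as zero ++ args (λ i → as (suc i))}
      λ { _ (inj₁ v)             → ≈.refl
        ; _ (inj₂ (pos zero))    → ≈.refl
        ; _ (inj₂ (pos (suc i))) → ≈.refl })
    (∀*-elim (rename shift φ) (p (as zero)) (λ i → as (suc i)))

  module _ {n} {ss : Fin n → S} (E : Formula L (Pos ss ⊕ Pos ss))
           (h : ⊨ equivalence ss E [ ε ]) where

    private
      _~_ : (as bs : ∀ i → ∣_∣ (ss i)) → Set c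
      as ~ bs = ⊨ E [ args as ++ args bs ]

      sub : ∀ {Γ} {x y : Ren (Pos ss) Γ} {ρ : Env Γ} {as bs : ∀ i → ∣_∣ (ss i)} →
            (∀ i → as i ≡ ρ _ (x _ (pos i))) → (∀ i → bs i ≡ ρ _ (y _ (pos i))) →
            (as ~ bs) ⇔ (⊨ rename [ x , y ]ʳ E [ ρ ])
      sub {x = x} {y} e e′ = ⊨-rename E [ x , y ]ʳ
        λ { _ (inj₁ (pos i)) → ≈.reflexive (e i) ; _ (inj₂ (pos i)) → ≈.reflexive (e′ i) }

    defines-equivalence : IsEquivalence _~_
    defines-equivalence = record
      { refl  = λ {a} → from (sub {as = a} {a} (λ _ → refl) (λ _ → refl))
                  (∀*-elim _ (proj₁ h) a)
      ; sym   = λ {a} {b} p → from (sub {as = b} {a} (λ _ → refl) (λ _ → refl))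
                  (∀*-elim _ (∀*-elim _ (proj₁ (proj₂ h)) a) b
                    (to (sub {as = a} {b} (λ _ → refl) (λ _ → refl)) p))
      ; trans = λ {a} {b} {d} p q → from (sub {as = a} {d} (λ _ → refl) (λ _ → refl))
                  (∀*-elim _ (∀*-elim _ (∀*-elim _ (proj₂ (proj₂ h)) a) b) d
                    (to (sub {as = a} {b} (λ _ → refl) (λ _ → refl)) p)
                    (to (sub {as = b} {d} (λ _ → refl) (λ _ → refl)) q))
      }

open Semantics using (Models; Saturated)

-- Theories are taken to be deductively closed, so that completeness is
-- membership of φ or of ¬φ; consistency comes from the model at hand.

Complete : ∀ {ℓ} {S : Set ℓ} {L : Signature S} → Theory L → Set ℓ
Complete T = ∀ φ → T φ ⊎ T (¬′ φ)

-- The sorts of T^eq: those of T, and one for each tuple of sorts with a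
-- ∅-definable equivalence relation E on it.  In M^eq the elements of
-- quot ss E are the tuples of sorts ss, two tuples being equal when they
-- are E-equivalent; proj ss E sends a tuple to its E-class.

module _ {ℓ} {S : Set ℓ} {L : Signature S} (T : Theory L) where
  open Signature L

  data EqSort : Set ℓ where
    home : S → EqSort
    quot : ∀ {n} (ss : Fin n → S) (E : Formula L (Pos ss ⊕ Pos ss)) →
           T (equivalence ss E) → EqSort

  data EqFun : Set ℓ where
    base : Fun → EqFun
    proj : ∀ {n} (ss : Fin n → S) (E : Formula L (Pos ss ⊕ Pos ss)) →
           T (equivalence ss E) → EqFun

  private
    eqFunArity : EqFun → ℕ
    eqFunArity (base f)           = funArity f
    eqFunArity (proj {n} ss E t)  = n

    eqDom : (f : EqFun) → Fin (eqFunArity f) → EqSort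
    eqDom (base f)      i = home (dom f i)
    eqDom (proj ss E t) i = home (ss i)

    eqCod : EqFun → EqSort
    eqCod (base f)      = home (cod f)
    eqCod (proj ss E t) = quot ss E t

  Lᵉ : Signature EqSort
  Lᵉ = record
    { Fun = EqFun ; Rel = Rel
    ; funArity = eqFunArity ; dom = eqDom ; cod = eqCod
    ; relArity = relArity ; rdom = λ R i → home (rdom R i) }

  module _ {c} (M : Structure L c) (M⊨T : Models M T) where
    open Structure M
    open Semantics M

    private
      carrier : EqSort → Set c
      carrier (home s)             = ∣_∣ s
      carrier (quot {n} ss E t)    = (i : Fin n) → ∣_∣ (ss i)

      equal : ∀ s → carrier s → carrier s → Set c
      equal (home s)       a  b  = a ≈ b
      equal (quot ss E t) as bs = ⊨ E [ args as ++ args bs ]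

      equal-equiv : ∀ s → IsEquivalence (equal s)
      equal-equiv (home s)      = isEquivalence
      equal-equiv (quot ss E t) = defines-equivalence E (M⊨T _ t)

      eqFun : (f : EqFun) → ((i : Fin (eqFunArity f)) → carrier (eqDom f i)) → carrier (eqCod f)
      eqFun (base f)      as = fun f as
      eqFun (proj ss E t) as = as

      eqFun-cong : ∀ f {as bs} → (∀ i → equal (eqDom f i) (as i) (bs i)) →
                   equal (eqCod f) (eqFun f as) (eqFun f bs)
      eqFun-cong (base f) h = fun-cong f h
      eqFun-cong (proj ss E t) {as} {bs} h =
        ⊨-resp E (λ { _ (inj₁ (pos i)) → ≈.refl ; _ (inj₂ (pos i)) → h i })
               (IsEquivalence.refl (equal-equiv (quot ss E t)) {as})

    _ᵉ : Structure Lᵉ c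
    _ᵉ = record
      { ∣_∣ = carrier ; _≈_ = λ {s} → equal s
      ; isEquivalence = λ {s} → equal-equiv s
      ; fun = eqFun ; fun-cong = eqFun-cong
      ; relation = relation ; relation-resp = relation-resp }

-- lim f denotes the supremum of the (nonempty, small) family f.

data Ord {ℓ} : Set (lsuc ℓ) where
  zero : Ord
  suc  : Ord {ℓ} → Ord
  lim  : {I : Set ℓ} → I → (I → Ord {ℓ}) → Ord

finite : ∀ {ℓ} → ℕ → Ord {ℓ}
finite zero    = zero
finite (suc n) = suc (finite n)

module Thorn {ℓ c} {S : Set ℓ} {L : Signature S} (M : Structure L c) where
  open Structure M using (∣_∣; _≈_)
  open Semantics M

  -- A small tuple of elements, or a small set given by an enumeration.
  record Tuple : Set (lsuc ℓ ⊔ c) where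
    constructor ⟨_⟩
    field
      {ctx} : Ctx S
      elt   : Env ctx
  open Tuple public

  infixl 6 _∪_
  infix  4 _⊆_

  -- Concatenation of tuples; in particular Ab is A ∪ b.
  _∪_ : Tuple → Tuple → Tuple
  A ∪ B = ⟨ elt A ++ elt B ⟩

  _⊆_ : Tuple → Tuple → Set (ℓ ⊔ c)
  A ⊆ B = ∀ s (i : ctx A s) → ∃[ j ] elt A s i ≈ elt B s j

  reparam : ∀ {X} A B → A ⊆ B → Formula L (X ⊕ ctx A) → Formula L (X ⊕ ctx B)
  reparam A B A⊆B = rename λ { _ (inj₁ v) → inj₁ v
                             ; s (inj₂ i) → inj₂ (proj₁ (A⊆B s i)) }

  FiniteTuple : Tuple → Set ℓ
  FiniteTuple A = FiniteCtx (ctx A)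

  Finite Infinite : ∀ {i Y} → Pred (Env Y) i → Set (i ⊔ ℓ ⊔ c)
  Finite   P = Σ (List (Env _)) λ as → ∀ a → P a → Any (a ≋_) as
  Infinite P = ¬ Finite P

  acl : Tuple → ∀ s → Pred (∣_∣ s) (ℓ ⊔ c)
  acl A s e = Σ (Formula L (∅ ▸ s ⊕ ctx A)) λ φ →
    (⊨ φ [ (ε ,, e) ++ elt A ]) × Finite (λ x → ⊨ φ [ x ++ elt A ])

  -- D is acl(A), as a small set.
  Enumerates-acl : Tuple → Tuple → Set (ℓ ⊔ c)
  Enumerates-acl D A =
    (∀ s (i : ctx D s) → acl A s (elt D s i)) ×
    (∀ s e → acl A s e → ∃[ i ] e ≈ elt D s i)

  Type : Ctx S → Tuple → Set (ℓ ⊔ lsuc c)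
  Type X B = Pred (Formula L (X ⊕ ctx B)) c

  record IsPartialType {X} (B : Tuple) (p : Type X B) : Set (ℓ ⊔ c) where
    field
      consistent : Consistent (elt B) p
      ⊤-closed   : p ⊤′
      ∧-closed   : ∀ {φ ψ} → p φ → p ψ → p (φ ∧′ ψ)

  record IsCompleteType {X} (B : Tuple) (p : Type X B) : Set (ℓ ⊔ c) where
    field
      isPartialType : IsPartialType B p
      decides       : ∀ φ → p φ ⊎ p (¬′ φ)

  tp : (a B : Tuple) → Type (ctx a) B
  tp a B φ = ⊨ φ [ elt a ++ elt B ]

  Realises : ∀ {X} (B : Tuple) → Type X B → Pred (Env X) (ℓ ⊔ c)
  Realises B p x = ∀ φ → p φ → ⊨ φ [ x ++ elt B ]

  record ParFormula (X : Ctx S) : Set (lsuc ℓ ⊔ c) where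
    constructor _⟪_⟫
    field
      {parCtx} : Ctx S
      formula  : Formula L (X ⊕ parCtx)
      param    : Env parCtx
  open ParFormula public

  _⊩_ : ∀ {X} → Env X → ParFormula X → Set c
  x ⊩ φ = ⊨ formula φ [ x ++ param φ ]

  _∧ᵖ_ : ∀ {X} → ParFormula X → ParFormula X → ParFormula X
  (φ ⟪ a ⟫) ∧ᵖ (ψ ⟪ b ⟫) =
    (rename (λ { _ (inj₁ v) → inj₁ v ; _ (inj₂ v) → inj₂ (inj₁ v) }) φ ∧′
     rename (λ { _ (inj₁ v) → inj₁ v ; _ (inj₂ v) → inj₂ (inj₂ v) }) ψ) ⟪ a ++ b ⟫

  Inconsistent : ∀ {i} {X Y} → ℕ → Formula L (X ⊕ Y) → Pred (Env Y) i → Set (i ⊔ ℓ ⊔ c)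
  Inconsistent k δ P = ∀ (as : Fin k → Env _) → (∀ i → P (as i)) →
    (∀ i j → i ≢ j → ¬ (as i ≋ as j)) → ¬ (∃[ x ] ∀ i → ⊨ δ [ x ++ as i ])

  StronglyDivides : ∀ {X} → ParFormula X → Tuple → Set (ℓ ⊔ c)
  StronglyDivides (δ ⟪ a ⟫) A =
    Infinite (Realises A (tp ⟨ a ⟩ A)) ×
    ∃[ k ] Inconsistent k δ (Realises A (tp ⟨ a ⟩ A))

  Þ-divides : ∀ {X} → ParFormula X → Tuple → Set (lsuc ℓ ⊔ c)
  Þ-divides φ A = ∃[ d ] StronglyDivides φ (A ∪ d)

  Þ-forks : ∀ {X} → ParFormula X → Tuple → Set (lsuc ℓ ⊔ c)
  Þ-forks φ A = ∃[ ψs ] All (λ ψ → Þ-divides ψ A) ψs × (∀ x → x ⊩ φ → Any (x ⊩_) ψs)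

  Þ-forksᵗ : ∀ {X} (B : Tuple) → Type X B → Tuple → Set (lsuc ℓ ⊔ c)
  Þ-forksᵗ B p A = ∃[ φ ] p φ × Þ-forks (φ ⟪ elt B ⟫) A

  infix 4 _⫝[_]_

  _⫝[_]_ : (a A b : Tuple) → Set (lsuc ℓ ⊔ c)
  a ⫝[ A ] b = ¬ Þ-forksᵗ (A ∪ b) (tp a (A ∪ b)) A

  module _ {X Y Z : Ctx S} (Δ : Pred (Formula L (X ⊕ Y)) ℓ)
           (Π : Pred (Formula L (Y ⊕ Z)) ℓ) (k : ℕ) where

    Rank≥ : ParFormula X → Ord {ℓ} → Set (ℓ ⊔ c)
    Rank≥ φ zero          = ∃[ x ] x ⊩ φ
    Rank≥ φ (lim {I} _ α) = ∀ i → Rank≥ φ (α i)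
    Rank≥ φ (suc α)       = ∃[ δ ] ∃[ π ] Δ δ × Π π × Σ (Env Z) λ d →
      Infinite (λ a → (⊨ π [ a ++ d ]) × Rank≥ (φ ∧ᵖ (δ ⟪ a ⟫)) α) ×
      Inconsistent k δ (λ a → ⊨ π [ a ++ d ])

    Rank≡ : ParFormula X → Ord {ℓ} → Set (ℓ ⊔ c)
    Rank≡ φ α = Rank≥ φ α × ¬ Rank≥ φ (suc α)

    -- α is the minimum of the ranks of the formulas of p.
    TypeRank≡ : (B : Tuple) → Type X B → Ord {ℓ} → Set (ℓ ⊔ c)
    TypeRank≡ B p α = (∃[ φ ] p φ × Rank≡ (φ ⟪ elt B ⟫) α) ×
                      (∀ φ → p φ → Rank≥ (φ ⟪ elt B ⟫) α)

  Rosy : Set (lsuc ℓ ⊔ lsuc c)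
  Rosy = ∀ {X Y Z : Ctx S} (B : Tuple) (p : Type X B) → IsPartialType B p →
    (Δ : List (Formula L (X ⊕ Y))) (Π : List (Formula L (Y ⊕ Z))) (k : ℕ) →
    ∃[ n ] TypeRank≡ (_∈ Δ) (_∈ Π) k B p (finite n)

{-# OPTIONS --safe #-}

-- The key to left transitivity of þ-independence: if b ⫝_A B and δ(x,B)
-- þ-forks over A, then it þ-forks over Ab through the same formulas.  For by
-- extension b may be replaced by a conjugate independent from the parameters
-- e and z of a formula δ(x,e) strongly dividing over Az; then e cannot become
-- algebraic over Abz, since a formula χ(e,b,z) saying so would itself strongly
-- divide over Az.
--
-- Rosiness enters only through the finiteness of þ-ranks.  If a ⫝_A b but
-- tp(b/Aa) þ-forks over A, choose conjugates a₀,…,aₙ of a over Ab, each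
-- independent over A from b and its predecessors.  By left transitivity
-- aᵢ₊₁…aₙ ⫝_A aᵢ, so tp(b/A aᵢ…aₙ) þ-forks over A aᵢ₊₁…aₙ through the same
-- formulas for every i, and one þ-rank of tp(b/A) exceeds n.  This gives
-- symmetry; existence is the same argument with a constant chain of sets.
--
-- No automorphisms are needed: conjugating a tuple always means extending an
-- elementary map by one more small tuple, which saturation allows.

module Submission where

open import Axiom.ExcludedMiddle using (ExcludedMiddle)
open import Data.Empty using (⊥)
open import Data.Fin.Base using (Fin; zero; suc; inject≤)
import Data.Fin.Properties as Fin
open import Data.List.Base using (List; []; _∷_; map; concat; tabulate; lookup; length; deduplicate) renaming (_++_ to _++ˡ_)
open import Data.List.Membership.Propositional using (_∈_)
open import Data.List.Membership.Propositional.Properties using (∈-++⁺ˡ; ∈-++⁺ʳ; ∈-concat⁺′; ∈-tabulate⁺; ∈-deduplicate⁺; ∈-lookup)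
open import Data.List.Relation.Unary.All using (All; []; _∷_)
import Data.List.Relation.Unary.All as All
import Data.List.Relation.Unary.All.Properties as All
open import Data.List.Relation.Unary.AllPairs using (_∷_)
open import Data.List.Relation.Unary.Any using (Any; here; there)
import Data.List.Relation.Unary.Any as Any
import Data.List.Relation.Unary.Any.Properties as Any
open import Data.List.Relation.Unary.Unique.Propositional using (Unique)
open import Data.List.Relation.Unary.Unique.DecPropositional.Properties using (deduplicate-!)
open import Data.Nat.Base using (ℕ; zero; suc; _+_; _≤_) renaming (_⊔_ to _⊔ℕ_)
import Data.Nat.Properties as ℕ
open import Data.Product.Base using (Σ; ∃; ∃-syntax; _×_; _,_; proj₁; proj₂)
open import Data.Sum.Base using (_⊎_; inj₁; inj₂)
open import Function.Base using (_∘_)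
open import Function.Bundles using (_⇔_; mk⇔; Equivalence)
open import Level using (_⊔_; Lift; lift; lower) renaming (suc to lsuc)
open import Relation.Binary.PropositionalEquality using (_≡_; _≢_; refl; sym; trans; cong; subst)
open import Relation.Nullary.Decidable using (Dec; yes; no; True; toWitness; fromWitness; decidable-stable)
open import Relation.Nullary.Negation using (¬_; contradiction)
open import Relation.Unary using (Pred)
open import Defs renaming (lift to liftʳ)

open Equivalence using (to; from)

-- The obstacle is that þ-dividing speaks of whole types, with parameters of any small length, while
-- þ-rank counts with finitely many formulas δ, π and one k. Every dividing formula is therefore
-- normalised to a parameter-free `Pattern` with parameters. The parameter is cut down to the
-- finitely many coordinates that the formula mentions, after which distinctness of parameters is
-- first-order; compactness then extracts, from k-inconsistency along a type, a single formula π
-- that already enforces it. In this form the base A enters only through the demand that e have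
-- infinitely many conjugates over Az. Moving a forking formula to a larger base thus means
-- preserving non-algebraicity, while δ, π and k stay literally the same, and this is what lets
-- ranks add up along a chain. The forking argument is carried out in an arbitrary saturated
-- structure and applied to C^eq, to which saturation is transferred by translating formulas about
-- imaginaries into formulas about representatives.

-- Free variables, restriction to fewer variables, substitution

module Syntax {ℓ} {S : Set ℓ} (L : Signature S) where
  open Signature L

  Vars : Ctx S → Set ℓ
  Vars Γ = List (Σ S Γ)

  Covers : ∀ {Γ Δ} → Vars Γ → Ren Δ Γ → Set ℓ
  Covers vs r = ∀ {s v} → (s , v) ∈ vs → ∃[ w ] r s w ≡ v

  unbind : ∀ {Γ s} → Vars (Γ ▸ s) → Vars Γ
  unbind []                  = []
  unbind ((t , inj₁ v) ∷ vs) = (t , v) ∷ unbind vs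
  unbind ((t , inj₂ _) ∷ vs) = unbind vs

  ∈-unbind : ∀ {Γ s t v} (vs : Vars (Γ ▸ s)) → (t , inj₁ v) ∈ vs → (t , v) ∈ unbind vs
  ∈-unbind ((_ , inj₁ _) ∷ vs) (here refl) = here refl
  ∈-unbind ((_ , inj₁ _) ∷ vs) (there m)   = there (∈-unbind vs m)
  ∈-unbind ((_ , inj₂ _) ∷ vs) (there m)   = ∈-unbind vs m

  fvᵗ : ∀ {Γ s} → Term L Γ s → Vars Γ
  fvᵗ (var v)    = (_ , v) ∷ []
  fvᵗ (app f ts) = concat (tabulate λ i → fvᵗ (ts i))

  fv : ∀ {Γ} → Formula L Γ → Vars Γ
  fv (t ≐ u)    = fvᵗ t ++ˡ fvᵗ u
  fv (rel R ts) = concat (tabulate λ i → fvᵗ (ts i))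
  fv ⊥′         = []
  fv (φ ∧′ ψ)   = fv φ ++ˡ fv ψ
  fv (φ ∨′ ψ)   = fv φ ++ˡ fv ψ
  fv (φ ⇒′ ψ)   = fv φ ++ˡ fv ψ
  fv (∀′ s φ)   = unbind (fv φ)
  fv (∃′ s φ)   = unbind (fv φ)

  covers-lift : ∀ {Γ Δ s} {vs : Vars (Γ ▸ s)} {r : Ren Δ Γ} →
                Covers (unbind vs) r → Covers vs (liftʳ r)
  covers-lift {vs = vs} cov {v = inj₁ v} m with cov (∈-unbind vs m)
  ... | w , e = inj₁ w , cong inj₁ e
  covers-lift cov {v = inj₂ e} m = inj₂ e , refl

  covers-concat : ∀ {Γ Δ n} {f : Fin n → Vars Γ} {r : Ren Δ Γ} →
                  Covers (concat (tabulate f)) r → ∀ i → Covers (f i) r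
  covers-concat cov i m = cov (∈-concat⁺′ m (∈-tabulate⁺ i))

  restrictᵗ : ∀ {Γ Δ s} (t : Term L Γ s) (r : Ren Δ Γ) → Covers (fvᵗ t) r → Term L Δ s
  restrictᵗ (var v)    r cov = var (proj₁ (cov (here refl)))
  restrictᵗ (app f ts) r cov = app f λ i → restrictᵗ (ts i) r (covers-concat cov i)

  -- Undoes `rename r` for a formula whose free variables all lie in the image of `r`; this is how a
  -- formula over an infinite tuple of variables becomes one over a finite tuple.
  restrict : ∀ {Γ Δ} (φ : Formula L Γ) (r : Ren Δ Γ) → Covers (fv φ) r → Formula L Δ
  restrict (t ≐ u)    r cov = restrictᵗ t r (cov ∘ ∈-++⁺ˡ) ≐ restrictᵗ u r (cov ∘ ∈-++⁺ʳ (fvᵗ t))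
  restrict (rel R ts) r cov = rel R λ i → restrictᵗ (ts i) r (covers-concat cov i)
  restrict ⊥′         r cov = ⊥′
  restrict (φ ∧′ ψ)   r cov = restrict φ r (cov ∘ ∈-++⁺ˡ) ∧′ restrict ψ r (cov ∘ ∈-++⁺ʳ (fv φ))
  restrict (φ ∨′ ψ)   r cov = restrict φ r (cov ∘ ∈-++⁺ˡ) ∨′ restrict ψ r (cov ∘ ∈-++⁺ʳ (fv φ))
  restrict (φ ⇒′ ψ)   r cov = restrict φ r (cov ∘ ∈-++⁺ˡ) ⇒′ restrict ψ r (cov ∘ ∈-++⁺ʳ (fv φ))
  restrict (∀′ s φ)   r cov = ∀′ s (restrict φ (liftʳ r) (covers-lift cov))
  restrict (∃′ s φ)   r cov = ∃′ s (restrict φ (liftʳ r) (covers-lift cov))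

  Sub : Ctx S → Ctx S → Set ℓ
  Sub Γ Δ = ∀ s → Γ s → Term L Δ s

  liftˢ : ∀ {Γ Δ s} → Sub Γ Δ → Sub (Γ ▸ s) (Δ ▸ s)
  liftˢ σ t (inj₁ v) = renameᵗ (λ _ → inj₁) (σ t v)
  liftˢ σ t (inj₂ e) = var (inj₂ e)

  substituteᵗ : ∀ {Γ Δ s} → Sub Γ Δ → Term L Γ s → Term L Δ s
  substituteᵗ σ (var v)    = σ _ v
  substituteᵗ σ (app f ts) = app f λ i → substituteᵗ σ (ts i)

  -- Serves the translation of equality between imaginaries, where real terms take the places of the
  -- two tuples related by E.
  substitute : ∀ {Γ Δ} → Sub Γ Δ → Formula L Γ → Formula L Δ
  substitute σ (t ≐ u)    = substituteᵗ σ t ≐ substituteᵗ σ u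
  substitute σ (rel R ts) = rel R λ i → substituteᵗ σ (ts i)
  substitute σ ⊥′         = ⊥′
  substitute σ (φ ∧′ ψ)   = substitute σ φ ∧′ substitute σ ψ
  substitute σ (φ ∨′ ψ)   = substitute σ φ ∨′ substitute σ ψ
  substitute σ (φ ⇒′ ψ)   = substitute σ φ ⇒′ substitute σ ψ
  substitute σ (∀′ s φ)   = ∀′ s (substitute (liftˢ σ) φ)
  substitute σ (∃′ s φ)   = ∃′ s (substitute (liftˢ σ) φ)

  ∃* : ∀ {Γ n} (ss : Fin n → S) → Formula L (Γ ⊕ Pos ss) → Formula L Γ
  ∃* {n = zero}  ss φ = rename unit φ
  ∃* {n = suc n} ss φ = ∃′ (ss zero) (∃* (ss ∘ suc) (rename shift φ))

  ⋀ : ∀ {Γ} n → (Fin n → Formula L Γ) → Formula L Γ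
  ⋀ zero    φ = ⊤′
  ⋀ (suc n) φ = φ zero ∧′ ⋀ n (φ ∘ suc)

-- Satisfaction of restricted, substituted and quantified formulas

⇔-→ : ∀ {a b c d} {A : Set a} {B : Set b} {C : Set c} {D : Set d} →
      A ⇔ B → C ⇔ D → (A → C) ⇔ (B → D)
⇔-→ e f = mk⇔ (λ g b → to f (g (from e b))) (λ g a → from f (g (to e a)))

⇔-× : ∀ {a b c d} {A : Set a} {B : Set b} {C : Set c} {D : Set d} →
      A ⇔ B → C ⇔ D → (A × C) ⇔ (B × D)
⇔-× e f = mk⇔ (λ (a , c) → to e a , to f c) (λ (b , d) → from e b , from f d)

⇔-⊎ : ∀ {a b c d} {A : Set a} {B : Set b} {C : Set c} {D : Set d} →
      A ⇔ B → C ⇔ D → (A ⊎ C) ⇔ (B ⊎ D)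
⇔-⊎ e f = mk⇔ (λ { (inj₁ a) → inj₁ (to e a) ; (inj₂ c) → inj₂ (to f c) })
              (λ { (inj₁ b) → inj₁ (from e b) ; (inj₂ d) → inj₂ (from f d) })

module Satisfaction {ℓ c} {S : Set ℓ} {L : Signature S} (M : Structure L c) where
  open Signature L
  open Structure M
  open Semantics M
  open Syntax L

  infixl 7 _∘ʳ_
  infix  4 _≡ᵗ_

  _∘ʳ_ : ∀ {Γ Δ} → Env Δ → Ren Γ Δ → Env Γ
  (ρ ∘ʳ r) s v = ρ s (r s v)

  ≋-refl : ∀ {Γ} {ρ : Env Γ} → ρ ≋ ρ
  ≋-refl _ _ = ≈.refl

  ≋-sym : ∀ {Γ} {ρ σ : Env Γ} → ρ ≋ σ → σ ≋ ρ
  ≋-sym e s v = ≈.sym (e s v)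

  ≋-trans : ∀ {Γ} {ρ σ τ : Env Γ} → ρ ≋ σ → σ ≋ τ → ρ ≋ τ
  ≋-trans e f s v = ≈.trans (e s v) (f s v)

  ++-cong : ∀ {Γ Δ} {ρ ρ′ : Env Γ} {σ σ′ : Env Δ} → ρ ≋ ρ′ → σ ≋ σ′ → (ρ ++ σ) ≋ (ρ′ ++ σ′)
  ++-cong e f s (inj₁ v) = e s v
  ++-cong e f s (inj₂ v) = f s v

  ⊨-rename′ : ∀ {Γ Δ} (φ : Formula L Γ) (r : Ren Γ Δ) {ρ} → (⊨ φ [ ρ ∘ʳ r ]) ⇔ (⊨ rename r φ [ ρ ])
  ⊨-rename′ φ r = ⊨-rename φ r ≋-refl

  ⟦⟧-restrict : ∀ {Γ Δ s} (t : Term L Γ s) (r : Ren Δ Γ) (cov : Covers (fvᵗ t) r) {ρ σ} →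
                σ ≋ (ρ ∘ʳ r) → ⟦ t ⟧ ρ ≈ ⟦ restrictᵗ t r cov ⟧ σ
  ⟦⟧-restrict (var v) r cov {ρ} e with cov (here refl)
  ... | w , refl = ≈.sym (e _ w)
  ⟦⟧-restrict (app f ts) r cov e = fun-cong f λ i → ⟦⟧-restrict (ts i) r (covers-concat cov i) e

  lift-restrict : ∀ {Γ Δ s} (r : Ren Δ Γ) {ρ : Env Γ} {σ : Env Δ} (a : ∣_∣ s) →
                  σ ≋ (ρ ∘ʳ r) → (σ ,, a) ≋ ((ρ ,, a) ∘ʳ liftʳ r)
  lift-restrict r a e s (inj₁ v)    = e s v
  lift-restrict r a e _ (inj₂ refl) = ≈.refl

  ⊨-restrict : ∀ {Γ Δ} (φ : Formula L Γ) (r : Ren Δ Γ) (cov : Covers (fv φ) r) {ρ σ} →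
               σ ≋ (ρ ∘ʳ r) → (⊨ φ [ ρ ]) ⇔ (⊨ restrict φ r cov [ σ ])
  ⊨-restrict (t ≐ u) r cov e = mk⇔
    (λ p → ≈.trans (≈.sym (⟦⟧-restrict t r _ e)) (≈.trans p (⟦⟧-restrict u r _ e)))
    (λ p → ≈.trans (⟦⟧-restrict t r _ e) (≈.trans p (≈.sym (⟦⟧-restrict u r _ e))))
  ⊨-restrict (rel R ts) r cov e = mk⇔
    (relation-resp R λ i → ⟦⟧-restrict (ts i) r _ e)
    (relation-resp R λ i → ≈.sym (⟦⟧-restrict (ts i) r _ e))
  ⊨-restrict ⊥′ r cov e = mk⇔ (λ z → z) (λ z → z)
  ⊨-restrict (φ ∧′ ψ) r cov e = ⇔-× (⊨-restrict φ r _ e) (⊨-restrict ψ r _ e)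
  ⊨-restrict (φ ∨′ ψ) r cov e = ⇔-⊎ (⊨-restrict φ r _ e) (⊨-restrict ψ r _ e)
  ⊨-restrict (φ ⇒′ ψ) r cov e = ⇔-→ (⊨-restrict φ r _ e) (⊨-restrict ψ r _ e)
  ⊨-restrict (∀′ s φ) r cov e = mk⇔
    (λ g a → to (⊨-restrict φ (liftʳ r) _ (lift-restrict r a e)) (g a))
    (λ g a → from (⊨-restrict φ (liftʳ r) _ (lift-restrict r a e)) (g a))
  ⊨-restrict (∃′ s φ) r cov e = mk⇔
    (λ (a , p) → a , to (⊨-restrict φ (liftʳ r) _ (lift-restrict r a e)) p)
    (λ (a , p) → a , from (⊨-restrict φ (liftʳ r) _ (lift-restrict r a e)) p)

  ⟦⟧-substitute : ∀ {Γ Δ s} (σ : Sub Γ Δ) (t : Term L Γ s) {ρ : Env Γ} {ρ′ : Env Δ} →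
                  (∀ u v → ρ u v ≈ ⟦ σ u v ⟧ ρ′) → ⟦ t ⟧ ρ ≈ ⟦ substituteᵗ σ t ⟧ ρ′
  ⟦⟧-substitute σ (var v)    h = h _ v
  ⟦⟧-substitute σ (app f ts) h = fun-cong f λ i → ⟦⟧-substitute σ (ts i) h

  lift-substitute : ∀ {Γ Δ s} (σ : Sub Γ Δ) {ρ : Env Γ} {ρ′ : Env Δ} (a : ∣_∣ s) →
                    (∀ u v → ρ u v ≈ ⟦ σ u v ⟧ ρ′) →
                    ∀ u v → (ρ ,, a) u v ≈ ⟦ liftˢ σ u v ⟧ (ρ′ ,, a)
  lift-substitute σ a h u (inj₁ v)    = ≈.trans (h u v) (⟦⟧-rename (σ u v) (λ _ → inj₁) ≋-refl)
  lift-substitute σ a h _ (inj₂ refl) = ≈.refl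

  ⊨-substitute : ∀ {Γ Δ} (σ : Sub Γ Δ) (φ : Formula L Γ) {ρ : Env Γ} {ρ′ : Env Δ} →
                 (∀ u v → ρ u v ≈ ⟦ σ u v ⟧ ρ′) → (⊨ φ [ ρ ]) ⇔ (⊨ substitute σ φ [ ρ′ ])
  ⊨-substitute σ (t ≐ u) h = mk⇔
    (λ p → ≈.trans (≈.sym (⟦⟧-substitute σ t h)) (≈.trans p (⟦⟧-substitute σ u h)))
    (λ p → ≈.trans (⟦⟧-substitute σ t h) (≈.trans p (≈.sym (⟦⟧-substitute σ u h))))
  ⊨-substitute σ (rel R ts) h = mk⇔
    (relation-resp R λ i → ⟦⟧-substitute σ (ts i) h)
    (relation-resp R λ i → ≈.sym (⟦⟧-substitute σ (ts i) h))
  ⊨-substitute σ ⊥′ h = mk⇔ (λ z → z) (λ z → z)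
  ⊨-substitute σ (φ ∧′ ψ) h = ⇔-× (⊨-substitute σ φ h) (⊨-substitute σ ψ h)
  ⊨-substitute σ (φ ∨′ ψ) h = ⇔-⊎ (⊨-substitute σ φ h) (⊨-substitute σ ψ h)
  ⊨-substitute σ (φ ⇒′ ψ) h = ⇔-→ (⊨-substitute σ φ h) (⊨-substitute σ ψ h)
  ⊨-substitute σ (∀′ s φ) h = mk⇔
    (λ g a → to (⊨-substitute (liftˢ σ) φ (lift-substitute σ a h)) (g a))
    (λ g a → from (⊨-substitute (liftˢ σ) φ (lift-substitute σ a h)) (g a))
  ⊨-substitute σ (∃′ s φ) h = mk⇔
    (λ (a , p) → a , to (⊨-substitute (liftˢ σ) φ (lift-substitute σ a h)) p)
    (λ (a , p) → a , from (⊨-substitute (liftˢ σ) φ (lift-substitute σ a h)) p)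

  unit-args : ∀ {Γ} {ss : Fin zero → S} (ρ : Env Γ) (as : ∀ i → ∣_∣ (ss i)) →
              (ρ ++ args {ss = ss} as) ≋ (ρ ∘ʳ unit)
  unit-args ρ as _ (inj₁ v)        = ≈.refl
  unit-args ρ as _ (inj₂ (pos ()))

  shift-args : ∀ {Γ n} {ss : Fin (suc n) → S} (ρ : Env Γ) (as : ∀ i → ∣_∣ (ss i)) →
               (ρ ++ args as) ≋ ((ρ ,, as zero ++ args (as ∘ suc)) ∘ʳ shift)
  shift-args ρ as _ (inj₁ v)             = ≈.refl
  shift-args ρ as _ (inj₂ (pos zero))    = ≈.refl
  shift-args ρ as _ (inj₂ (pos (suc i))) = ≈.refl

  consᵃ : ∀ {n} {ss : Fin (suc n) → S} → ∣_∣ (ss zero) → (∀ i → ∣_∣ (ss (suc i))) → ∀ i → ∣_∣ (ss i)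
  consᵃ a as zero    = a
  consᵃ a as (suc i) = as i

  ∀*-intro : ∀ {Γ n} {ss : Fin n → S} (φ : Formula L (Γ ⊕ Pos ss)) {ρ : Env Γ} →
             (∀ as → ⊨ φ [ ρ ++ args as ]) → ⊨ ∀* ss φ [ ρ ]
  ∀*-intro {n = zero} φ {ρ} h = to (⊨-rename φ unit (unit-args ρ λ ())) (h λ ())
  ∀*-intro {n = suc n} {ss} φ {ρ} h a = ∀*-intro (rename shift φ) λ as →
    to (⊨-rename φ shift (shift-args {ss = ss} ρ (consᵃ a as))) (h (consᵃ a as))

  ⊨-∃* : ∀ {Γ n} (ss : Fin n → S) (φ : Formula L (Γ ⊕ Pos ss)) {ρ : Env Γ} →
         (⊨ ∃* ss φ [ ρ ]) ⇔ (∃[ as ] ⊨ φ [ ρ ++ args as ])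
  ⊨-∃* {n = zero} ss φ {ρ} = mk⇔
    (λ p → (λ ()) , from (⊨-rename φ unit (unit-args ρ λ ())) p)
    (λ (as , p) → to (⊨-rename φ unit (unit-args ρ as)) p)
  ⊨-∃* {n = suc n} ss φ {ρ} = mk⇔
    (λ (a , p) → let (as , q) = to (⊨-∃* (ss ∘ suc) (rename shift φ)) p in
      consᵃ a as , from (⊨-rename φ shift (shift-args {ss = ss} ρ (consᵃ a as))) q)
    (λ (as , p) → as zero , from (⊨-∃* (ss ∘ suc) (rename shift φ))
      (as ∘ suc , to (⊨-rename φ shift (shift-args {ss = ss} ρ as)) p))

  ⊨-⋀ : ∀ {Γ} n (φ : Fin n → Formula L Γ) {ρ} → (⊨ ⋀ n φ [ ρ ]) ⇔ (∀ i → ⊨ φ i [ ρ ])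
  ⊨-⋀ zero    φ = mk⇔ (λ _ ()) (λ _ z → z)
  ⊨-⋀ (suc n) φ = mk⇔
    (λ { (p , q) zero → p ; (p , q) (suc i) → to (⊨-⋀ n (φ ∘ suc)) q i })
    (λ h → h zero , from (⊨-⋀ n (φ ∘ suc)) (h ∘ suc))

  -- Equality of complete types, that is, conjugacy in the monster model. One inclusion is enough
  -- because negation turns it around.
  _≡ᵗ_ : ∀ {Γ} → Env Γ → Env Γ → Set (ℓ ⊔ c)
  ρ ≡ᵗ σ = ∀ φ → ⊨ φ [ ρ ] → ⊨ φ [ σ ]

  ≡ᵗ-trans : ∀ {Γ} {ρ σ τ : Env Γ} → ρ ≡ᵗ σ → σ ≡ᵗ τ → ρ ≡ᵗ τ
  ≡ᵗ-trans e f φ p = f φ (e φ p)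

  ≡ᵗ-reindex : ∀ {Γ Δ} (r : Ren Γ Δ) {ρ σ : Env Δ} {ρ′ σ′ : Env Γ} → ρ ≡ᵗ σ →
               ρ′ ≋ (ρ ∘ʳ r) → σ′ ≋ (σ ∘ʳ r) → ρ′ ≡ᵗ σ′
  ≡ᵗ-reindex r e h k φ p = from (⊨-rename φ r k) (e (rename r φ) (to (⊨-rename φ r h) p))

-- Classical tools, and formulas on finite parts of infinite tuples

lookup-injective : ∀ {a} {A : Set a} {xs : List A} → Unique xs →
                   ∀ {i j} → lookup xs i ≡ lookup xs j → i ≡ j
lookup-injective (_ ∷ _)  {zero}  {zero}  e = refl
lookup-injective (p ∷ _)  {zero}  {suc j} e = contradiction e (All.lookup p (∈-lookup j))
lookup-injective (p ∷ _)  {suc i} {zero}  e = contradiction (sym e) (All.lookup p (∈-lookup i))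
lookup-injective (_ ∷ ps) {suc i} {suc j} e = cong suc (lookup-injective ps e)

module Classical (em : ∀ {i} → ExcludedMiddle i) where

  byContradiction : ∀ {p} {P : Set p} → ¬ ¬ P → P
  byContradiction = decidable-stable em

  ¬∀⇒∃¬ : ∀ {a p} {A : Set a} {P : A → Set p} → ¬ (∀ x → P x) → ∃[ x ] ¬ P x
  ¬∀⇒∃¬ h = byContradiction λ k → h λ x → byContradiction λ p → k (x , p)

  -- Types are predicates at level c, while the conditions defining them below may live in larger
  -- universes; excluded middle replaces such a condition by a decided one, which is small.
  Resize : ∀ {p} c → Set p → Set c
  Resize c P = Lift c (True (em {P = P}))

  resize : ∀ {p c} {P : Set p} → P → Resize c P
  resize p = lift (fromWitness p)

  unresize : ∀ {p c} {P : Set p} → Resize c P → P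
  unresize p = toWitness (lower p)

  dedupe : ∀ {a} {A : Set a} → List A → List A
  dedupe {A = A} = deduplicate {R = _≡_ {A = A}} λ _ _ → em

  ∈-dedupe : ∀ {a} {A : Set a} {x : A} {xs} → x ∈ xs → x ∈ dedupe xs
  ∈-dedupe {A = A} = ∈-deduplicate⁺ {A = A} λ _ _ → em

  dedupe-unique : ∀ {a} {A : Set a} (xs : List A) → Unique (dedupe xs)
  dedupe-unique {A = A} = deduplicate-! {A = A} λ _ _ → em

  module Support {ℓ} {S : Set ℓ} (L : Signature S) where
    open Syntax L

    ctxOf : ∀ {X : Ctx S} → Vars X → Ctx S
    ctxOf vs = Pos λ i → proj₁ (lookup vs i)

    varOf : ∀ {X : Ctx S} (vs : Vars X) → Ren (ctxOf vs) X
    varOf vs _ (pos i) = proj₂ (lookup vs i)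

    lefts : ∀ (X Γ : Ctx S) → Vars (X ⊕ Γ) → Vars X
    lefts X Γ []                  = []
    lefts X Γ ((s , inj₁ v) ∷ vs) = (s , v) ∷ lefts X Γ vs
    lefts X Γ ((s , inj₂ _) ∷ vs) = lefts X Γ vs

    ∈-lefts : ∀ (X Γ : Ctx S) {s v} (vs : Vars (X ⊕ Γ)) → (s , inj₁ v) ∈ vs → (s , v) ∈ lefts X Γ vs
    ∈-lefts X Γ ((_ , inj₁ _) ∷ vs) (here refl) = here refl
    ∈-lefts X Γ ((_ , inj₁ _) ∷ vs) (there m)   = there (∈-lefts X Γ vs m)
    ∈-lefts X Γ ((_ , inj₂ _) ∷ vs) (there m)   = ∈-lefts X Γ vs m

    -- Repetitions are removed so that values given to the positions of the list are values of the
    -- variables, as `override` requires.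
    fvˡ : ∀ (X : Ctx S) {Γ : Ctx S} → Formula L (X ⊕ Γ) → Vars X
    fvˡ X {Γ} φ = dedupe (lefts X Γ (fv φ))

    onLeft : ∀ {X X′ Γ : Ctx S} → Ren X X′ → Ren (X ⊕ Γ) (X′ ⊕ Γ)
    onLeft r s (inj₁ v) = inj₁ (r s v)
    onLeft r s (inj₂ v) = inj₂ v

    swap : ∀ {X Y : Ctx S} → Ren (X ⊕ Y) (Y ⊕ X)
    swap s (inj₁ v) = inj₂ v
    swap s (inj₂ v) = inj₁ v

    narrow-covers : ∀ {X Γ : Ctx S} (φ : Formula L (X ⊕ Γ)) (vs : Vars X) →
                    (∀ {w} → w ∈ fvˡ X φ → w ∈ vs) →
                    Covers {X ⊕ Γ} {ctxOf vs ⊕ Γ} (fv φ) (onLeft {ctxOf vs} {X} {Γ} (varOf vs))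
    narrow-covers {X} {Γ} φ vs h {s} {inj₁ v} m = at (Any.index m′) (Any.lookup-index m′)
      where
      m′ : (s , v) ∈ vs
      m′ = h (∈-dedupe (∈-lefts X Γ (fv φ) m))
      at : ∀ {s v} i → (s , v) ≡ lookup vs i →
           Σ ((ctxOf vs ⊕ Γ) s) λ w → onLeft {ctxOf vs} {X} {Γ} (varOf vs) s w ≡ inj₁ v
      at i refl = inj₁ (pos i) , refl
    narrow-covers φ vs h {s} {inj₂ v} m = inj₂ v , refl

    narrow : ∀ {X Γ : Ctx S} (φ : Formula L (X ⊕ Γ)) (vs : Vars X) →
             (∀ {w} → w ∈ fvˡ X φ → w ∈ vs) → Formula L (ctxOf vs ⊕ Γ)
    narrow {X} {Γ} φ vs h = restrict φ (onLeft {ctxOf vs} {X} {Γ} (varOf vs)) (narrow-covers {X} {Γ} φ vs h)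

    -- X may be infinite: only the finitely many variables of φ are quantified.
    ∃ˣ : ∀ (X : Ctx S) {Γ : Ctx S} → Formula L (X ⊕ Γ) → Formula L Γ
    ∃ˣ X {Γ} φ = ∃* _ (rename (swap {ctxOf (fvˡ X φ)} {Γ}) (narrow {X} {Γ} φ (fvˡ X φ) λ m → m))

    Copies : ℕ → Ctx S → Ctx S
    Copies k Y s = Fin k × Y s

    copy : ∀ {k Y} → Fin k → Ren Y (Copies k Y)
    copy i s v = i , v

    unless : ∀ {p} {Γ : Ctx S} {P : Set p} → Dec P → Formula L Γ → Formula L Γ
    unless (yes _) φ = ⊤′
    unless (no _)  φ = φ

    equalᶠ : ∀ {n} (ss : Fin n → S) → Formula L (Pos ss ⊕ Pos ss)
    equalᶠ ss = ⋀ _ λ i → var (inj₁ (pos i)) ≐ var (inj₂ (pos i))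

    distinctᶠ : ∀ {n} (ss : Fin n → S) k → Formula L (Copies k (Pos ss))
    distinctᶠ ss k = ⋀ k λ i → ⋀ k λ j →
      unless (i Fin.≟ j) (¬′ (rename [ copy {k} {Pos ss} i , copy {k} {Pos ss} j ]ʳ (equalᶠ ss)))

    -- Distinctness of tuples is first-order only for tuples of finite length, whence the context
    -- `Pos ss`.
    atLeast : ∀ {n} (ss : Fin n → S) {Γ : Ctx S} → ℕ → Formula L (Pos ss ⊕ Γ) → Formula L Γ
    atLeast ss {Γ} k χ = ∃ˣ (Copies k (Pos ss)) {Γ}
      (rename (λ _ → inj₁) (distinctᶠ ss k) ∧′
       ⋀ k λ i → rename (onLeft {Pos ss} {Copies k (Pos ss)} {Γ} (copy {k} {Pos ss} i)) χ)

  -- Infinite sets of tuples and the semantics of counting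

  module Elementary {ℓ c} {S : Set ℓ} {L : Signature S} (M : Structure L c) where
    open Structure M
    open Semantics M
    open Syntax L
    open Support L
    open Satisfaction M
    open Thorn M using (Finite; Infinite; Inconsistent)

    ≡ᵗ-sym : ∀ {Γ : Ctx S} {ρ σ : Env Γ} → ρ ≡ᵗ σ → σ ≡ᵗ ρ
    ≡ᵗ-sym e φ p = byContradiction λ q → lower (e (¬′ φ) (λ r → lift (q r)) p)

    ⊨-narrow : ∀ {X Γ : Ctx S} (φ : Formula L (X ⊕ Γ)) (vs : Vars X) (h : ∀ {w} → w ∈ fvˡ X φ → w ∈ vs)
               {x : Env X} {f : Env (ctxOf vs)} {g : Env Γ} → (x ∘ʳ varOf vs) ≋ f →
               (⊨ φ [ x ++ g ]) ⇔ (⊨ narrow φ vs h [ f ++ g ])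
    ⊨-narrow φ vs h e = ⊨-restrict φ _ (narrow-covers φ vs h)
      λ { s (inj₁ v) → ≈.sym (e s v) ; s (inj₂ v) → ≈.refl }

    override : ∀ {X : Ctx S} {vs : Vars X} → Unique vs → Env X → (f : Env (ctxOf vs)) →
               ∃[ x ] (x ∘ʳ varOf vs) ≋ f
    override {X} {vs} u x₀ f = (λ s v → value s v em) , λ { _ (pos i) → value-pos i em }
      where
      Named : ∀ s → X s → Set ℓ
      Named s v = ∃[ i ] lookup vs i ≡ (s , v)
      value : ∀ s v → Dec (Named s v) → ∣_∣ s
      value s v (yes (i , refl)) = f _ (pos i)
      value s v (no _)           = x₀ s v
      value-pos : ∀ i (d : Dec (Named (proj₁ (lookup vs i)) (proj₂ (lookup vs i)))) →
                  value _ _ d ≈ f _ (pos i)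
      value-pos i (no q) = contradiction (i , refl) q
      value-pos i (yes (j , e)) with lookup-injective u e
      value-pos i (yes (.i , refl)) | refl = ≈.refl

    Pos-η : ∀ {n} {ss : Fin n → S} (f : Env (Pos ss)) → args (λ i → f _ (pos i)) ≋ f
    Pos-η f _ (pos i) = ≈.refl

    swap-++ : ∀ {X Y : Ctx S} (x : Env X) (y : Env Y) → (x ++ y) ≋ ((y ++ x) ∘ʳ swap)
    swap-++ x y s (inj₁ v) = ≈.refl
    swap-++ x y s (inj₂ v) = ≈.refl

    onLeft-++ : ∀ {X X′ Γ : Ctx S} (r : Ren X X′) (x : Env X′) (g : Env Γ) →
                ((x ∘ʳ r) ++ g) ≋ ((x ++ g) ∘ʳ onLeft r)
    onLeft-++ r x g s (inj₁ v) = ≈.refl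
    onLeft-++ r x g s (inj₂ v) = ≈.refl

    -- `x₀` fills the variables of X that φ does not mention; sorts may be empty, so such values
    -- have to be given.
    ⊨-∃ˣ : ∀ (X : Ctx S) {Γ : Ctx S} (φ : Formula L (X ⊕ Γ)) {g} → Env X → (⊨ ∃ˣ X φ [ g ]) ⇔ (∃[ x ] ⊨ φ [ x ++ g ])
    ⊨-∃ˣ X {Γ} φ {g} x₀ = mk⇔
      (λ p → let as , q = to (⊨-∃* _ _) p
                 x , e  = override (dedupe-unique (lefts X Γ (fv φ))) x₀ (args as)
             in x , from (⊨-narrow φ vs (λ m → m) e)
                      (from (⊨-rename φ′ swap (swap-++ _ _)) q))
      (λ (x , p) → from (⊨-∃* _ _) ((λ i → x _ (varOf vs _ (pos i))) ,
         to (⊨-rename φ′ swap (swap-++ _ _))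
           (to (⊨-narrow φ vs (λ m → m) (≋-sym (Pos-η _))) p)))
      where
      vs = fvˡ X φ
      φ′ : Formula L (ctxOf vs ⊕ Γ)
      φ′ = narrow φ vs λ m → m

    -- The form of infinity suited to compactness: `Infinite` amounts to `Many n` for every n, and
    -- for finite tuples each `Many n` is first-order.
    Many : ∀ {p Y} → ℕ → Pred (Env Y) p → Set (p ⊔ ℓ ⊔ c)
    Many {Y = Y} n P = Σ (Fin n → Env Y) λ as →
      (∀ i → P (as i)) × (∀ i j → i ≢ j → ¬ (as i ≋ as j))

    infinite⇒many : ∀ {p Y} {P : Pred (Env Y) p} → Infinite P → ∀ n → Many n P
    infinite⇒many inf zero = (λ ()) , (λ ()) , λ ()
    infinite⇒many {Y = Y} {P = P} inf (suc n) =
      let as , ps , ds = infinite⇒many inf n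
          a , h = ¬∀⇒∃¬ λ h → inf (tabulate as , h)
          p = byContradiction λ q → h λ p → contradiction p q
          fresh : ∀ i → ¬ (a ≋ as i)
          fresh i e = h λ _ → Any.tabulate⁺ i e
      in cons a as
       , (λ { zero → p ; (suc i) → ps i })
       , λ { zero    zero    i≢i → contradiction refl i≢i
           ; zero    (suc j) _   → fresh j
           ; (suc i) zero    _   → fresh i ∘ ≋-sym
           ; (suc i) (suc j) i≢j → ds i j (i≢j ∘ cong suc) }
      where
      cons : ∀ {n} → Env Y → (Fin n → Env Y) → Fin (suc n) → Env Y
      cons a as zero    = a
      cons a as (suc i) = as i

    many⇒infinite : ∀ {p Y} {P : Pred (Env Y) p} → (∀ n → Many n P) → Infinite P
    many⇒infinite many (bs , h) =
      let as , ps , ds = many (suc (length bs))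
          cover i = h (as i) (ps i)
          i , j , i<j , e = Fin.pigeonhole (ℕ.n<1+n _) (Any.index ∘ cover)
      in ds i j (Fin.<⇒≢ i<j) (≋-trans (Any.lookup-index (cover i))
           (subst (λ k → lookup bs k ≋ as j) (sym e) (≋-sym (Any.lookup-index (cover j)))))

    many-map : ∀ {p q Y Z n} {P : Pred (Env Y) p} {Q : Pred (Env Z) q} (f : Env Y → Env Z) →
               (∀ a → P a → Q (f a)) → (∀ a b → P a → P b → f a ≋ f b → a ≋ b) → Many n P → Many n Q
    many-map f g inj (as , ps , ds) =
      f ∘ as , (λ i → g _ (ps i)) , λ i j i≢j e → ds i j i≢j (inj _ _ (ps i) (ps j) e)

    infinite-map : ∀ {p q Y Z} {P : Pred (Env Y) p} {Q : Pred (Env Z) q} (f : Env Y → Env Z) →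
                   (∀ a → P a → Q (f a)) → (∀ a b → P a → P b → f a ≋ f b → a ≋ b) →
                   Infinite P → Infinite Q
    infinite-map {P = P} {Q} f g inj inf = many⇒infinite λ n →
      many-map {P = P} {Q} f g inj (infinite⇒many inf n)

    infinite-mono : ∀ {p q Y} {P : Pred (Env Y) p} {Q : Pred (Env Y) q} →
                    (∀ a → P a → Q a) → Infinite P → Infinite Q
    infinite-mono g inf (bs , h) = inf (bs , λ a p → h a (g a p))

    infinite-⊎ : ∀ {p q Y} {P : Pred (Env Y) p} {Q : Pred (Env Y) q} →
                 Infinite (λ a → P a ⊎ Q a) → Infinite P ⊎ Infinite Q
    infinite-⊎ {P = P} {Q} inf with em {P = Finite P} | em {P = Finite Q}
    ... | no p         | _           = inj₁ p
    ... | _            | no q        = inj₂ q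
    ... | yes (as , p) | yes (bs , q) = contradiction (as ++ˡ bs , λ
      { a (inj₁ x) → Any.++⁺ˡ (p a x) ; a (inj₂ y) → Any.++⁺ʳ as (q a y) }) inf

    infinite-fibre : ∀ {p Y Z} {P : Pred (Env Y) p} (f : Env Y → Env Z) (bs : List (Env Z)) →
                     (∀ a → P a → Any (f a ≋_) bs) → Infinite P →
                     ∃[ b ] Infinite (λ a → P a × (f a ≋ b))
    infinite-fibre f []       h inf = contradiction ([] , λ a p → contradiction (h a p) λ ()) inf
    infinite-fibre {P = P} f (b ∷ bs) h inf
      with infinite-⊎ {P = λ a → P a × (f a ≋ b)} {Q = λ a → P a × Any (f a ≋_) bs}
             (infinite-mono (λ a p → split a p (h a p)) inf)
      where
      split : ∀ a → P a → Any (f a ≋_) (b ∷ bs) → (P a × (f a ≋ b)) ⊎ (P a × Any (f a ≋_) bs)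
      split a p (here e)  = inj₁ (p , e)
      split a p (there m) = inj₂ (p , m)
    ... | inj₁ i = b , i
    ... | inj₂ i with infinite-fibre f bs (λ a → proj₂) i
    ...   | b′ , j = b′ , infinite-mono (λ { a ((p , _) , e) → p , e }) j

    ⊨-equalᶠ : ∀ {n} (ss : Fin n → S) {a b : Env (Pos ss)} → (⊨ equalᶠ ss [ a ++ b ]) ⇔ (a ≋ b)
    ⊨-equalᶠ ss = mk⇔ (λ p → λ { _ (pos i) → to (⊨-⋀ _ _) p i }) (λ e → from (⊨-⋀ _ _) λ i → e _ (pos i))

    Distinct : ∀ {k Y} → Env (Copies k Y) → Set (ℓ ⊔ c)
    Distinct {k} ys = ∀ i j → i ≢ j → ¬ ((ys ∘ʳ copy {k} i) ≋ (ys ∘ʳ copy j))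

    copies : ∀ {k Y} → (Fin k → Env Y) → Env (Copies k Y)
    copies as s (i , v) = as i s v

    ⊨-unless : ∀ {p} {Γ : Ctx S} {P : Set p} (d : Dec P) (φ : Formula L Γ) {ρ} →
               (⊨ unless d φ [ ρ ]) ⇔ (¬ P → ⊨ φ [ ρ ])
    ⊨-unless (yes p) φ = mk⇔ (λ _ q → contradiction p q) (λ _ z → z)
    ⊨-unless (no q)  φ = mk⇔ (λ r _ → r) (λ h → h q)

    ⊨-distinctᶠ : ∀ {n} (ss : Fin n → S) {k} {ys : Env (Copies k (Pos ss))} →
                  (⊨ distinctᶠ ss k [ ys ]) ⇔ Distinct ys
    ⊨-distinctᶠ ss {k} {ys} = mk⇔
      (λ p i j i≢j e → lower (to (⊨-unless (i Fin.≟ j) _) (to (⊨-⋀ k _) (to (⊨-⋀ k _) p i) j) i≢j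
         (to (pair i j) (from (⊨-equalᶠ ss) e))))
      (λ ds → from (⊨-⋀ k _) λ i → from (⊨-⋀ k _) λ j → from (⊨-unless (i Fin.≟ j) _) λ i≢j q →
         lift (ds i j i≢j (to (⊨-equalᶠ ss) (from (pair i j) q))))
      where
      pair : ∀ i j → (⊨ equalᶠ ss [ (ys ∘ʳ copy i) ++ (ys ∘ʳ copy j) ]) ⇔
                     (⊨ rename [ copy i , copy j ]ʳ (equalᶠ ss) [ ys ])
      pair i j = ⊨-rename (equalᶠ ss) _ λ { _ (inj₁ v) → ≈.refl ; _ (inj₂ v) → ≈.refl }

    ⊨-atLeast : ∀ {n} (ss : Fin n → S) {Γ : Ctx S} k (χ : Formula L (Pos ss ⊕ Γ)) {g} → Env (Pos ss) →
                (⊨ atLeast ss k χ [ g ]) ⇔ Many k (λ y → ⊨ χ [ y ++ g ])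
    ⊨-atLeast ss {Γ} k χ {g} y₀ = mk⇔ (λ p → forth (to quantified p)) (λ m → from quantified (back m))
      where
      ψ : Formula L (Copies k (Pos ss) ⊕ Γ)
      ψ = rename (λ _ → inj₁) (distinctᶠ ss k) ∧′ ⋀ k λ i → rename (onLeft (copy i)) χ
      quantified : (⊨ ∃ˣ (Copies k (Pos ss)) ψ [ g ]) ⇔ (∃[ ys ] ⊨ ψ [ ys ++ g ])
      quantified = ⊨-∃ˣ _ ψ (copies λ _ → y₀)
      forth : (∃[ ys ] ⊨ ψ [ ys ++ g ]) → Many k (λ y → ⊨ χ [ y ++ g ])
      forth (ys , q , r) = (λ i → ys ∘ʳ copy i)
        , (λ i → from (⊨-rename χ (onLeft (copy i)) (onLeft-++ (copy i) ys g)) (to (⊨-⋀ k _) r i))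
        , to (⊨-distinctᶠ ss) (from (⊨-rename (distinctᶠ ss k) _ ≋-refl) q)
      back : Many k (λ y → ⊨ χ [ y ++ g ]) → ∃[ ys ] ⊨ ψ [ ys ++ g ]
      back (as , ps , ds) = copies as
        , to (⊨-rename (distinctᶠ ss k) _ ≋-refl) (from (⊨-distinctᶠ ss) ds)
        , from (⊨-⋀ k _) λ i → to (⊨-rename χ (onLeft (copy i)) (onLeft-++ (copy i) (copies as) g)) (ps i)

  -- Compactness and the extension of elementary maps

  module Compactness {ℓ c} {S : Set ℓ} {L : Signature S} (M : Structure L c)
                     (saturated : Semantics.Saturated M) where
    open Structure M
    open Semantics M
    open Syntax L
    open Support L
    open Satisfaction M
    open Elementary M
    open Thorn M using (Inconsistent)

    -- The directed sets Q i need not be definable: they stand for the type of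
    -- all formulas implied by one of them.
    abstract
      compactness : ∀ {i q} {X A : Ctx S} (ρ : Env A) {I : Set i} (Q : I → Pred (Env X) q) → I →
                    (∀ i j → ∃[ k ] ∀ x → Q k x → Q i x × Q j x) → (∀ i → ∃ (Q i)) →
                    ∃[ x ] ∀ i φ → (∀ y → Q i y → ⊨ φ [ y ++ ρ ]) → ⊨ φ [ x ++ ρ ]
      compactness {X = X} {A} ρ {I} Q i₀ directed nonempty =
        let x , h = saturated ρ p consistent in x , λ i φ q → h φ (resize (i , q))
        where
        p : Pred (Formula L (X ⊕ A)) c
        p φ = Resize c (∃[ i ] ∀ y → Q i y → ⊨ φ [ y ++ ρ ])
        below : ∀ φs → All p φs → ∃[ i ] ∀ y → Q i y → All (λ φ → ⊨ φ [ y ++ ρ ]) φs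
        below []       []       = i₀ , λ _ _ → []
        below (φ ∷ φs) (h ∷ hs) =
          let i , f = unresize h ; j , g = below φs hs ; k , d = directed i j in
          k , λ y q → f y (proj₁ (d y q)) ∷ g y (proj₂ (d y q))
        consistent : Consistent ρ p
        consistent φs hs = let i , f = below φs hs ; y , q = nonempty i in y , f y q

      -- The formulas true of `e ++ a` are closed under conjunction, and `∃ˣ Δ φ` carries the
      -- solvability of each of them from a to b.
      extend : ∀ {Γ Δ : Ctx S} {a b : Env Γ} → a ≡ᵗ b → (e : Env Δ) → ∃[ e′ ] (a ++ e) ≡ᵗ (b ++ e′)
      extend {Γ} {Δ} {a} {b} a≡b e = transpose (compactness b {I = I} Q (⊤′ , λ z → z)
        (λ (φ , p) (ψ , q) → (φ ∧′ ψ , p , q) , λ _ r → r)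
        (λ (φ , p) → to (⊨-∃ˣ Δ φ e) (a≡b (∃ˣ Δ φ) (from (⊨-∃ˣ Δ φ e) (e , p)))))
        where
        I : Set (ℓ ⊔ c)
        I = Σ (Formula L (Δ ⊕ Γ)) λ φ → ⊨ φ [ e ++ a ]
        Q : I → Pred (Env Δ) c
        Q (φ , _) x = ⊨ φ [ x ++ b ]
        transpose : (∃[ x ] ∀ i φ → (∀ y → Q i y → ⊨ φ [ y ++ b ]) → ⊨ φ [ x ++ b ]) →
               ∃[ e′ ] (a ++ e) ≡ᵗ (b ++ e′)
        transpose (x , h) = x , ≡ᵗ-reindex swap {ρ = e ++ a} {x ++ b}
          (λ φ p → h (φ , p) φ λ _ q → q) (swap-++ a e) (swap-++ b x)

    module _ {n} {ss : Fin n → S} {Γ : Ctx S} (e : Env (Pos ss)) (g : Env Γ) where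

      private
        I : Set (ℓ ⊔ c)
        I = Σ (Formula L (Pos ss ⊕ Γ)) λ χ → ⊨ χ [ e ++ g ]

      -- To be k distinct solutions of χ, for χ in tp(e/g), is a directed family of conditions on k
      -- copies of a finite tuple; compactness meets them all at once.
      many-conjugates : ∀ k → (∀ χ → ⊨ χ [ e ++ g ] → Many k (λ y → ⊨ χ [ y ++ g ])) →
                        Many k (λ y → (e ++ g) ≡ᵗ (y ++ g))
      many-conjugates k many =
          (λ i → ys ∘ʳ copy i)
        , (λ i χ p → from (⊨-copy χ i ys)
            (proj₂ realised (χ , p) (rename (onLeft (copy i)) χ) λ zs (r , _) → to (⊨-copy χ i zs) (r i)))
        , from (⊨-distinct ys)
            (proj₂ realised (⊤′ , λ z → z) (rename (λ _ → inj₁) (distinctᶠ ss k)) λ zs (_ , d) → to (⊨-distinct zs) d)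
        where
        Q : I → Pred (Env (Copies k (Pos ss))) (ℓ ⊔ c)
        Q (χ , _) ys = (∀ i → ⊨ χ [ (ys ∘ʳ copy i) ++ g ]) × Distinct ys
        ⊨-copy : ∀ χ i ys → (⊨ χ [ (ys ∘ʳ copy i) ++ g ]) ⇔ (⊨ rename (onLeft (copy i)) χ [ ys ++ g ])
        ⊨-copy χ i ys = ⊨-rename χ (onLeft (copy i)) (onLeft-++ (copy i) ys g)
        ⊨-distinct : ∀ ys → Distinct ys ⇔ (⊨ rename (λ _ → inj₁) (distinctᶠ ss k) [ ys ++ g ])
        ⊨-distinct ys = mk⇔
          (λ d → to (⊨-rename′ (distinctᶠ ss k) (λ _ → inj₁) {ys ++ g}) (from (⊨-distinctᶠ ss) d))
          (λ p → to (⊨-distinctᶠ ss) (from (⊨-rename′ (distinctᶠ ss k) (λ _ → inj₁) {ys ++ g}) p))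
        realised = compactness g Q (⊤′ , λ z → z)
          (λ (φ , p) (ψ , q) → (φ ∧′ ψ , p , q) ,
             λ y (r , d) → ((λ i → proj₁ (r i)) , d) , ((λ i → proj₂ (r i)) , d))
          (λ (χ , p) → let as , ps , ds = many χ p in copies as , ps , ds)
        ys : Env (Copies k (Pos ss))
        ys = proj₁ realised

      -- If every π in tp(e/g) had k distinct solutions with a common x for δ, compactness would
      -- give k distinct conjugates of e with a common x.
      inconsistent-formula : ∀ {X : Ctx S} k (δ : Formula L (X ⊕ Pos ss)) →
        Inconsistent k δ (λ y → (e ++ g) ≡ᵗ (y ++ g)) →
        ∃[ π ] (⊨ π [ e ++ g ]) × Inconsistent k δ (λ y → ⊨ π [ y ++ g ])
      inconsistent-formula {X} k δ inc = byContradiction λ none →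
        let realised = compactness g Q (⊤′ , λ z → z)
              (λ (φ , p) (ψ , q) → (φ ∧′ ψ , p , q) ,
                 λ y (r , d) → ((λ i → proj₁ (r i)) , d) , ((λ i → proj₂ (r i)) , d))
              (λ (π , p) → byContradiction λ empty → none (π , p , λ as ps ds (x , q) →
                 empty (x ++ copies as , ps , ds , λ i → ⊨-resp δ (split i x as) (q i))))
            z = proj₁ realised
        in inc (λ i → z ∘ʳ y i)
             (λ i π p → from (⊨-copy π i z)
               (proj₂ realised (π , p) (rename (onLeft (y i)) π) λ w (r , _) → to (⊨-copy π i w) (r i)))
             (from (⊨-distinct z)
               (proj₂ realised (⊤′ , λ z → z) (rename (λ _ → inj₁ ∘ inj₂) (distinctᶠ ss k)) λ w (_ , d , _) → to (⊨-distinct w) d))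
             ((z ∘ʳ λ _ → inj₁) , λ i → from (⊨-xy i z)
               (proj₂ realised (⊤′ , λ z → z) (rename (xy i) δ) λ w (_ , _ , q) → to (⊨-xy i w) (q i)))
        where
        y : Fin k → Ren (Pos ss) (X ⊕ Copies k (Pos ss))
        y i s v = inj₂ (i , v)
        xy : Fin k → Ren (X ⊕ Pos ss) (X ⊕ Copies k (Pos ss) ⊕ Γ)
        xy i = [ (λ _ → inj₁ ∘ inj₁) , (λ _ v → inj₁ (inj₂ (i , v))) ]ʳ
        xy-++ : ∀ i (z : Env (X ⊕ Copies k (Pos ss))) →
                ((z ∘ʳ λ _ → inj₁) ++ (z ∘ʳ y i)) ≋ ((z ++ g) ∘ʳ xy i)
        xy-++ i z s (inj₁ v) = ≈.refl
        xy-++ i z s (inj₂ v) = ≈.refl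
        ⊨-xy : ∀ i z → (⊨ δ [ (z ∘ʳ λ _ → inj₁) ++ (z ∘ʳ y i) ]) ⇔ (⊨ rename (xy i) δ [ z ++ g ])
        ⊨-xy i z = ⊨-rename δ (xy i) (xy-++ i z)
        split : ∀ i (x : Env X) (as : Fin k → Env (Pos ss)) →
                (x ++ as i) ≋ (((x ++ copies as) ∘ʳ λ _ → inj₁) ++ ((x ++ copies as) ∘ʳ y i))
        split i x as s (inj₁ v) = ≈.refl
        split i x as s (inj₂ v) = ≈.refl
        Apart : Env (X ⊕ Copies k (Pos ss)) → Set (ℓ ⊔ c)
        Apart z = ∀ i j → i ≢ j → ¬ ((z ∘ʳ y i) ≋ (z ∘ʳ y j))
        Q : I → Pred (Env (X ⊕ Copies k (Pos ss))) (ℓ ⊔ c)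
        Q (π , _) z = (∀ i → ⊨ π [ (z ∘ʳ y i) ++ g ]) × Apart z
                    × (∀ i → ⊨ δ [ (z ∘ʳ λ _ → inj₁) ++ (z ∘ʳ y i) ])
        ⊨-copy : ∀ π i z → (⊨ π [ (z ∘ʳ y i) ++ g ]) ⇔ (⊨ rename (onLeft (y i)) π [ z ++ g ])
        ⊨-copy π i z = ⊨-rename π (onLeft (y i)) (onLeft-++ (y i) z g)
        ⊨-distinct : ∀ z → Apart z ⇔ (⊨ rename (λ _ → inj₁ ∘ inj₂) (distinctᶠ ss k) [ z ++ g ])
        ⊨-distinct z = mk⇔
          (λ d → to (⊨-rename′ (distinctᶠ ss k) (λ _ → inj₁ ∘ inj₂) {z ++ g}) (from (⊨-distinctᶠ ss {ys = z ∘ʳ λ _ → inj₂}) d))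
          (λ p → to (⊨-distinctᶠ ss {ys = z ∘ʳ λ _ → inj₂}) (from (⊨-rename′ (distinctᶠ ss k) (λ _ → inj₁ ∘ inj₂) {z ++ g}) p))

-- Transfer of saturation to imaginaries

module Imaginaries (em : ∀ {i} → ExcludedMiddle i) {ℓ c} {S : Set ℓ} {L : Signature S}
                   (T : Theory L) (M : Structure L c) (M⊨T : Semantics.Models M T)
                   (saturated : Semantics.Saturated M) where
  open Classical em
  open Signature L
  open Syntax L
  open Structure M
  open Semantics M
  open Satisfaction M
  open Compactness M saturated

  Mᵉ : Structure (Lᵉ T) c
  Mᵉ = _ᵉ T M M⊨T

  module Mᵉ = Structure Mᵉ
  module Eq = Semantics Mᵉ

  reflᵉ : ∀ s (a : Mᵉ.∣ s ∣) → Mᵉ._≈_ {s} a a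
  reflᵉ s a = Mᵉ.≈.refl {s} {a}

  -- An imaginary variable stands for a tuple of real ones.
  data Real (Γ : Ctx (EqSort T)) : Ctx S where
    real  : ∀ {s} → Γ (home s) → Real Γ s
    coord : ∀ {n} {ss : Fin n → S} {E t} → Γ (quot ss E t) → (i : Fin n) → Real Γ (ss i)

  realEnv : ∀ {Γ : Ctx (EqSort T)} → Eq.Env Γ → Env (Real Γ)
  realEnv ρ _ (real v)    = ρ _ v
  realEnv ρ _ (coord v i) = ρ _ v i

  eqEnv : ∀ {Γ : Ctx (EqSort T)} → Env (Real Γ) → Eq.Env Γ
  eqEnv ρ (home s)      v = ρ s (real v)
  eqEnv ρ (quot ss E t) v = λ i → ρ (ss i) (coord v i)

  RealTerm : Ctx (EqSort T) → EqSort T → Set ℓ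
  RealTerm Γ (home s)          = Term L (Real Γ) s
  RealTerm Γ (quot {n} ss E t) = (i : Fin n) → Term L (Real Γ) (ss i)

  realVar : ∀ {Γ : Ctx (EqSort T)} s → Γ s → RealTerm Γ s
  realVar (home s)      v = var (real v)
  realVar (quot ss E t) v = λ i → var (coord v i)

  realTerm : ∀ {Γ : Ctx (EqSort T)} {s} → Term (Lᵉ T) Γ s → RealTerm Γ s
  realTerm (var {s} v)            = realVar s v
  realTerm (app (base f) ts)      = app f λ i → realTerm (ts i)
  realTerm (app (proj ss E t) ts) = λ i → realTerm (ts i)

  evaluate : ∀ {Γ : Ctx (EqSort T)} s → RealTerm Γ s → Env (Real Γ) → Mᵉ.∣ s ∣
  evaluate (home s)      t  ρ = ⟦ t ⟧ ρ
  evaluate (quot ss E t) ts ρ = λ i → ⟦ ts i ⟧ ρ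

  realVar-correct : ∀ {Γ : Ctx (EqSort T)} s (v : Γ s) (ρ : Env (Real Γ)) →
                    Mᵉ._≈_ {s} (evaluate s (realVar s v) ρ) (eqEnv ρ s v)
  realVar-correct (home s)      v ρ = ≈.refl
  realVar-correct (quot ss E t) v ρ = reflᵉ (quot ss E t) (eqEnv ρ (quot ss E t) v)

  realTerm-correct : ∀ {Γ : Ctx (EqSort T)} {s} (t : Term (Lᵉ T) Γ s) (ρ : Env (Real Γ)) →
                     Mᵉ._≈_ {s} (evaluate s (realTerm t) ρ) (Eq.⟦ t ⟧ (eqEnv ρ))
  realTerm-correct (var {s} v)            ρ = realVar-correct s v ρ
  realTerm-correct (app (base f) ts)      ρ = Mᵉ.fun-cong (base f) λ i → realTerm-correct (ts i) ρ
  realTerm-correct (app (proj ss E t) ts) ρ = Mᵉ.fun-cong (proj ss E t) λ i → realTerm-correct (ts i) ρ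

  equation : ∀ {Γ : Ctx (EqSort T)} s (t u : RealTerm Γ s) → Formula L (Real Γ)
  equation (home s)      t  u  = t ≐ u
  equation (quot ss E _) ts us =
    substitute (λ { _ (inj₁ (pos i)) → ts i ; _ (inj₂ (pos i)) → us i }) E

  ⊨-equation : ∀ {Γ : Ctx (EqSort T)} s (t u : RealTerm Γ s) (ρ : Env (Real Γ)) →
               (⊨ equation s t u [ ρ ]) ⇔ Mᵉ._≈_ {s} (evaluate s t ρ) (evaluate s u ρ)
  ⊨-equation (home s)      t  u  ρ = mk⇔ (λ e → e) (λ e → e)
  ⊨-equation (quot ss E _) ts us ρ = mk⇔ (from ⊨E) (to ⊨E)
    where ⊨E = ⊨-substitute _ E {args (λ i → ⟦ ts i ⟧ ρ) ++ args (λ i → ⟦ us i ⟧ ρ)} {ρ}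
                 λ { _ (inj₁ (pos i)) → ≈.refl ; _ (inj₂ (pos i)) → ≈.refl }

  unbindʰ : ∀ {Γ : Ctx (EqSort T)} s → Ren (Real (Γ ▸ home s)) (Real Γ ▸ s)
  unbindʰ s _ (real (inj₁ v))    = inj₁ (real v)
  unbindʰ s _ (real (inj₂ refl)) = inj₂ refl
  unbindʰ s _ (coord (inj₁ v) i) = inj₁ (coord v i)

  unbindᑫ : ∀ {Γ : Ctx (EqSort T)} {n} (ss : Fin n → S) E t →
            Ren (Real (Γ ▸ quot ss E t)) (Real Γ ⊕ Pos ss)
  unbindᑫ ss E t _ (real (inj₁ v))       = inj₁ (real v)
  unbindᑫ ss E t _ (coord (inj₁ v) i)    = inj₁ (coord v i)
  unbindᑫ ss E t _ (coord (inj₂ refl) i) = inj₂ (pos i)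

  realFormula : ∀ {Γ : Ctx (EqSort T)} → Formula (Lᵉ T) Γ → Formula L (Real Γ)
  realFormula (_≐_ {s} t u) = equation s (realTerm t) (realTerm u)
  realFormula (rel R ts) = rel R λ i → realTerm (ts i)
  realFormula ⊥′         = ⊥′
  realFormula (φ ∧′ ψ)   = realFormula φ ∧′ realFormula ψ
  realFormula (φ ∨′ ψ)   = realFormula φ ∨′ realFormula ψ
  realFormula (φ ⇒′ ψ)   = realFormula φ ⇒′ realFormula ψ
  realFormula (∀′ (home s) φ)      = ∀′ s (rename (unbindʰ s) (realFormula φ))
  realFormula (∀′ (quot ss E t) φ) = ∀* ss (rename (unbindᑫ ss E t) (realFormula φ))
  realFormula (∃′ (home s) φ)      = ∃′ s (rename (unbindʰ s) (realFormula φ))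
  realFormula (∃′ (quot ss E t) φ) = ∃* ss (rename (unbindᑫ ss E t) (realFormula φ))

  Correct : ∀ {Γ : Ctx (EqSort T)} → Formula (Lᵉ T) Γ → Set (ℓ ⊔ c)
  Correct {Γ} φ = ∀ (ρ : Env (Real Γ)) → (⊨ realFormula φ [ ρ ]) ⇔ (Eq.⊨ φ [ eqEnv ρ ])

  bind-home : ∀ {Γ : Ctx (EqSort T)} s (φ : Formula (Lᵉ T) (Γ ▸ home s)) → Correct φ →
              ∀ (ρ : Env (Real Γ)) (a : ∣_∣ s) →
              (⊨ rename (unbindʰ s) (realFormula φ) [ ρ ,, a ]) ⇔ (Eq.⊨ φ [ eqEnv ρ Eq.,, a ])
  bind-home s φ correct ρ a = mk⇔
    (λ p → Eq.⊨-resp φ agree (to (correct ρ′) (from (⊨-rename′ (realFormula φ) (unbindʰ s)) p)))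
    (λ p → to (⊨-rename′ (realFormula φ) (unbindʰ s))
             (from (correct ρ′) (Eq.⊨-resp φ (λ s v → Mᵉ.≈.sym {s} (agree s v)) p)))
    where
    ρ′ = (ρ ,, a) ∘ʳ unbindʰ s
    agree : eqEnv ρ′ Eq.≋ (eqEnv ρ Eq.,, a)
    agree (home t)      (inj₁ v)    = ≈.refl
    agree (quot ss E t) (inj₁ v)    = reflᵉ (quot ss E t) (eqEnv ρ (quot ss E t) v)
    agree (home t)      (inj₂ refl) = ≈.refl

  bind-quot : ∀ {Γ : Ctx (EqSort T)} {n} (ss : Fin n → S) E t (φ : Formula (Lᵉ T) (Γ ▸ quot ss E t)) →
              Correct φ → ∀ (ρ : Env (Real Γ)) (as : ∀ i → ∣_∣ (ss i)) →
              (⊨ rename (unbindᑫ ss E t) (realFormula φ) [ ρ ++ args as ]) ⇔ (Eq.⊨ φ [ eqEnv ρ Eq.,, as ])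
  bind-quot ss E t φ correct ρ as = mk⇔
    (λ p → Eq.⊨-resp φ agree (to (correct ρ′) (from (⊨-rename′ (realFormula φ) (unbindᑫ ss E t)) p)))
    (λ p → to (⊨-rename′ (realFormula φ) (unbindᑫ ss E t))
             (from (correct ρ′) (Eq.⊨-resp φ (λ s v → Mᵉ.≈.sym {s} (agree s v)) p)))
    where
    ρ′ = (ρ ++ args as) ∘ʳ unbindᑫ ss E t
    agree : eqEnv ρ′ Eq.≋ (eqEnv ρ Eq.,, as)
    agree (home _)         (inj₁ v)    = ≈.refl
    agree (quot ss′ E′ t′) (inj₁ v)    = reflᵉ (quot ss′ E′ t′) (eqEnv ρ (quot ss′ E′ t′) v)
    agree (quot ss′ E′ t′) (inj₂ refl) = reflᵉ (quot ss′ E′ t′) as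

  realFormula-correct : ∀ {Γ : Ctx (EqSort T)} (φ : Formula (Lᵉ T) Γ) → Correct φ
  realFormula-correct (_≐_ {s} t u) ρ = mk⇔
    (λ p → Mᵉ.≈.trans {s} (Mᵉ.≈.sym {s} (realTerm-correct t ρ))
             (Mᵉ.≈.trans {s} (to (⊨-equation s (realTerm t) (realTerm u) ρ) p) (realTerm-correct u ρ)))
    (λ p → from (⊨-equation s (realTerm t) (realTerm u) ρ)
             (Mᵉ.≈.trans {s} (realTerm-correct t ρ) (Mᵉ.≈.trans {s} p (Mᵉ.≈.sym {s} (realTerm-correct u ρ)))))
  realFormula-correct (rel R ts) ρ = mk⇔
    (relation-resp R λ i → realTerm-correct (ts i) ρ)
    (relation-resp R λ i → ≈.sym (realTerm-correct (ts i) ρ))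
  realFormula-correct ⊥′       ρ = mk⇔ (λ z → z) (λ z → z)
  realFormula-correct (φ ∧′ ψ) ρ = ⇔-× (realFormula-correct φ ρ) (realFormula-correct ψ ρ)
  realFormula-correct (φ ∨′ ψ) ρ = ⇔-⊎ (realFormula-correct φ ρ) (realFormula-correct ψ ρ)
  realFormula-correct (φ ⇒′ ψ) ρ = ⇔-→ (realFormula-correct φ ρ) (realFormula-correct ψ ρ)
  realFormula-correct (∀′ (home s) φ) ρ = mk⇔
    (λ h a → to (bind-home s φ (realFormula-correct φ) ρ a) (h a))
    (λ h a → from (bind-home s φ (realFormula-correct φ) ρ a) (h a))
  realFormula-correct (∀′ (quot ss E t) φ) ρ = mk⇔
    (λ h as → to (bind-quot ss E t φ (realFormula-correct φ) ρ as) (∀*-elim _ h as))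
    (λ h → ∀*-intro _ λ as → from (bind-quot ss E t φ (realFormula-correct φ) ρ as) (h as))
  realFormula-correct (∃′ (home s) φ) ρ = mk⇔
    (λ (a , p) → a , to (bind-home s φ (realFormula-correct φ) ρ a) p)
    (λ (a , p) → a , from (bind-home s φ (realFormula-correct φ) ρ a) p)
  realFormula-correct (∃′ (quot ss E t) φ) ρ = mk⇔
    (λ p → let as , q = to (⊨-∃* ss _) p in as , to (bind-quot ss E t φ (realFormula-correct φ) ρ as) q)
    (λ (as , p) → from (⊨-∃* ss _) (as , from (bind-quot ss E t φ (realFormula-correct φ) ρ as) p))

  separate : ∀ {X A : Ctx (EqSort T)} → Ren (Real (X ⊕ A)) (Real X ⊕ Real A)
  separate _ (real (inj₁ v))    = inj₁ (real v)
  separate _ (real (inj₂ v))    = inj₂ (real v)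
  separate _ (coord (inj₁ v) i) = inj₁ (coord v i)
  separate _ (coord (inj₂ v) i) = inj₂ (coord v i)

  ⊨-separate : ∀ {X A : Ctx (EqSort T)} (φ : Formula (Lᵉ T) (X ⊕ A)) (x : Env (Real X)) (a : Eq.Env A) →
               (⊨ rename separate (realFormula φ) [ x ++ realEnv a ]) ⇔ (Eq.⊨ φ [ eqEnv x Eq.++ a ])
  ⊨-separate {X} {A} φ x a = mk⇔
    (λ p → Eq.⊨-resp φ agree (to (realFormula-correct φ ρ) (from (⊨-rename′ (realFormula φ) separate) p)))
    (λ p → to (⊨-rename′ (realFormula φ) separate)
             (from (realFormula-correct φ ρ) (Eq.⊨-resp φ (λ s v → Mᵉ.≈.sym {s} (agree s v)) p)))
    where
    ρ : Env (Real (X ⊕ A))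
    ρ = (x ++ realEnv a) ∘ʳ separate
    agree : eqEnv ρ Eq.≋ (eqEnv x Eq.++ a)
    agree (home s)      (inj₁ v) = ≈.refl
    agree (home s)      (inj₂ v) = ≈.refl
    agree (quot ss E t) (inj₁ v) = reflᵉ (quot ss E t) (eqEnv x (quot ss E t) v)
    agree (quot ss E t) (inj₂ v) = reflᵉ (quot ss E t) (a (quot ss E t) v)

  -- Elements of a sort `quot ss E t` are tuples, so imaginary parameters come with representatives.
  -- A type over them translates to a type of `M` over these representatives, and a realisation by
  -- real tuples, read back through `eqEnv`, realises the original.
  eq-saturated : Eq.Saturated
  eq-saturated {X} {A} ρ p consistent = eqEnv (proj₁ realised) , λ φ q →
    to (⊨-separate φ (proj₁ realised) ρ)
      (proj₂ realised (φ ∷ [] , q ∷ []) (rename separate (realFormula φ))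
        λ { y (r ∷ []) → from (⊨-separate φ y ρ) r })
    where
    Q : Σ (List (Formula (Lᵉ T) (X ⊕ A))) (All p) → Pred (Env (Real X)) (ℓ ⊔ c)
    Q (φs , _) x = All (λ φ → Eq.⊨ φ [ eqEnv x Eq.++ ρ ]) φs
    realised = compactness (realEnv ρ) Q ([] , [])
      (λ (φs , ps) (ψs , qs) → (φs ++ˡ ψs , All.++⁺ ps qs) ,
         λ x r → All.++⁻ˡ φs r , All.++⁻ʳ φs r)
      (λ (φs , ps) → let x , h = consistent φs ps in
         realEnv x , All.map (λ {φ} → Eq.⊨-resp φ (agree x)) h)
      where
      agree : ∀ x → (x Eq.++ ρ) Eq.≋ (eqEnv (realEnv x) Eq.++ ρ)
      agree x (home s)      (inj₁ v) = ≈.refl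
      agree x (home s)      (inj₂ v) = ≈.refl
      agree x (quot ss E t) (inj₁ v) = reflᵉ (quot ss E t) (x (quot ss E t) v)
      agree x (quot ss E t) (inj₂ v) = reflᵉ (quot ss E t) (ρ (quot ss E t) v)

-- Change of base and conjugation for þ-dividing

module Thorn-forking (em : ∀ {i} → ExcludedMiddle i) {ℓ c} {S : Set ℓ} {L : Signature S}
                     (M : Structure L c) (saturated : Semantics.Saturated M) where
  open Classical em
  open Support L public
  open Syntax L public
  open Structure M public
  open Semantics M public
  open Satisfaction M public
  open Elementary M public
  open Compactness M saturated public
  open Thorn M public

  ⊆-refl : ∀ A → A ⊆ A
  ⊆-refl A s i = i , ≈.refl

  ⊆-trans : ∀ {A B D} → A ⊆ B → B ⊆ D → A ⊆ D
  ⊆-trans A⊆B B⊆D s i =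
    let j , e = A⊆B s i ; k , f = B⊆D s j in k , ≈.trans e f

  ⊆-∪ˡ : ∀ A B → A ⊆ A ∪ B
  ⊆-∪ˡ A B s i = inj₁ i , ≈.refl

  ⊆-∪ʳ : ∀ A B → B ⊆ A ∪ B
  ⊆-∪ʳ A B s i = inj₂ i , ≈.refl

  ∪-⊆ : ∀ {A B D} → A ⊆ D → B ⊆ D → A ∪ B ⊆ D
  ∪-⊆ A⊆D B⊆D s (inj₁ i) = A⊆D s i
  ∪-⊆ A⊆D B⊆D s (inj₂ i) = B⊆D s i

  ∪-mono : ∀ {A A′ B B′} → A ⊆ A′ → B ⊆ B′ → A ∪ B ⊆ A′ ∪ B′
  ∪-mono {A′ = A′} {B′ = B′} f g =
    ∪-⊆ (⊆-trans f (⊆-∪ˡ A′ B′)) (⊆-trans g (⊆-∪ʳ A′ B′))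

  ⊨-reparam : ∀ {X : Ctx S} A B (A⊆B : A ⊆ B) (φ : Formula L (X ⊕ ctx A)) {x : Env X} →
              (⊨ φ [ x ++ elt A ]) ⇔ (⊨ reparam A B A⊆B φ [ x ++ elt B ])
  ⊨-reparam A B A⊆B φ = ⊨-rename φ _ λ { s (inj₁ v) → ≈.refl ; s (inj₂ i) → proj₂ (A⊆B s i) }

  -- Definitionally Realises A (tp ⟨ e ⟩ A) y.
  Conjugate : ∀ {Y : Ctx S} → Tuple → Env Y → Env Y → Set (ℓ ⊔ c)
  Conjugate A e y = (e ++ elt A) ≡ᵗ (y ++ elt A)

  conjugate-mono : ∀ {Y : Ctx S} A B (e y : Env Y) → A ⊆ B → Conjugate B e y → Conjugate A e y
  conjugate-mono A B e y A⊆B h φ p =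
    from (⊨-reparam A B A⊆B φ) (h (reparam A B A⊆B φ) (to (⊨-reparam A B A⊆B φ) p))

  inconsistent-mono : ∀ {i j k} {X Y : Ctx S} {δ : Formula L (X ⊕ Y)} {P : Pred (Env Y) i} {Q : Pred (Env Y) j} →
                      (∀ y → Q y → P y) → Inconsistent k δ P → Inconsistent k δ Q
  inconsistent-mono f inc as qs = inc as λ i → f _ (qs i)

  -- The extra tuple allowed in þ-dividing absorbs A′: over A one takes `A′ ∪ d` in place of d.
  divides-base : ∀ {X : Ctx S} (φ : ParFormula X) A A′ → A ⊆ A′ → Þ-divides φ A′ → Þ-divides φ A
  divides-base (δ ⟪ e ⟫) A A′ A⊆A′ (d , inf , k , inc) = A′ ∪ d ,
    infinite-mono (λ y → conjugate-mono (A ∪ (A′ ∪ d)) (A′ ∪ d) e y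
      (∪-⊆ {A} {A′ ∪ d} {A′ ∪ d} (⊆-trans {A} {A′} {A′ ∪ d} A⊆A′ (⊆-∪ˡ A′ d)) (⊆-refl (A′ ∪ d)))) inf ,
    k , inconsistent-mono {δ = δ} (λ y → conjugate-mono (A′ ∪ d) (A ∪ (A′ ∪ d)) e y (⊆-∪ʳ A (A′ ∪ d))) inc

  forks-base : ∀ {X : Ctx S} (φ : ParFormula X) A A′ → A ⊆ A′ → Þ-forks φ A′ → Þ-forks φ A
  forks-base φ A A′ A⊆A′ (ψs , ds , h) = ψs , All.map (λ {ψ} → divides-base ψ A A′ A⊆A′) ds , h

  ≡ᵗ-≈ : ∀ {Γ : Ctx S} {ρ σ : Env Γ} → ρ ≡ᵗ σ → ∀ {s} u v → ρ s u ≈ ρ s v → σ s u ≈ σ s v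
  ≡ᵗ-≈ h u v = h (var u ≐ var v)

  -- The n elements are moved as one tuple; since types record equality of coordinates, distinct
  -- elements stay distinct.
  extend-many : ∀ {p q n} {Γ Y : Ctx S} {ρ σ : Env Γ} {P : Pred (Env Y) p} {Q : Pred (Env Y) q} →
                ρ ≡ᵗ σ → (∀ a b → (ρ ++ a) ≡ᵗ (σ ++ b) → P a → Q b) → Many n P → Many n Q
  extend-many {n = n} {Γ} {Y} {ρ} {σ} ρ≡σ f (as , ps , ds) =
      (λ i → bs ∘ʳ copy i)
    , (λ i → f (as i) (bs ∘ʳ copy i) (conj i) (ps i))
    , λ i j i≢j e → ds i j i≢j λ s v → ≡ᵗ-≈ (≡ᵗ-sym h) (inj₂ (i , v)) (inj₂ (j , v)) (e s v)
    where
    extension = extend ρ≡σ (copies as)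
    bs : Env (Copies n Y)
    bs = proj₁ extension
    h : (ρ ++ copies as) ≡ᵗ (σ ++ bs)
    h = proj₂ extension
    at : Fin n → Ren (Γ ⊕ Y) (Γ ⊕ Copies n Y)
    at i s (inj₁ v) = inj₁ v
    at i s (inj₂ v) = inj₂ (i , v)
    conj : ∀ i → (ρ ++ as i) ≡ᵗ (σ ++ (bs ∘ʳ copy i))
    conj i = ≡ᵗ-reindex (at i) h
      (λ { s (inj₁ v) → ≈.refl ; s (inj₂ v) → ≈.refl }) (λ { s (inj₁ v) → ≈.refl ; s (inj₂ v) → ≈.refl })

  extend-infinite : ∀ {p q} {Γ Y : Ctx S} {ρ σ : Env Γ} {P : Pred (Env Y) p} {Q : Pred (Env Y) q} →
                    ρ ≡ᵗ σ → (∀ a b → (ρ ++ a) ≡ᵗ (σ ++ b) → P a → Q b) → Infinite P → Infinite Q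
  extend-infinite {P = P} {Q} ρ≡σ f inf =
    many⇒infinite λ n → extend-many {P = P} {Q} ρ≡σ f (infinite⇒many inf n)

  -- A violation over σ, namely k parameters together with their common solution x, is a single
  -- small tuple and can be moved back to ρ.
  extend-inconsistent : ∀ {p q k} {Γ X Y : Ctx S} {ρ σ : Env Γ} (δ : Formula L (X ⊕ Y))
                        {P : Pred (Env Y) p} {Q : Pred (Env Y) q} →
                        ρ ≡ᵗ σ → (∀ a b → (σ ++ b) ≡ᵗ (ρ ++ a) → Q b → P a) →
                        Inconsistent k δ P → Inconsistent k δ Q
  extend-inconsistent {k = k} {Γ} {X} {Y} {ρ} {σ} δ {P} {Q} ρ≡σ f inc as qs ds (x , p) =
    inc (λ i → bs ∘ʳ y i) (λ i → f (bs ∘ʳ y i) (as i) (conj i) (qs i))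
      (λ i j i≢j e → ds i j i≢j λ s v → ≡ᵗ-≈ (≡ᵗ-sym h) (inj₂ (y i s v)) (inj₂ (y j s v)) (e s v))
      ((bs ∘ʳ λ _ → inj₁) , λ i → ≡ᵗ-reindex (xy i) h
        (λ { s (inj₁ v) → ≈.refl ; s (inj₂ v) → ≈.refl })
        (λ { s (inj₁ v) → ≈.refl ; s (inj₂ v) → ≈.refl }) δ (p i))
    where
    extension = extend (≡ᵗ-sym ρ≡σ) (x ++ copies as)
    bs : Env (X ⊕ Copies k Y)
    bs = proj₁ extension
    h : (σ ++ (x ++ copies as)) ≡ᵗ (ρ ++ bs)
    h = proj₂ extension
    y : Fin k → Ren Y (X ⊕ Copies k Y)
    y i s v = inj₂ (i , v)
    at : Fin k → Ren (Γ ⊕ Y) (Γ ⊕ (X ⊕ Copies k Y))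
    at i s (inj₁ v) = inj₁ v
    at i s (inj₂ v) = inj₂ (inj₂ (i , v))
    conj : ∀ i → (σ ++ as i) ≡ᵗ (ρ ++ (bs ∘ʳ y i))
    conj i = ≡ᵗ-reindex (at i) h
      (λ { s (inj₁ v) → ≈.refl ; s (inj₂ v) → ≈.refl }) (λ { s (inj₁ v) → ≈.refl ; s (inj₂ v) → ≈.refl })
    xy : Fin k → Ren (X ⊕ Y) (Γ ⊕ (X ⊕ Copies k Y))
    xy i s (inj₁ v) = inj₂ (inj₁ v)
    xy i s (inj₂ v) = inj₂ (inj₂ (i , v))

  -- Normal form of þ-dividing and þ-forking

  Union : ∀ {m} → (Fin m → Ctx S) → Ctx S
  Union {m} F s = Σ (Fin m) λ j → F j s

  collect : ∀ {m} {F : Fin m → Ctx S} → (∀ j → Env (F j)) → Env (Union F)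
  collect f s (j , v) = f j s v

  -- The parameter-free part of one dividing formula, which is also the data of one step of þ-rank.
  -- Keeping it apart makes "forks through the same formulas" expressible: patterns are fixed while
  -- base and parameters move.
  record Pattern (X : Ctx S) : Set (lsuc ℓ) where
    field
      {arity} : ℕ
      sorts   : Fin arity → S
      ground    : Ctx S
      δ       : Formula L (X ⊕ Pos sorts)
      π       : Formula L (Pos sorts ⊕ ground)
      k       : ℕ

    Param : Ctx S
    Param = Pos sorts

  -- π(y;z) isolates the part of tp(e/Az) responsible for k-inconsistency, so
  -- that δ(x,e) strongly divides over Az.
  record Divides {X : Ctx S} (w : Pattern X) (A : Tuple)
                 (e : Env (Pattern.Param w)) (z : Env (Pattern.ground w)) : Set (ℓ ⊔ c) where
    open Pattern w
    field
      infinite     : Infinite (Conjugate (A ∪ ⟨ z ⟩) e)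
      satisfies    : ⊨ π [ e ++ z ]
      inconsistent : Inconsistent k δ (λ y → ⊨ π [ y ++ z ])

  record Forks {X : Ctx S} {m} (w : Fin m → Pattern X) (P : Pred (Env X) c) (A : Tuple) : Set (ℓ ⊔ c) where
    private open module Shape j = Pattern (w j)
    field
      point   : ∀ j → Env (Param j)
      over    : ∀ j → Env (ground j)
      divides : ∀ j → Divides (w j) A (point j) (over j)
      covers  : ∀ x → P x → ∃[ j ] ⊨ δ j [ x ++ point j ]

  divides⇒Þ-divides : ∀ {X : Ctx S} (w : Pattern X) A {e z} → Divides w A e z → Þ-divides (Pattern.δ w ⟪ e ⟫) A
  divides⇒Þ-divides w A {e} {z} D = ⟨ z ⟩ , infinite , k , inconsistent-mono {δ = δ}
    satisfied inconsistent
    where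
    open Pattern w
    open Divides D
    r : Ren (Param ⊕ ground) (Param ⊕ (ctx A ⊕ ground))
    r s (inj₁ v) = inj₁ v
    r s (inj₂ v) = inj₂ (inj₂ v)
    r-++ : ∀ y → (y ++ z) ≋ ((y ++ elt (A ∪ ⟨ z ⟩)) ∘ʳ r)
    r-++ y s (inj₁ v) = ≈.refl
    r-++ y s (inj₂ v) = ≈.refl
    satisfied : ∀ y → Conjugate (A ∪ ⟨ z ⟩) e y → ⊨ π [ y ++ z ]
    satisfied y h = ≡ᵗ-reindex r h (r-++ e) (r-++ y) π satisfies

  forks⇒Þ-forks : ∀ {X : Ctx S} {m} (w : Fin m → Pattern X) A (φ : ParFormula X) →
                  Forks w (_⊩ φ) A → Þ-forks φ A
  forks⇒Þ-forks {m = m} w A φ F =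
    tabulate (λ j → Pattern.δ (w j) ⟪ point j ⟫) , All.tabulate⁺ (λ j → divides⇒Þ-divides (w j) A (divides j)) ,
    λ x p → let j , q = covers x p in Any.tabulate⁺ j q
    where open Forks F

  -- A consistent δ(x,a) depends only on the finite part of a that it mentions,
  -- and that part is still non-algebraic: otherwise infinitely many conjugates
  -- of a would share it, contradicting k-inconsistency.
  module Finitise {X : Ctx S} (A d : Tuple) {Y : Ctx S} (δ : Formula L (X ⊕ Y)) (a : Env Y)
                  (inf : Infinite (Conjugate (A ∪ d) a)) (k : ℕ)
                  (inc : Inconsistent k δ (Conjugate (A ∪ d) a))
                  (x₀ : Env X) (δ₀ : ⊨ δ [ x₀ ++ a ]) where
    V : Tuple
    V = A ∪ d

    δˢ : Formula L (Y ⊕ X)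
    δˢ = rename swap δ

    vs : Vars Y
    vs = fvˡ Y δˢ

    r : Ren (ctxOf vs) Y
    r = varOf vs

    δ′ : Formula L (X ⊕ ctxOf vs)
    δ′ = rename swap (narrow δˢ vs λ m → m)

    ⊨δ′ : ∀ x y f → (y ∘ʳ r) ≋ f → (⊨ δ [ x ++ y ]) ⇔ (⊨ δ′ [ x ++ f ])
    ⊨δ′ x y f e = mk⇔
      (λ p → to (⊨-rename (narrow δˢ vs λ m → m) swap (swap-++ f x))
               (to (⊨-narrow δˢ vs (λ m → m) e) (to (⊨-rename δ swap (swap-++ x y)) p)))
      (λ p → from (⊨-rename δ swap (swap-++ x y))
               (from (⊨-narrow δˢ vs (λ m → m) e)
                 (from (⊨-rename (narrow δˢ vs λ m → m) swap (swap-++ f x)) p)))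

    e : Env (ctxOf vs)
    e = a ∘ʳ r

    restrict-conjugate : ∀ B y → Conjugate B a y → Conjugate B e (y ∘ʳ r)
    restrict-conjugate B y h = ≡ᵗ-reindex (onLeft r) h (onLeft-++ r a (elt B)) (onLeft-++ r y (elt B))

    infinite : Infinite (Conjugate V e)
    infinite (bs , h) =
      let b , inf-b = infinite-fibre (_∘ʳ r) bs (λ y p → h (y ∘ʳ r) (restrict-conjugate V y p)) inf
          as₁ , ps₁ , _ = infinite⇒many inf-b 1
          as , ps , ds  = infinite⇒many inf-b k
          -- δ is consistent at every conjugate of a; a solution x at one whose mentioned part is b
          -- solves δ at all conjugates with that same part.
          x , p = to (⊨-∃ˣ X δ x₀) (≡ᵗ-reindex (λ _ → inj₁) (proj₁ (ps₁ zero)) ≋-refl ≋-refl (∃ˣ X δ)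
                    (from (⊨-∃ˣ X δ x₀) (x₀ , δ₀)))
          q = to (⊨δ′ x (as₁ zero) b (proj₂ (ps₁ zero))) p
      in inc as (λ i → proj₁ (ps i)) ds (x , λ i → from (⊨δ′ x (as i) b (proj₂ (ps i))) q)

    -- Each conjugate of e over V extends to a conjugate of a, so a violation for δ′ would yield one
    -- for δ.
    inconsistent : Inconsistent k δ′ (Conjugate V e)
    inconsistent fs ps ds (x , q) = inc as conjugate distinct
      (x , λ i → from (⊨δ′ x (as i) (fs i) (agree i)) (q i))
      where
      extension : ∀ i → ∃[ y ] ((e ++ elt V) ++ a) ≡ᵗ ((fs i ++ elt V) ++ y)
      extension i = extend (ps i) a
      as : Fin k → Env Y
      as i = proj₁ (extension i)
      agree : ∀ i → (as i ∘ʳ r) ≋ fs i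
      agree i s v = ≡ᵗ-≈ (proj₂ (extension i)) (inj₂ (r s v)) (inj₁ (inj₁ v)) ≈.refl
      last-first : Ren (Y ⊕ ctx V) ((ctxOf vs ⊕ ctx V) ⊕ Y)
      last-first s (inj₁ v) = inj₂ v
      last-first s (inj₂ v) = inj₁ (inj₂ v)
      last-first-++ : ∀ f y → (y ++ elt V) ≋ (((f ++ elt V) ++ y) ∘ʳ last-first)
      last-first-++ f y s (inj₁ v) = ≈.refl
      last-first-++ f y s (inj₂ v) = ≈.refl
      conjugate : ∀ i → Conjugate V a (as i)
      conjugate i = ≡ᵗ-reindex last-first (proj₂ (extension i))
        (last-first-++ e a) (last-first-++ (fs i) (as i))
      distinct : ∀ i j → i ≢ j → ¬ (as i ≋ as j)
      distinct i j i≢j f = ds i j i≢j λ s v →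
        ≈.trans (≈.sym (agree i s v)) (≈.trans (f s (r s v)) (agree j s v))

    formula′ = inconsistent-formula e (elt V) k δ′ inconsistent

    pattern′ : Pattern X
    -- The tuple z enumerates all of `A ∪ d`, since the formula π found by compactness may mention
    -- any of it.
    pattern′ = record { sorts = λ i → proj₁ (lookup vs i) ; ground = ctx V ; δ = δ′ ; π = proj₁ formula′ ; k = k }

    divides : Divides pattern′ A e (elt V)
    divides = record
      { infinite = infinite-mono (λ y → conjugate-mono (A ∪ V) V e y (∪-⊆ {A} {V} {V} (⊆-∪ˡ A d) (⊆-refl V))) infinite
      ; satisfies = proj₁ (proj₂ formula′) ; inconsistent = proj₂ (proj₂ formula′) }

  record Divider {X : Ctx S} (A : Tuple) : Set (lsuc ℓ ⊔ c) where
    field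
      shape : Pattern X
      point : Env (Pattern.Param shape)
      over  : Env (Pattern.ground shape)
      holds : Divides shape A point over

  Þ-forks⇒forks : ∀ {X : Ctx S} A (φ : ParFormula X) → Þ-forks φ A →
                  ∃[ m ] Σ (Fin m → Pattern X) λ w → Forks w (_⊩ φ) A
  Þ-forks⇒forks {X} A φ (ψs , ds , cov) =
    length Ds , (λ j → shape (lookup Ds j)) , record
      { point = λ j → point (lookup Ds j) ; over = λ j → over (lookup Ds j)
      ; divides = λ j → holds (lookup Ds j)
      ; covers = λ x p → let q = proj₂ (dividers ψs ds) x (cov x p) in Any.index q , Any.lookup-index q }
    where
    open Divider
    dividers : ∀ ψs → All (λ ψ → Þ-divides ψ A) ψs →
              Σ (List (Divider {X} A)) λ Ds → ∀ x → Any (x ⊩_) ψs →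
                Any (λ D → ⊨ Pattern.δ (shape D) [ x ++ point D ]) Ds
    dividers [] [] = [] , λ x ()
    dividers (ψ ∷ ψs) (p ∷ ps) with dividers ψs ps | em {P = ∃[ x ] x ⊩ ψ}
    -- An inconsistent disjunct covers no point and is dropped; `Finitise` applies only to
    -- consistent ones.
    ... | Ds , f | no inconsistent = Ds , λ { x (here q) → contradiction (x , q) inconsistent ; x (there q) → f x q }
    ... | Ds , f | yes (x₀ , p₀) =
      record { shape = F.pattern′ ; point = F.e ; over = elt F.V ; holds = F.divides } ∷ Ds ,
      λ { x (here q) → here (to (F.⊨δ′ x (param ψ) F.e ≋-refl) q) ; x (there q) → there (f x q) }
      where
      module F = Finitise A (proj₁ p) (formula ψ) (param ψ) (proj₁ (proj₂ p))
                   (proj₁ (proj₂ (proj₂ p))) (proj₂ (proj₂ (proj₂ p))) x₀ p₀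
    Ds = proj₁ (dividers ψs ds)

-- Ranks of solution sets, and their growth under forking

module Rank (em : ∀ {i} → ExcludedMiddle i) {ℓ c} {S : Set ℓ} {L : Signature S}
            (M : Structure L c) (saturated : Semantics.Saturated M) where
  open Classical em
  open Thorn-forking em M saturated

  forget : ∀ {X Y Z : Ctx S} → Ren (X ⊕ Z) (X ⊕ (Y ⊕ Z))
  forget s (inj₁ v) = inj₁ v
  forget s (inj₂ v) = inj₂ (inj₂ v)

  keep : ∀ {X Y Z : Ctx S} → Ren (X ⊕ Y) (X ⊕ (Y ⊕ Z))
  keep s (inj₁ v) = inj₁ v
  keep s (inj₂ v) = inj₂ (inj₁ v)

  ⊨-forget : ∀ {X Y Z : Ctx S} (φ : Formula L (X ⊕ Z)) (x : Env X) (y : Env Y) (z : Env Z) →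
             (⊨ φ [ x ++ z ]) ⇔ (⊨ rename (forget {X} {Y} {Z}) φ [ x ++ (y ++ z) ])
  ⊨-forget φ x y z = ⊨-rename φ forget λ { s (inj₁ v) → ≈.refl ; s (inj₂ v) → ≈.refl }

  ⊨-keep : ∀ {X Y Z : Ctx S} (φ : Formula L (X ⊕ Y)) (x : Env X) (y : Env Y) (z : Env Z) →
           (⊨ φ [ x ++ y ]) ⇔ (⊨ rename (keep {X} {Y} {Z}) φ [ x ++ (y ++ z) ])
  ⊨-keep φ x y z = ⊨-rename φ keep λ { s (inj₁ v) → ≈.refl ; s (inj₂ v) → ≈.refl }

  module _ {X : Ctx S} {m} (w : Fin m → Pattern X) where
    private open module Shape j = Pattern (w j)

    -- Works with solution sets in place of formulas and lets each pattern keep its own variables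
    -- and its own k; the coding into a single þ-rank is postponed to `semantic⇒Rank≥`.
    SemanticRank≥ : Pred (Env X) c → ℕ → Set (ℓ ⊔ c)
    SemanticRank≥ P zero    = ∃ P
    SemanticRank≥ P (suc n) = ∃[ j ] Σ (Env (ground j)) λ d →
      Infinite (λ a → (⊨ π j [ a ++ d ]) × SemanticRank≥ (λ x → P x × (⊨ δ j [ x ++ a ])) n) ×
      Inconsistent (k j) (δ j) (λ a → ⊨ π j [ a ++ d ])

    rank-mono : ∀ {P Q : Pred (Env X) c} n → (∀ x → P x → Q x) → SemanticRank≥ P n → SemanticRank≥ Q n
    rank-mono zero    f (x , p) = x , f x p
    rank-mono (suc n) f (j , d , inf , inc) =
      j , d , infinite-mono (λ a (p , r) → p , rank-mono n (λ x (q , s) → f x q , s) r) inf , inc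

    -- Each parameter leaves enough rank in P or in Q, and one of the two alternatives occurs
    -- infinitely often.
    rank-⊎ : ∀ {P Q : Pred (Env X) c} n → SemanticRank≥ (λ x → P x ⊎ Q x) n →
             SemanticRank≥ P n ⊎ SemanticRank≥ Q n
    rank-⊎ zero (x , inj₁ p) = inj₁ (x , p)
    rank-⊎ zero (x , inj₂ q) = inj₂ (x , q)
    rank-⊎ {P} {Q} (suc n) (j , d , inf , inc) with infinite-⊎
      {P = λ a → (⊨ π j [ a ++ d ]) × SemanticRank≥ (λ x → P x × (⊨ δ j [ x ++ a ])) n}
      {Q = λ a → (⊨ π j [ a ++ d ]) × SemanticRank≥ (λ x → Q x × (⊨ δ j [ x ++ a ])) n}
      (infinite-mono (λ a (p , r) → split a p (rank-⊎ n (rank-mono n distribute r))) inf)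
      where
      distribute : ∀ {a} x → (P x ⊎ Q x) × (⊨ δ j [ x ++ a ]) →
                   (P x × (⊨ δ j [ x ++ a ])) ⊎ (Q x × (⊨ δ j [ x ++ a ]))
      distribute x (inj₁ p , q) = inj₁ (p , q)
      distribute x (inj₂ p , q) = inj₂ (p , q)
      split : ∀ a {A B : Set (ℓ ⊔ c)} → ⊨ π j [ a ++ d ] → A ⊎ B →
              ((⊨ π j [ a ++ d ]) × A) ⊎ ((⊨ π j [ a ++ d ]) × B)
      split a p (inj₁ r) = inj₁ (p , r)
      split a p (inj₂ r) = inj₂ (p , r)
    ... | inj₁ i = inj₁ (j , d , i , inc)
    ... | inj₂ i = inj₂ (j , d , i , inc)

    rank-∃ : ∀ {l} {P : Fin l → Pred (Env X) c} n → SemanticRank≥ (λ x → ∃[ j ] P j x) n →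
             ∃[ j ] SemanticRank≥ (P j) n
    rank-∃ {zero} {P} zero    (x , () , _)
    -- An empty union has no rank: infinitely many parameters provide one, so one can descend to
    -- rank 0, where a point is required.
    rank-∃ {zero} {P} (suc n) (j , d , inf , inc) =
      let as , ps , _ = infinite⇒many inf 1 in
      contradiction (proj₁ (rank-∃ {zero} {λ ()} n (rank-mono n (λ { _ ((() , _) , _) }) (proj₂ (ps zero))))) λ ()
    rank-∃ {suc l} {P} n r with rank-⊎ {P zero} {λ x → ∃[ j ] P (suc j) x} n
      (rank-mono n (λ { x (zero , p) → inj₁ p ; x (suc j , p) → inj₂ (j , p) }) r)
    ... | inj₁ r₀ = zero , r₀
    ... | inj₂ r₊ = let j , rⱼ = rank-∃ n r₊ in suc j , rⱼ

    private
      snocᵉ : ∀ {Γ D Y : Ctx S} → Ren (Y ⊕ Γ) ((Γ ⊕ D) ⊕ Y)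
      snocᵉ s (inj₁ v) = inj₂ v
      snocᵉ s (inj₂ v) = inj₁ (inj₁ v)

      snocᵈ : ∀ {Γ D Y : Ctx S} → Ren (Y ⊕ D) ((Γ ⊕ D) ⊕ Y)
      snocᵈ s (inj₁ v) = inj₂ v
      snocᵈ s (inj₂ v) = inj₁ (inj₂ v)

      snocᵉ-++ : ∀ {Γ D Y : Ctx S} (g : Env Γ) (d : Env D) (y : Env Y) → (y ++ g) ≋ (((g ++ d) ++ y) ∘ʳ snocᵉ)
      snocᵉ-++ g d y s (inj₁ v) = ≈.refl
      snocᵉ-++ g d y s (inj₂ v) = ≈.refl

      snocᵈ-++ : ∀ {Γ D Y : Ctx S} (g : Env Γ) (d : Env D) (y : Env Y) → (y ++ d) ≋ (((g ++ d) ++ y) ∘ʳ snocᵈ)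
      snocᵈ-++ g d y s (inj₁ v) = ≈.refl
      snocᵈ-++ g d y s (inj₂ v) = ≈.refl

    -- The parameter chosen at one step joins g for the next, hence the induction over all contexts
    -- Γ.
    rank-invariant : ∀ {Γ : Ctx S} (φ : Formula L (X ⊕ Γ)) {g g′ : Env Γ} n → g ≡ᵗ g′ →
                     SemanticRank≥ (λ x → ⊨ φ [ x ++ g ]) n → SemanticRank≥ (λ x → ⊨ φ [ x ++ g′ ]) n
    rank-invariant φ zero g≡g′ (x , p) = to (⊨-∃ˣ X φ x) (g≡g′ (∃ˣ X φ) (from (⊨-∃ˣ X φ x) (x , p)))
    rank-invariant {Γ} φ {g} {g′} (suc n) g≡g′ (j , d , inf , inc) =
      j , d′ , extend-infinite {P = Good g d} {Q = Good g′ d′} gd≡gd′ step inf ,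
      extend-inconsistent (δ j) {P = λ a → ⊨ π j [ a ++ d ]} {Q = λ b → ⊨ π j [ b ++ d′ ]} gd≡gd′ back inc
      where
      Good : Env Γ → Env (ground j) → Pred (Env (Param j)) (ℓ ⊔ c)
      Good g d a = (⊨ π j [ a ++ d ]) × SemanticRank≥ (λ x → (⊨ φ [ x ++ g ]) × (⊨ δ j [ x ++ a ])) n
      extension : ∃[ d′ ] (g ++ d) ≡ᵗ (g′ ++ d′)
      extension = extend g≡g′ d
      d′ : Env (ground j)
      d′ = proj₁ extension
      gd≡gd′ : (g ++ d) ≡ᵗ (g′ ++ d′)
      gd≡gd′ = proj₂ extension
      back : ∀ a b → ((g′ ++ d′) ++ b) ≡ᵗ ((g ++ d) ++ a) → ⊨ π j [ b ++ d′ ] → ⊨ π j [ a ++ d ]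
      back a b h = ≡ᵗ-reindex snocᵈ h (snocᵈ-++ g′ d′ b) (snocᵈ-++ g d a) (π j)
      ψ : Formula L (X ⊕ (Param j ⊕ Γ))
      ψ = rename forget φ ∧′ rename keep (δ j)
      ⊨ψ : ∀ x a g → ((⊨ φ [ x ++ g ]) × (⊨ δ j [ x ++ a ])) ⇔ (⊨ ψ [ x ++ (a ++ g) ])
      ⊨ψ x a g = ⇔-× (⊨-forget φ x a g) (⊨-keep (δ j) x a g)
      step : ∀ a b → ((g ++ d) ++ a) ≡ᵗ ((g′ ++ d′) ++ b) → Good g d a → Good g′ d′ b
      step a b h (p , r) =
        ≡ᵗ-reindex snocᵈ h (snocᵈ-++ g d a) (snocᵈ-++ g′ d′ b) (π j) p ,
        rank-mono n (λ x → from (⊨ψ x b g′))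
          (rank-invariant ψ n (≡ᵗ-reindex snocᵉ h (snocᵉ-++ g d a) (snocᵉ-++ g′ d′ b))
            (rank-mono n (λ x → to (⊨ψ x a g)) r))

    TypeRank≥ : Env X → Tuple → ℕ → Set (ℓ ⊔ c)
    TypeRank≥ b E n = ∀ (θ : Formula L (X ⊕ ctx E)) → ⊨ θ [ b ++ elt E ] →
                      SemanticRank≥ (λ x → ⊨ θ [ x ++ elt E ]) n

    -- Each θ in tp(b/E) meets some δ j(x,e) in rank n, and then all the
    -- infinitely many conjugates of e over E z witness that θ has rank n+1.
    rank-step : ∀ (b : Env X) E B n → E ⊆ B → (φ : Formula L (X ⊕ ctx B)) → ⊨ φ [ b ++ elt B ] →
                Forks w (λ x → ⊨ φ [ x ++ elt B ]) E → TypeRank≥ b B n → TypeRank≥ b E (suc n)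
    rank-step b E B n E⊆B φ φb F r θ θb =
      j , over j , infinite-mono conjugates (Divides.infinite (divides j)) , Divides.inconsistent (divides j)
      where
      open Forks F
      θᴮ = reparam E B E⊆B θ
      -- `θᴮ ∧′ φ` belongs to tp(b/B), so it has rank n, and the disjuncts cover it; one of them
      -- must carry the whole rank.
      located = rank-∃ {P = λ j x → (⊨ θ [ x ++ elt E ]) × (⊨ δ j [ x ++ point j ])} n
        (rank-mono n (λ x (p , q) → let j , h = covers x q in j , from (⊨-reparam E B E⊆B θ) p , h)
          (r (θᴮ ∧′ φ) (to (⊨-reparam E B E⊆B θ) θb , φb)))
      j = proj₁ located
      ψ : Formula L (X ⊕ (Param j ⊕ ctx E))
      ψ = rename forget θ ∧′ rename keep (δ j)
      ⊨ψ : ∀ x y → ((⊨ θ [ x ++ elt E ]) × (⊨ δ j [ x ++ y ])) ⇔ (⊨ ψ [ x ++ (y ++ elt E) ])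
      ⊨ψ x y = ⇔-× (⊨-forget θ x y (elt E)) (⊨-keep (δ j) x y (elt E))
      overᴱ : Ren (Param j ⊕ ctx E) (Param j ⊕ (ctx E ⊕ ground j))
      overᴱ s (inj₁ v) = inj₁ v
      overᴱ s (inj₂ v) = inj₂ (inj₁ v)
      overᴱ-++ : ∀ y → (y ++ elt E) ≋ ((y ++ (elt E ++ over j)) ∘ʳ overᴱ)
      overᴱ-++ y s (inj₁ v) = ≈.refl
      overᴱ-++ y s (inj₂ v) = ≈.refl
      overᶻ : Ren (Param j ⊕ ground j) (Param j ⊕ (ctx E ⊕ ground j))
      overᶻ s (inj₁ v) = inj₁ v
      overᶻ s (inj₂ v) = inj₂ (inj₂ v)
      overᶻ-++ : ∀ y → (y ++ over j) ≋ ((y ++ (elt E ++ over j)) ∘ʳ overᶻ)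
      overᶻ-++ y s (inj₁ v) = ≈.refl
      overᶻ-++ y s (inj₂ v) = ≈.refl
      conjugates : ∀ y → Conjugate (E ∪ ⟨ over j ⟩) (point j) y →
                   (⊨ π j [ y ++ over j ]) × SemanticRank≥ (λ x → (⊨ θ [ x ++ elt E ]) × (⊨ δ j [ x ++ y ])) n
      conjugates y h =
        ≡ᵗ-reindex overᶻ h (overᶻ-++ (point j)) (overᶻ-++ y) (π j) (Divides.satisfies (divides j)) ,
        rank-mono n (λ x → from (⊨ψ x y))
          (rank-invariant ψ n (≡ᵗ-reindex overᴱ h (overᴱ-++ (point j)) (overᴱ-++ y))
            (rank-mono n (λ x → to (⊨ψ x (point j))) (proj₂ located)))

-- From several patterns to one þ-rank, and its finiteness

module Bound (em : ∀ {i} → ExcludedMiddle i) {ℓ c} {S : Set ℓ} {L : Signature S}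
             (M : Structure L c) (saturated : Semantics.Saturated M) where
  open Classical em
  open Thorn-forking em M saturated
  open Rank em M saturated

  upperBound : ∀ {m} (k : Fin m → ℕ) → ∃[ K ] ∀ j → k j ≤ K
  upperBound {zero}  k = zero , λ ()
  upperBound {suc m} k = let K , h = upperBound (k ∘ suc) in k zero ⊔ℕ K ,
    λ { zero → ℕ.m≤m⊔n _ _ ; (suc j) → ℕ.≤-trans (h j) (ℕ.m≤n⊔m (k zero) K) }

  inconsistent-≤ : ∀ {p k K} {X Y : Ctx S} {δ : Formula L (X ⊕ Y)} {P : Pred (Env Y) p} →
                   k ≤ K → Inconsistent k δ P → Inconsistent K δ P
  inconsistent-≤ k≤K inc as ps ds (x , q) = inc (λ i → as (ι i)) (λ i → ps (ι i))
    (λ i j i≢j → ds (ι i) (ι j) (i≢j ∘ Fin.inject≤-injective k≤K k≤K i j)) (x , λ i → q (ι i))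
    where ι = λ i → inject≤ i k≤K

  -- A rank only sees one pair of variable contexts, so the patterns are coded
  -- into their disjoint unions; π̂ pins the coordinates of the other patterns
  -- to the values e⁰.
  module _ {X : Ctx S} {m} (w : Fin m → Pattern X)
           (e⁰ : ∀ j → Env (Pattern.Param (w j))) (d⁰ : ∀ j → Env (Pattern.ground (w j))) where
    private open module Shape j = Pattern (w j)

    Y Z : Ctx S
    Y = Union Param
    Z = Union ground ⊕ Y

    component : ∀ {F : Fin m → Ctx S} j → Ren (F j) (Union F)
    component j s v = j , v

    insertAt : ∀ {F : Fin m → Ctx S} {i s} j → Env (F j) → (∀ i → Env (F i)) → F i s → Dec (i ≡ j) → ∣_∣ s
    insertAt j a f v (yes refl) = a _ v
    insertAt j a f v (no _)     = f _ _ v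

    insert : ∀ (F : Fin m → Ctx S) j → Env (F j) → (∀ i → Env (F i)) → Env (Union F)
    insert F j a f s (i , v) = insertAt {F} j a f v (i Fin.≟ j)

    insert-here : ∀ (F : Fin m → Ctx S) j a f s v → insert F j a f s (j , v) ≡ a s v
    insert-here F j a f s v with j Fin.≟ j
    ... | yes refl = refl
    ... | no j≢j   = contradiction refl j≢j

    insert-there : ∀ (F : Fin m → Ctx S) j a f i s v → i ≢ j → insert F j a f s (i , v) ≡ f i s v
    insert-there F j a f i s v i≢j with i Fin.≟ j
    ... | yes i≡j = contradiction i≡j i≢j
    ... | no _    = refl

    δ-ren : ∀ j → Ren (X ⊕ Param j) (X ⊕ Y)
    δ-ren j s (inj₁ v) = inj₁ v
    δ-ren j s (inj₂ v) = inj₂ (j , v)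

    δ̂ : Fin m → Formula L (X ⊕ Y)
    δ̂ j = rename (δ-ren j) (δ j)

    π-ren : ∀ j → Ren (Param j ⊕ ground j) (Y ⊕ Z)
    π-ren j s (inj₁ v) = inj₁ (j , v)
    π-ren j s (inj₂ v) = inj₂ (inj₁ (j , v))

    pinned : ∀ j → Formula L (Y ⊕ Z)
    pinned j = ⋀ m λ i → ⋀ (arity i) λ l →
      unless (i Fin.≟ j) (var (inj₁ (i , pos l)) ≐ var (inj₂ (inj₂ (i , pos l))))

    π̂ : Fin m → Formula L (Y ⊕ Z)
    π̂ j = rename (π-ren j) (π j) ∧′ pinned j

    K : ℕ
    K = proj₁ (upperBound k)

    module _ j (d : Env (ground j)) where

      ŷ : Env (Param j) → Env Y
      ŷ a = insert Param j a e⁰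

      ẑ : Env Z
      -- `π̂ j` reads slot j of the first summand, the others being filled with d⁰; the second
      -- summand holds the values e⁰ with which the pinned coordinates are compared.
      ẑ = insert ground j d d⁰ ++ (λ s (i , v) → e⁰ i s v)

      ⊨-δ̂ : ∀ x (y : Env Y) → (⊨ δ j [ x ++ (y ∘ʳ component j) ]) ⇔ (⊨ δ̂ j [ x ++ y ])
      ⊨-δ̂ x y = ⊨-rename (δ j) (δ-ren j) λ { s (inj₁ v) → ≈.refl ; s (inj₂ v) → ≈.refl }

      ŷ-component : ∀ a → a ≋ (ŷ a ∘ʳ component j)
      ŷ-component a s v = ≈.reflexive (sym (insert-here Param j a e⁰ s v))

      ⊨-π̂ : ∀ (y : Env Y) → (⊨ π j [ (y ∘ʳ component j) ++ d ]) ⇔ (⊨ rename (π-ren j) (π j) [ y ++ ẑ ])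
      ⊨-π̂ y = ⊨-rename (π j) (π-ren j) λ
        { s (inj₁ v) → ≈.refl ; s (inj₂ v) → ≈.reflexive (sym (insert-here ground j d d⁰ s v)) }

      ŷ-pinned : ∀ a → ⊨ pinned j [ ŷ a ++ ẑ ]
      ŷ-pinned a = from (⊨-⋀ m _) λ i → from (⊨-⋀ (arity i) _) λ l → from (⊨-unless (i Fin.≟ j) _) λ i≢j →
        ≈.reflexive (insert-there Param j a e⁰ i (sorts i l) (pos l) i≢j)

      pinned-agree : ∀ y i s v → i ≢ j → ⊨ pinned j [ y ++ ẑ ] → y s (i , v) ≈ e⁰ i s v
      pinned-agree y i _ (pos l) i≢j p = to (⊨-unless (i Fin.≟ j) _) (to (⊨-⋀ (arity i) _) (to (⊨-⋀ m _) p i) l) i≢j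

      -- Two solutions of `π̂ j` that agree in component j agree everywhere because of the pinning,
      -- so distinct codes have distinct components.
      coded-inconsistent : Inconsistent (k j) (δ j) (λ a → ⊨ π j [ a ++ d ]) →
                           Inconsistent K (δ̂ j) (λ y → ⊨ π̂ j [ y ++ ẑ ])
      coded-inconsistent inc ys ps ds (x , q) = inconsistent-≤ {δ = δ j} {P = λ a → ⊨ π j [ a ++ d ]} (proj₂ (upperBound k) j) inc
        (λ i → ys i ∘ʳ component j) (λ i → from (⊨-π̂ (ys i)) (proj₁ (ps i)))
        (λ a b a≢b e → ds a b a≢b (agree a b e)) (x , λ i → from (⊨-δ̂ x (ys i)) (q i))
        where
        agree : ∀ a b → (ys a ∘ʳ component j) ≋ (ys b ∘ʳ component j) → ys a ≋ ys b
        agree a b e s (i , v) with i Fin.≟ j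
        ... | yes refl = e s v
        ... | no i≢j   = ≈.trans (pinned-agree (ys a) i s v i≢j (proj₂ (ps a)))
                           (≈.sym (pinned-agree (ys b) i s v i≢j (proj₂ (ps b))))

    -- The coding `ŷ` is injective, so infinitely many parameters remain infinitely many. P is only
    -- asked to imply φ, so that conjunctions `∧ᵖ` are compared by implication alone.
    semantic⇒Rank≥ : ∀ {P : Pred (Env X) c} n (φ : ParFormula X) → (∀ x → P x → x ⊩ φ) →
                     SemanticRank≥ w P n → Rank≥ (_∈ tabulate δ̂) (_∈ tabulate π̂) K φ (finite n)
    semantic⇒Rank≥ zero φ f (x , p) = x , f x p
    semantic⇒Rank≥ {P} (suc n) φ f (j , d , inf , inc) =
      δ̂ j , π̂ j , ∈-tabulate⁺ j , ∈-tabulate⁺ j , ẑ j d ,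
      infinite-map {P = Before} {Q = After} (ŷ j d) step
        (λ a b _ _ e s v → ≈.trans (ŷ-component j d a s v) (≈.trans (e s (j , v)) (≈.sym (ŷ-component j d b s v)))) inf ,
      coded-inconsistent j d inc
      where
      Before : Pred (Env (Param j)) (ℓ ⊔ c)
      Before a = (⊨ π j [ a ++ d ]) × SemanticRank≥ w (λ x → P x × (⊨ δ j [ x ++ a ])) n
      After : Pred (Env Y) (ℓ ⊔ c)
      After y = (⊨ π̂ j [ y ++ ẑ j d ]) ×
                Rank≥ (_∈ tabulate δ̂) (_∈ tabulate π̂) K (φ ∧ᵖ (δ̂ j ⟪ y ⟫)) (finite n)
      step : ∀ a → Before a → After (ŷ j d a)
      step a (p , r) =
        (to (⊨-π̂ j d (ŷ j d a)) (⊨-resp (π j) (++-cong (ŷ-component j d a) ≋-refl) p) , ŷ-pinned j d a) ,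
        semantic⇒Rank≥ n (φ ∧ᵖ (δ̂ j ⟪ ŷ j d a ⟫)) (λ x (q , q′) →
          to (⊨-rename (formula φ) _ λ { s (inj₁ v) → ≈.refl ; s (inj₂ v) → ≈.refl }) (f x q) ,
          to (⊨-rename (δ̂ j) _ λ { s (inj₁ v) → ≈.refl ; s (inj₂ v) → ≈.refl })
            (to (⊨-δ̂ j d x (ŷ j d a)) (⊨-resp (δ j) (++-cong ≋-refl (ŷ-component j d a)) q′))) r

    tp-partial : ∀ (b : Env X) E → IsPartialType E (tp ⟨ b ⟩ E)
    tp-partial b E = record
      { consistent = λ φs ps → b , ps ; ⊤-closed = λ z → z ; ∧-closed = λ p q → p , q }

    -- Rosiness gives a formula of tp(b/E) whose rank is exactly some finite n, while unboundedness
    -- gives every formula of the type rank n+1.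
    rank-bounded : Rosy → ∀ (b : Env X) E → ¬ (∀ n → TypeRank≥ w b E n)
    rank-bounded rosy b E unbounded =
      let n , (φ , φb , _ , ¬n+1) , _ = rosy E (tp ⟨ b ⟩ E) (tp-partial b E) (tabulate δ̂) (tabulate π̂) K
      in ¬n+1 (semantic⇒Rank≥ (suc n) (φ ⟪ elt E ⟫) (λ x p → p) (unbounded (suc n) φ φb))

-- Monotonicity, invariance and extension for þ-independence

module Calculus (em : ∀ {i} → ExcludedMiddle i) {ℓ c} {S : Set ℓ} {L : Signature S}
                (M : Structure L c) (saturated : Semantics.Saturated M) where
  open Classical em
  open Thorn-forking em M saturated

  forks-⊆ : ∀ {X : Ctx S} A (φ ψ : ParFormula X) → (∀ x → x ⊩ φ → x ⊩ ψ) → Þ-forks ψ A → Þ-forks φ A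
  forks-⊆ A φ ψ f (χs , ds , h) = χs , ds , λ x p → h x (f x p)

  forksʷ-mono : ∀ {X : Ctx S} {m} {w : Fin m → Pattern X} {P Q : Pred (Env X) c} A →
                (∀ x → Q x → P x) → Forks w P A → Forks w Q A
  forksʷ-mono A f F = record
    { point = point ; over = over ; divides = divides ; covers = λ x q → covers x (f x q) }
    where open Forks F

  ⫝-mono : ∀ a A B A′ B′ → A ⊆ A′ → A′ ∪ B′ ⊆ A ∪ B → a ⫝[ A ] B → a ⫝[ A′ ] B′
  ⫝-mono a A B A′ B′ A⊆A′ s ind (φ , φa , forks) =
    ind (φ′ , to (⊨-reparam (A′ ∪ B′) (A ∪ B) s φ) φa ,
         forks-⊆ A (φ′ ⟪ elt (A ∪ B) ⟫) (φ ⟪ elt (A′ ∪ B′) ⟫)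
           (λ x → from (⊨-reparam (A′ ∪ B′) (A ∪ B) s φ))
           (forks-base (φ ⟪ elt (A′ ∪ B′) ⟫) A A′ A⊆A′ forks))
    where φ′ = reparam (A′ ∪ B′) (A ∪ B) s φ

  ⫝-monoʳ : ∀ a A B B′ → A ∪ B′ ⊆ A ∪ B → a ⫝[ A ] B → a ⫝[ A ] B′
  ⫝-monoʳ a A B B′ = ⫝-mono a A B A B′ (⊆-refl A)

  -- All points and grounds are moved as one tuple, along with the base α and the parameters g of φ.
  -- The patterns `w` stay fixed, which later keeps every rank within the same finite sets of
  -- formulas.
  forks-invariant : ∀ {X Γ : Ctx S} {m} {w : Fin m → Pattern X} (φ : Formula L (X ⊕ Γ)) (g g′ : Env Γ)
                    {C : Ctx S} (α α′ : Env C) → (α ++ g) ≡ᵗ (α′ ++ g′) →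
                    Forks w (λ x → ⊨ φ [ x ++ g ]) ⟨ α ⟩ → Forks w (λ x → ⊨ φ [ x ++ g′ ]) ⟨ α′ ⟩
  forks-invariant {X} {Γ} {m} {w} φ g g′ {C} α α′ h F = record
    { point = e′ ; over = z′ ; divides = divides′ ; covers = covers′ }
    where
    open Forks F
    module Shape j = Pattern (w j)
    open Shape
    E Z : Ctx S
    E = Union Param
    Z = Union ground
    extension : ∃[ f ] ((α ++ g) ++ (collect point ++ collect over)) ≡ᵗ ((α′ ++ g′) ++ f)
    extension = extend h (collect point ++ collect over)
    f : Env (E ⊕ Z)
    f = proj₁ extension
    conj : ((α ++ g) ++ (collect point ++ collect over)) ≡ᵗ ((α′ ++ g′) ++ f)
    conj = proj₂ extension
    e′ : ∀ j → Env (Param j)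
    e′ j s v = f s (inj₁ (j , v))
    z′ : ∀ j → Env (ground j)
    z′ j s v = f s (inj₂ (j , v))

    eαz : ∀ j → Ren ((C ⊕ ground j) ⊕ Param j) ((C ⊕ Γ) ⊕ (E ⊕ Z))
    eαz j s (inj₁ (inj₁ v)) = inj₁ (inj₁ v)
    eαz j s (inj₁ (inj₂ v)) = inj₂ (inj₂ (j , v))
    eαz j s (inj₂ v)        = inj₂ (inj₁ (j , v))

    grounded : ∀ j → (α ++ over j) ≡ᵗ (α′ ++ z′ j)
    grounded j = ≡ᵗ-reindex (λ s v → eαz j s (inj₁ v)) conj
      (λ { s (inj₁ v) → ≈.refl ; s (inj₂ v) → ≈.refl }) (λ { s (inj₁ v) → ≈.refl ; s (inj₂ v) → ≈.refl })

    pointed : ∀ j → ((α ++ over j) ++ point j) ≡ᵗ ((α′ ++ z′ j) ++ e′ j)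
    pointed j = ≡ᵗ-reindex (eαz j) conj
      (λ { s (inj₁ (inj₁ v)) → ≈.refl ; s (inj₁ (inj₂ v)) → ≈.refl ; s (inj₂ v) → ≈.refl })
      (λ { s (inj₁ (inj₁ v)) → ≈.refl ; s (inj₁ (inj₂ v)) → ≈.refl ; s (inj₂ v) → ≈.refl })

    yz : ∀ {j} → Ren (Param j ⊕ ground j) ((C ⊕ ground j) ⊕ Param j)
    yz s (inj₁ v) = inj₂ v
    yz s (inj₂ v) = inj₁ (inj₂ v)

    yz-++ : ∀ {j} (a : Env C) (z : Env (ground j)) (y : Env (Param j)) → (y ++ z) ≋ (((a ++ z) ++ y) ∘ʳ yz {j})
    yz-++ a z y s (inj₁ v) = ≈.refl
    yz-++ a z y s (inj₂ v) = ≈.refl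

    back : ∀ j a b → ((α′ ++ z′ j) ++ b) ≡ᵗ ((α ++ over j) ++ a) → ⊨ π j [ b ++ z′ j ] → ⊨ π j [ a ++ over j ]
    back j a b k = ≡ᵗ-reindex (yz {j}) k (yz-++ {j} α′ (z′ j) b) (yz-++ {j} α (over j) a) (π j)

    conjugate : ∀ j a b → ((α ++ over j) ++ a) ≡ᵗ ((α′ ++ z′ j) ++ b) →
                Conjugate (⟨ α ⟩ ∪ ⟨ over j ⟩) (point j) a → Conjugate (⟨ α′ ⟩ ∪ ⟨ z′ j ⟩) (e′ j) b
    conjugate j a b k r =
      ≡ᵗ-trans (≡ᵗ-reindex swap (≡ᵗ-sym (pointed j)) (swap-++ (e′ j) (α′ ++ z′ j)) (swap-++ (point j) (α ++ over j)))
        (≡ᵗ-trans r (≡ᵗ-reindex swap k (swap-++ a (α ++ over j)) (swap-++ b (α′ ++ z′ j))))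

    divides′ : ∀ j → Divides (w j) ⟨ α′ ⟩ (e′ j) (z′ j)
    divides′ j = record
      { infinite = extend-infinite {P = Conjugate (⟨ α ⟩ ∪ ⟨ over j ⟩) (point j)}
          {Q = Conjugate (⟨ α′ ⟩ ∪ ⟨ z′ j ⟩) (e′ j)} (grounded j) (conjugate j) (Divides.infinite (divides j))
      ; satisfies = ≡ᵗ-reindex (yz {j}) (pointed j) (yz-++ {j} α (over j) (point j)) (yz-++ {j} α′ (z′ j) (e′ j)) (π j)
          (Divides.satisfies (divides j))
      ; inconsistent = extend-inconsistent (δ j) {P = λ y → ⊨ π j [ y ++ over j ]} {Q = λ y → ⊨ π j [ y ++ z′ j ]}
          (grounded j) (back j) (Divides.inconsistent (divides j)) }

    covers′ : ∀ x′ → ⊨ φ [ x′ ++ g′ ] → ∃[ j ] ⊨ δ j [ x′ ++ e′ j ]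
    covers′ x′ p =
      -- A solution over the new configuration is moved back to the old one, located in some
      -- disjunct there, and that disjunct is carried forward.
      let x , k = extend (≡ᵗ-sym conj) x′
          j , q = covers x (≡ᵗ-reindex xg k (xg-++ α′ g′ f x′) (xg-++ α g (collect point ++ collect over) x) φ p)
      in j , ≡ᵗ-reindex (xe j) (≡ᵗ-sym k)
               (λ { s (inj₁ v) → ≈.refl ; s (inj₂ v) → ≈.refl })
               (λ { s (inj₁ v) → ≈.refl ; s (inj₂ v) → ≈.refl }) (δ j) q
      where
      xg : Ren (X ⊕ Γ) (((C ⊕ Γ) ⊕ (E ⊕ Z)) ⊕ X)
      xg s (inj₁ v) = inj₂ v
      xg s (inj₂ v) = inj₁ (inj₁ (inj₂ v))
      xg-++ : ∀ a g f x → (x ++ g) ≋ ((((a ++ g) ++ f) ++ x) ∘ʳ xg)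
      xg-++ a g f x s (inj₁ v) = ≈.refl
      xg-++ a g f x s (inj₂ v) = ≈.refl
      xe : ∀ j → Ren (X ⊕ Param j) (((C ⊕ Γ) ⊕ (E ⊕ Z)) ⊕ X)
      xe j s (inj₁ v) = inj₂ v
      xe j s (inj₂ v) = inj₁ (inj₂ (inj₁ (j , v)))

  ⫝-invariant : ∀ {Cᵃ Cᴬ Cᴮ : Ctx S} (a a′ : Env Cᵃ) (A A′ : Env Cᴬ) (B B′ : Env Cᴮ) →
                ((A ++ B) ++ a) ≡ᵗ ((A′ ++ B′) ++ a′) → ⟨ a ⟩ ⫝[ ⟨ A ⟩ ] ⟨ B ⟩ → ⟨ a′ ⟩ ⫝[ ⟨ A′ ⟩ ] ⟨ B′ ⟩
  ⫝-invariant {Cᵃ} {Cᴬ} {Cᴮ} a a′ A A′ B B′ h ind (φ , φa′ , forks) =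
    let m , w , F = Þ-forks⇒forks ⟨ A′ ⟩ (φ ⟪ A′ ++ B′ ⟫) forks in
    ind (φ , ≡ᵗ-reindex swap (≡ᵗ-sym h) (swap-++ a′ (A′ ++ B′)) (swap-++ a (A ++ B)) φ φa′ ,
         forks⇒Þ-forks w ⟨ A ⟩ (φ ⟪ A ++ B ⟫) (forks-invariant φ (A′ ++ B′) (A ++ B) A′ A
           (≡ᵗ-reindex AAB (≡ᵗ-sym h) (AAB-++ A′ B′ a′) (AAB-++ A B a)) F))
    where
    AAB : Ren (Cᴬ ⊕ (Cᴬ ⊕ Cᴮ)) ((Cᴬ ⊕ Cᴮ) ⊕ Cᵃ)
    AAB s (inj₁ v) = inj₁ (inj₁ v)
    AAB s (inj₂ v) = inj₁ v
    AAB-++ : ∀ A B a → (A ++ (A ++ B)) ≋ (((A ++ B) ++ a) ∘ʳ AAB)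
    AAB-++ A B a s (inj₁ v) = ≈.refl
    AAB-++ A B a s (inj₂ v) = ≈.refl

  forks-∨ : ∀ {X : Ctx S} A B (φ ψ : Formula L (X ⊕ ctx B)) →
            Þ-forks (φ ⟪ elt B ⟫) A → Þ-forks (ψ ⟪ elt B ⟫) A → Þ-forks ((φ ∨′ ψ) ⟪ elt B ⟫) A
  forks-∨ A B φ ψ (χs , ds , h) (χs′ , ds′ , h′) = χs ++ˡ χs′ , All.++⁺ ds ds′ ,
    λ { x (inj₁ p) → Any.++⁺ˡ (h x p) ; x (inj₂ p) → Any.++⁺ʳ χs (h′ x p) }

  -- The forking formulas over B form an ideal, so a directed family outside
  -- it is consistent with the negations of all its members.
  avoid-forking : ∀ {i} {X : Ctx S} A B {I : Set i} (φ : I → Formula L (X ⊕ ctx B)) → I →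
                  (∀ i j → ∃[ k ] ∀ x → ⊨ φ k [ x ++ elt B ] → (⊨ φ i [ x ++ elt B ]) × (⊨ φ j [ x ++ elt B ])) →
                  (∀ i → ¬ Þ-forks (φ i ⟪ elt B ⟫) A) →
                  ∃[ x ] (∀ i → ⊨ φ i [ x ++ elt B ]) × ¬ Þ-forksᵗ B (tp ⟨ x ⟩ B) A
  avoid-forking {X = X} A B {I} φ i₀ directed nonforking = conclude
    (compactness (elt B) {I = J} Q (i₀ , ⊥′ , no-forks)
      (λ (i , ψ , f) (j , χ , g) → let k , h = directed i j in
        (k , ψ ∨′ χ , forks-∨ A B ψ χ f g) ,
        λ x (p , q) → (proj₁ (h x p) , λ r → q (inj₁ r)) , (proj₂ (h x p) , λ r → q (inj₂ r)))
      (λ (i , ψ , f) → byContradiction λ none → nonforking i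
        (forks-⊆ A (φ i ⟪ elt B ⟫) (ψ ⟪ elt B ⟫) (λ x p → byContradiction λ q → none (x , p , q)) f)))
    where
    J = I × Σ (Formula L (X ⊕ ctx B)) λ ψ → Þ-forks (ψ ⟪ elt B ⟫) A
    Q : J → Pred (Env X) c
    Q (i , ψ , _) x = (⊨ φ i [ x ++ elt B ]) × ¬ (⊨ ψ [ x ++ elt B ])
    no-forks : Þ-forks {X} (⊥′ ⟪ elt B ⟫) A
    no-forks = [] , [] , λ x p → contradiction (lower p) λ ()
    conclude : (∃[ x ] ∀ j χ → (∀ y → Q j y → ⊨ χ [ y ++ elt B ]) → ⊨ χ [ x ++ elt B ]) →
               ∃[ x ] (∀ i → ⊨ φ i [ x ++ elt B ]) × ¬ Þ-forksᵗ B (tp ⟨ x ⟩ B) A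
    conclude (x , h) = x , (λ i → h (i , ⊥′ , no-forks) (φ i) λ y → proj₁) ,
      λ (ψ , ψx , forks) → lower (h (i₀ , ψ , forks) (¬′ ψ) (λ y (_ , q) r → lift (q r)) ψx)

  extension : ∀ a A B D → a ⫝[ A ] B →
              ∃[ a′ ] ((elt A ++ elt B) ++ elt a) ≡ᵗ ((elt A ++ elt B) ++ a′) × (⟨ a′ ⟩ ⫝[ A ] (B ∪ D))
  extension a A B D ind =
    let a′ , h , ind′ = avoid-forking A V {I = Σ (Formula L (ctx a ⊕ ctx (A ∪ B))) (tp a (A ∪ B))}
          (λ (φ , _) → reparam (A ∪ B) V s φ) (⊤′ , λ z → z)
          (λ (φ , p) (ψ , q) → (φ ∧′ ψ , p , q) , λ x r → r)
          (λ (φ , p) forks → ind (φ , p , forks-⊆ A (φ ⟪ elt (A ∪ B) ⟫) (reparam (A ∪ B) V s φ ⟪ elt V ⟫)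
             (λ x → to (⊨-reparam (A ∪ B) V s φ)) forks))
    in a′ , ≡ᵗ-reindex swap {ρ = elt a ++ elt (A ∪ B)} {a′ ++ elt (A ∪ B)}
              (λ φ p → from (⊨-reparam (A ∪ B) V s φ) (h (φ , p)))
              (swap-++ (elt A ++ elt B) (elt a)) (swap-++ (elt A ++ elt B) a′) , ind′
    where
    V : Tuple
    V = A ∪ (B ∪ D)
    s : A ∪ B ⊆ V
    s = ∪-mono {A} {A} {B} {B ∪ D} (⊆-refl A) (⊆-∪ˡ B D)

-- Enlarging the base by an independent tuple; left transitivity

module Transitivity (em : ∀ {i} → ExcludedMiddle i) {ℓ c} {S : Set ℓ} {L : Signature S}
                    (M : Structure L c) (saturated : Semantics.Saturated M) where
  open Classical em
  open Thorn-forking em M saturated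
  open Calculus em M saturated

  -- Otherwise e is algebraic over Abz through some χ(y;A,b,z) with fewer than k
  -- solutions, and the formula in b saying so divides over Az.
  infinite-over : ∀ {n} (ss : Fin n → S) (e : Env (Pos ss)) {Z : Ctx S} (z : Env Z) A B b →
                  Infinite (Conjugate (A ∪ ⟨ z ⟩) e) → (⟨ e ⟩ ∪ ⟨ z ⟩) ⊆ A ∪ B → b ⫝[ A ] B →
                  Infinite (Conjugate ((A ∪ b) ∪ ⟨ z ⟩) e)
  infinite-over ss e {Z} z A B b inf ez⊆AB ind = many⇒infinite λ k →
    many-conjugates e (elt V) k λ χ χe → byContradiction λ few → absurd k χ χe few
    where
    V : Tuple
    V = (A ∪ b) ∪ ⟨ z ⟩
    U : Tuple
    U = ⟨ e ⟩ ∪ (A ∪ ⟨ z ⟩)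
    U⊆ : U ⊆ A ∪ B
    U⊆ = ∪-⊆ {⟨ e ⟩} {A ∪ ⟨ z ⟩} {A ∪ B} (λ s i → ez⊆AB s (inj₁ i))
           (∪-⊆ {A} {⟨ z ⟩} {A ∪ B} (⊆-∪ˡ A B) (λ s i → ez⊆AB s (inj₂ i)))

    absurd : ∀ k (χ : Formula L (Pos ss ⊕ ctx V)) → ⊨ χ [ e ++ elt V ] →
             ¬ Many k (λ y → ⊨ χ [ y ++ elt V ]) → ⊥
    -- `Many zero` holds trivially, so the bound is positive; below this provides the index `zero`
    -- of `Fin (suc k)`.
    absurd zero    χ χe few = few ((λ ()) , (λ ()) , λ ())
    absurd (suc k) χ χe few = ind
      ( reparam U (A ∪ B) U⊆ ψ
      , to (⊨-reparam U (A ∪ B) U⊆ ψ) (from (⊨ψ (elt b) e (elt A ++ z) elt-z) (χe , few))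
      , (ψ ⟪ elt U ⟫ ∷ []) , ((⟨ z ⟩ , infinite , suc k , inconsistent) ∷ [])
      , λ x p → here (from (⊨-reparam U (A ∪ B) U⊆ ψ) p))
      where
      V′ : Env (ctx b) → Env (ctx A ⊕ Z) → Env (ctx V)
      V′ x az s (inj₁ (inj₁ v)) = az s (inj₁ v)
      V′ x az s (inj₁ (inj₂ v)) = x s v
      V′ x az s (inj₂ v)        = az s (inj₂ v)
      elt-z : V′ (elt b) (elt A ++ z) ≋ elt V
      elt-z s (inj₁ (inj₁ v)) = ≈.refl
      elt-z s (inj₁ (inj₂ v)) = ≈.refl
      elt-z s (inj₂ v)        = ≈.refl
      few-ren : Ren (ctx V) (ctx b ⊕ (Pos ss ⊕ (ctx A ⊕ Z)))
      few-ren s (inj₁ (inj₁ v)) = inj₂ (inj₂ (inj₁ v))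
      few-ren s (inj₁ (inj₂ v)) = inj₁ v
      few-ren s (inj₂ v)        = inj₂ (inj₂ (inj₂ v))
      χ-ren : Ren (Pos ss ⊕ ctx V) (ctx b ⊕ (Pos ss ⊕ (ctx A ⊕ Z)))
      χ-ren s (inj₁ v) = inj₂ (inj₁ v)
      χ-ren s (inj₂ v) = few-ren s v
      ψ : Formula L (ctx b ⊕ (Pos ss ⊕ (ctx A ⊕ Z)))
      -- ψ(x; y, Az) says that y is one of at most k solutions of χ(·, A, x, z), with x in the place
      -- of b. Its parameters e, A, z lie in AB, so it belongs to tp(b/AB).
      ψ = rename χ-ren χ ∧′ ¬′ (rename few-ren (atLeast ss (suc k) χ))
      few-++ : ∀ x (u : Env (Pos ss ⊕ (ctx A ⊕ Z))) → V′ x (u ∘ʳ λ _ → inj₂) ≋ ((x ++ u) ∘ʳ few-ren)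
      few-++ x u s (inj₁ (inj₁ v)) = ≈.refl
      few-++ x u s (inj₁ (inj₂ v)) = ≈.refl
      few-++ x u s (inj₂ v)        = ≈.refl
      ⊨ψ : ∀ x y az {v} → V′ x az ≋ v →
           (⊨ ψ [ x ++ (y ++ az) ]) ⇔ ((⊨ χ [ y ++ v ]) × ¬ Many (suc k) (λ y → ⊨ χ [ y ++ v ]))
      ⊨ψ x y az {v} h = mk⇔
        (λ (p , q) → from χ⇔ p , λ m → lower (q (to few⇔ (from (⊨-atLeast ss (suc k) χ e) m))))
        (λ (p , q) → to χ⇔ p , λ r → lift (q (to (⊨-atLeast ss (suc k) χ e) (from few⇔ r))))
        where
        few≋ : v ≋ ((x ++ (y ++ az)) ∘ʳ few-ren)
        few≋ = ≋-trans (≋-sym h) (few-++ x (y ++ az))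
        χ≋ : (y ++ v) ≋ ((x ++ (y ++ az)) ∘ʳ χ-ren)
        χ≋ s (inj₁ v) = ≈.refl
        χ≋ s (inj₂ v) = few≋ s v
        χ⇔ : (⊨ χ [ y ++ v ]) ⇔ (⊨ rename χ-ren χ [ x ++ (y ++ az) ])
        χ⇔ = ⊨-rename χ χ-ren χ≋
        few⇔ : (⊨ atLeast ss (suc k) χ [ v ]) ⇔ (⊨ rename few-ren (atLeast ss (suc k) χ) [ x ++ (y ++ az) ])
        few⇔ = ⊨-rename (atLeast ss (suc k) χ) few-ren few≋

      az : Env (ctx A ⊕ Z)
      az = elt A ++ z
      -- Conjugation over Az fixes the part `az` of the parameter, so the conjugates correspond to
      -- those of e.
      infinite : Infinite (Conjugate (A ∪ ⟨ z ⟩) (e ++ az))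
      infinite = infinite-map {P = Conjugate (A ∪ ⟨ z ⟩) e} {Q = Conjugate (A ∪ ⟨ z ⟩) (e ++ az)} (_++ az)
        (λ y h → ≡ᵗ-reindex double h (double-++ e) (double-++ y)) (λ a b _ _ h s v → h s (inj₁ v)) inf
        where
        double : Ren ((Pos ss ⊕ (ctx A ⊕ Z)) ⊕ (ctx A ⊕ Z)) (Pos ss ⊕ (ctx A ⊕ Z))
        double s (inj₁ v) = v
        double s (inj₂ v) = inj₂ v
        double-++ : ∀ y → ((y ++ az) ++ az) ≋ ((y ++ az) ∘ʳ double)
        double-++ y s (inj₁ v) = ≈.refl
        double-++ y s (inj₂ v) = ≈.refl
      -- A common x for k+1 distinct conjugates would give χ(·, A, x, z) the k+1 distinct solutions
      -- that ψ excludes.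
      inconsistent : Inconsistent (suc k) ψ (Conjugate (A ∪ ⟨ z ⟩) (e ++ az))
      inconsistent as ps ds (x , q) = proj₂ (holds zero) (ys , (λ i → proj₁ (holds i)) , distinct)
        where
        ys : Fin (suc k) → Env (Pos ss)
        ys i s v = as i s (inj₁ v)
        fixed : ∀ i s v → az s v ≈ as i s (inj₂ v)
        fixed i s v = ≈.sym (≡ᵗ-≈ (ps i) (inj₁ (inj₂ v)) (inj₂ v) ≈.refl)
        holds : ∀ i → (⊨ χ [ ys i ++ V′ x az ]) × ¬ Many (suc k) (λ y → ⊨ χ [ y ++ V′ x az ])
        holds i = to (⊨ψ x (ys i) az ≋-refl) (⊨-resp ψ (++-cong ≋-refl split) (q i))
          where
          split : as i ≋ (ys i ++ az)
          split s (inj₁ v) = ≈.refl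
          split s (inj₂ v) = ≈.sym (fixed i s v)
        distinct : ∀ i j → i ≢ j → ¬ (ys i ≋ ys j)
        distinct i j i≢j h = ds i j i≢j λ
          { s (inj₁ v) → h s v ; s (inj₂ v) → ≈.trans (≈.sym (fixed i s v)) (fixed j s v) }

  forks-over : ∀ {X : Ctx S} {m} {w : Fin m → Pattern X} A B b G (φ : Formula L (X ⊕ ctx G)) →
               b ⫝[ A ] B → G ⊆ A ∪ B →
               Forks w (λ x → ⊨ φ [ x ++ elt G ]) A → Forks w (λ x → ⊨ φ [ x ++ elt G ]) (A ∪ b)
  forks-over {w = w} A B b G φ ind G⊆AB F =
    -- b′ and b are conjugate over AB, which contains the parameters G of φ, so forking over Ab′
    -- returns to forking over Ab.
    forks-invariant φ (elt G) (elt G) (elt A ++ b′) (elt A ++ elt b)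
      (≡ᵗ-reindex AbG (≡ᵗ-sym h) (AbG-++ b′) (AbG-++ (elt b))) F′
    where
    open Forks F
    D : Tuple
    D = ⟨ collect point ⟩ ∪ ⟨ collect over ⟩
    ext = extension b A B D ind
    b′ : Env (ctx b)
    b′ = proj₁ ext
    h : ((elt A ++ elt B) ++ elt b) ≡ᵗ ((elt A ++ elt B) ++ b′)
    h = proj₁ (proj₂ ext)
    AbG : Ren ((ctx A ⊕ ctx b) ⊕ ctx G) ((ctx A ⊕ ctx B) ⊕ ctx b)
    AbG s (inj₁ (inj₁ v)) = inj₁ (inj₁ v)
    AbG s (inj₁ (inj₂ v)) = inj₂ v
    AbG s (inj₂ v)        = inj₁ (proj₁ (G⊆AB s v))
    AbG-++ : ∀ y → ((elt A ++ y) ++ elt G) ≋ (((elt A ++ elt B) ++ y) ∘ʳ AbG)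
    AbG-++ y s (inj₁ (inj₁ v)) = ≈.refl
    AbG-++ y s (inj₁ (inj₂ v)) = ≈.refl
    AbG-++ y s (inj₂ v)        = proj₂ (G⊆AB s v)
    F′ : Forks w (λ x → ⊨ φ [ x ++ elt G ]) (A ∪ ⟨ b′ ⟩)
    F′ = record
      { point = point ; over = over ; covers = covers
      ; divides = λ j → record
        { infinite = infinite-over (Pattern.sorts (w j)) (point j) (over j) A (B ∪ D) ⟨ b′ ⟩
            (Divides.infinite (divides j))
            (λ { s (inj₁ i) → inj₂ (inj₂ (inj₁ (j , i))) , ≈.refl
               ; s (inj₂ i) → inj₂ (inj₂ (inj₂ (j , i))) , ≈.refl })
            (proj₂ (proj₂ ext))
        ; satisfies = Divides.satisfies (divides j) ; inconsistent = Divides.inconsistent (divides j) } }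

  -- A formula φ(x,y) of tp(ab/AB) forking over A forks over Ab by `forks-over`. Putting b for y in
  -- its disjuncts covers φ(x,b), a formula of tp(a/AbB). As b is fixed by conjugation over Ab,
  -- adding it to the parameters preserves both infinitude and inconsistency, so the disjuncts
  -- divide over Ab.
  left-transitivity : ∀ a b A B → a ⫝[ A ∪ b ] B → b ⫝[ A ] B → (a ∪ b) ⫝[ A ] B
  left-transitivity a b A B a⫝B b⫝B (φ , φab , forks) =
    a⫝B (rename assoc φ , to (⊨-assoc (elt a)) φab , ψs , dividing , covering)
    where
    forks′ = Þ-forks⇒forks A (φ ⟪ elt A ++ elt B ⟫) forks
    m : ℕ
    m = proj₁ forks′
    w : Fin m → Pattern (ctx a ⊕ ctx b)
    w = proj₁ (proj₂ forks′)
    F : Forks w (_⊩ (φ ⟪ elt A ++ elt B ⟫)) (A ∪ b)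
    F = forks-over A B b (A ∪ B) φ b⫝B (⊆-refl (A ∪ B)) (proj₂ (proj₂ forks′))
    open Forks F
    module Shape j = Pattern (w j)
    open Shape

    assoc : Ren ((ctx a ⊕ ctx b) ⊕ (ctx A ⊕ ctx B)) (ctx a ⊕ ((ctx A ⊕ ctx b) ⊕ ctx B))
    assoc s (inj₁ (inj₁ v)) = inj₁ v
    assoc s (inj₁ (inj₂ v)) = inj₂ (inj₁ (inj₂ v))
    assoc s (inj₂ (inj₁ v)) = inj₂ (inj₁ (inj₁ v))
    assoc s (inj₂ (inj₂ v)) = inj₂ (inj₂ v)
    ⊨-assoc : ∀ x → (⊨ φ [ (x ++ elt b) ++ (elt A ++ elt B) ]) ⇔
                    (⊨ rename assoc φ [ x ++ ((elt A ++ elt b) ++ elt B) ])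
    ⊨-assoc x = ⊨-rename φ assoc λ
      { s (inj₁ (inj₁ v)) → ≈.refl ; s (inj₁ (inj₂ v)) → ≈.refl
      ; s (inj₂ (inj₁ v)) → ≈.refl ; s (inj₂ (inj₂ v)) → ≈.refl }

    plug : ∀ {Y : Ctx S} → Ren ((ctx a ⊕ ctx b) ⊕ Y) (ctx a ⊕ (ctx b ⊕ Y))
    plug s (inj₁ (inj₁ v)) = inj₁ v
    plug s (inj₁ (inj₂ v)) = inj₂ (inj₁ v)
    plug s (inj₂ v)        = inj₂ (inj₂ v)
    ⊨-plug : ∀ {Y : Ctx S} (δ : Formula L ((ctx a ⊕ ctx b) ⊕ Y)) x (u : Env (ctx b ⊕ Y)) →
             (⊨ δ [ (x ++ (u ∘ʳ λ _ → inj₁)) ++ (u ∘ʳ λ _ → inj₂) ]) ⇔ (⊨ rename plug δ [ x ++ u ])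
    ⊨-plug δ x u = ⊨-rename δ plug λ
      { s (inj₁ (inj₁ v)) → ≈.refl ; s (inj₁ (inj₂ v)) → ≈.refl ; s (inj₂ v) → ≈.refl }

    ψ : ∀ j → ParFormula (ctx a)
    ψ j = rename plug (δ j) ⟪ elt b ++ point j ⟫
    ψs : List (ParFormula (ctx a))
    ψs = tabulate ψ

    covering : ∀ x → ⊨ rename assoc φ [ x ++ ((elt A ++ elt b) ++ elt B) ] → Any (x ⊩_) ψs
    covering x p = let j , q = covers (x ++ elt b) (from (⊨-assoc x) p) in
      Any.tabulate⁺ j (to (⊨-plug (δ j) x (elt b ++ point j)) (⊨-resp (δ j) (++-cong ≋-refl ≋-refl) q))

    dividing : All (λ ψ → Þ-divides ψ (A ∪ b)) ψs
    dividing = All.tabulate⁺ λ j → ⟨ over j ⟩ , infinite j , k j , inconsistent j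
      where
      V : ∀ j → Tuple
      V j = (A ∪ b) ∪ ⟨ over j ⟩
      dup : ∀ {j} → Ren ((ctx b ⊕ Param j) ⊕ ctx (V j)) (Param j ⊕ ctx (V j))
      dup s (inj₁ (inj₁ v)) = inj₂ (inj₁ (inj₂ v))
      dup s (inj₁ (inj₂ v)) = inj₁ v
      dup s (inj₂ v)        = inj₂ v
      dup-++ : ∀ j (y : Env (Param j)) → ((elt b ++ y) ++ elt (V j)) ≋ ((y ++ elt (V j)) ∘ʳ dup {j})
      dup-++ j y s (inj₁ (inj₁ v)) = ≈.refl
      dup-++ j y s (inj₁ (inj₂ v)) = ≈.refl
      dup-++ j y s (inj₂ v)        = ≈.refl
      infinite : ∀ j → Infinite (Conjugate (V j) (elt b ++ point j))
      infinite j = infinite-map {P = Conjugate (V j) (point j)} {Q = Conjugate (V j) (elt b ++ point j)}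
        (elt b ++_) (λ y h → ≡ᵗ-reindex (dup {j}) h (dup-++ j (point j)) (dup-++ j y))
        (λ _ _ _ _ h s v → h s (inj₂ v)) (Divides.infinite (divides j))
      satisfied : ∀ j (u : Env (ctx b ⊕ Param j)) → Conjugate (V j) (elt b ++ point j) u →
                  ⊨ π j [ (u ∘ʳ λ _ → inj₂) ++ over j ]
      satisfied j u h = ≡ᵗ-reindex r h (r-++ (elt b ++ point j)) (r-++ u) (π j) (Divides.satisfies (divides j))
        where
        r : Ren (Param j ⊕ ground j) ((ctx b ⊕ Param j) ⊕ ctx (V j))
        r s (inj₁ v) = inj₁ (inj₂ v)
        r s (inj₂ v) = inj₂ (inj₂ v)
        r-++ : ∀ u → ((u ∘ʳ λ _ → inj₂) ++ over j) ≋ ((u ++ elt (V j)) ∘ʳ r)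
        r-++ u s (inj₁ v) = ≈.refl
        r-++ u s (inj₂ v) = ≈.refl
      inconsistent : ∀ j → Inconsistent (k j) (rename plug (δ j)) (Conjugate (V j) (elt b ++ point j))
      inconsistent j as ps ds (x , q) = Divides.inconsistent (divides j)
        (λ i → as i ∘ʳ λ _ → inj₂) (λ i → satisfied j (as i) (ps i)) distinct
        (x ++ elt b , λ i → ⊨-resp (δ j) (++-cong (++-cong ≋-refl (fixed i)) ≋-refl) (from (⊨-plug (δ j) x (as i)) (q i)))
        where
        fixed : ∀ i → (as i ∘ʳ λ _ → inj₁) ≋ elt b
        fixed i s v = ≡ᵗ-≈ (ps i) (inj₁ (inj₁ v)) (inj₂ (inj₁ (inj₂ v))) ≈.refl
        distinct : ∀ i l → i ≢ l → ¬ ((as i ∘ʳ λ _ → inj₂) ≋ (as l ∘ʳ λ _ → inj₂))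
        distinct i l i≢l h = ds i l i≢l λ
          { s (inj₁ v) → ≈.trans (fixed i s v) (≈.sym (fixed l s v)) ; s (inj₂ v) → h s v }

-- Consequences of rosiness: existence, symmetry, transitivity, characters of independence

module Properties (em : ∀ {i} → ExcludedMiddle i) {ℓ c} {S : Set ℓ} {L : Signature S}
                  (M : Structure L c) (saturated : Semantics.Saturated M) (rosy : Thorn.Rosy M) where
  open Classical em
  open Thorn-forking em M saturated
  open Rank em M saturated
  open Bound em M saturated using (rank-bounded)
  open Calculus em M saturated
  open Transitivity em M saturated

  existence : ∀ b A → ¬ Þ-forksᵗ A (tp b A) A
  existence b A (φ , φb , forks) = rank-bounded w point over rosy (elt b) A unbounded
    where
    forks′ = Þ-forks⇒forks A (φ ⟪ elt A ⟫) forks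
    w = proj₁ (proj₂ forks′)
    F : Forks w (_⊩ (φ ⟪ elt A ⟫)) A
    F = proj₂ (proj₂ forks′)
    open Forks F
    unbounded : ∀ n → TypeRank≥ w (elt b) A n
    unbounded zero    θ θb = elt b , θb
    unbounded (suc n) = rank-step w (elt b) A A n (⊆-refl A) φ φb F (unbounded n)

  ⫝-base : ∀ b A → b ⫝[ A ] A
  ⫝-base b A (φ , φb , forks) = existence b A
    (reparam (A ∪ A) A s φ , to (⊨-reparam (A ∪ A) A s φ) φb ,
     forks-⊆ A (reparam (A ∪ A) A s φ ⟪ elt A ⟫) (φ ⟪ elt (A ∪ A) ⟫) (λ x → from (⊨-reparam (A ∪ A) A s φ)) forks)
    where
    s : A ∪ A ⊆ A
    s = ∪-⊆ {A} {A} {A} (⊆-refl A) (⊆-refl A)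

  ⫝-sym : ∀ a A b → a ⫝[ A ] b → b ⫝[ A ] a
  ⫝-sym a A b ind (φ , φb , forks) = rank-bounded w point over rosy (elt b) A unbounded
    where
    forks′ = Þ-forks⇒forks A (φ ⟪ elt A ++ elt a ⟫) forks
    w = proj₁ (proj₂ forks′)
    F : Forks w (_⊩ (φ ⟪ elt A ++ elt a ⟫)) A
    F = proj₂ (proj₂ forks′)
    open Forks F

    record NextTerm (G : Tuple) : Set (lsuc ℓ ⊔ c) where
      field
        value       : Env (ctx a)
        independent : ⟨ value ⟩ ⫝[ A ] (b ∪ G)
        satisfied   : ⊨ φ [ elt b ++ (elt A ++ value) ]
        forking     : Forks w (λ x → ⊨ φ [ x ++ (elt A ++ value) ]) A

    next : ∀ G → NextTerm G
    next G = record
      { value = a′ ; independent = proj₂ (proj₂ ext)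
      ; satisfied = ≡ᵗ-reindex bAa h (bAa-++ (elt a)) (bAa-++ a′) φ φb
      ; forking = forks-invariant φ (elt A ++ elt a) (elt A ++ a′) (elt A) (elt A)
          (≡ᵗ-reindex AAa h (AAa-++ (elt a)) (AAa-++ a′)) F }
      where
      ext = extension a A b G ind
      a′ : Env (ctx a)
      a′ = proj₁ ext
      h : ((elt A ++ elt b) ++ elt a) ≡ᵗ ((elt A ++ elt b) ++ a′)
      h = proj₁ (proj₂ ext)
      bAa : Ren (ctx b ⊕ (ctx A ⊕ ctx a)) ((ctx A ⊕ ctx b) ⊕ ctx a)
      bAa s (inj₁ v)        = inj₁ (inj₂ v)
      bAa s (inj₂ (inj₁ v)) = inj₁ (inj₁ v)
      bAa s (inj₂ (inj₂ v)) = inj₂ v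
      bAa-++ : ∀ y → (elt b ++ (elt A ++ y)) ≋ (((elt A ++ elt b) ++ y) ∘ʳ bAa)
      bAa-++ y s (inj₁ v)        = ≈.refl
      bAa-++ y s (inj₂ (inj₁ v)) = ≈.refl
      bAa-++ y s (inj₂ (inj₂ v)) = ≈.refl
      AAa : Ren (ctx A ⊕ (ctx A ⊕ ctx a)) ((ctx A ⊕ ctx b) ⊕ ctx a)
      AAa s (inj₁ v)        = inj₁ (inj₁ v)
      AAa s (inj₂ (inj₁ v)) = inj₁ (inj₁ v)
      AAa s (inj₂ (inj₂ v)) = inj₂ v
      AAa-++ : ∀ y → (elt A ++ (elt A ++ y)) ≋ (((elt A ++ elt b) ++ y) ∘ʳ AAa)
      AAa-++ y s (inj₁ v)        = ≈.refl
      AAa-++ y s (inj₂ (inj₁ v)) = ≈.refl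
      AAa-++ y s (inj₂ (inj₂ v)) = ≈.refl

    -- T gathers n+1 conjugates of a chosen after those in G. The gain is stated as a transfer of
    -- rank from `A ∪ T` down to A, so that gains compose.
    Chain : ℕ → Tuple → Set (lsuc ℓ ⊔ c)
    Chain n G = ∃[ T ] (T ⫝[ A ] (b ∪ G)) ×
      (∀ m → TypeRank≥ w (elt b) (A ∪ T) m → TypeRank≥ w (elt b) A (suc n + m))

    chain : ∀ n G → Chain n G
    chain zero G = ⟨ value ⟩ , independent , λ m → rank-step w (elt b) A (A ∪ ⟨ value ⟩) m
      (⊆-∪ˡ A ⟨ value ⟩) φ satisfied forking
      where open NextTerm (next G)
    -- `a′` is the earliest term and T the later ones, independent over A from b, G and `a′`; hence
    -- T is independent from `b ∪ G` over `A ∪ a′`, and left transitivity adjoins `a′`.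
    chain (suc n) G = T ∪ a′ , left-transitivity T a′ A (b ∪ G) T⫝ independent , rank
      where
      open NextTerm (next G)
      a′ : Tuple
      a′ = ⟨ value ⟩
      tail : Chain n (G ∪ a′)
      tail = chain n (G ∪ a′)
      T : Tuple
      T = proj₁ tail
      Aa′ : A ∪ a′ ⊆ A ∪ (b ∪ (G ∪ a′))
      Aa′ s (inj₁ i) = inj₁ i , ≈.refl
      Aa′ s (inj₂ i) = inj₂ (inj₂ (inj₂ i)) , ≈.refl
      Aa′bG : (A ∪ a′) ∪ (b ∪ G) ⊆ A ∪ (b ∪ (G ∪ a′))
      Aa′bG s (inj₁ i)        = Aa′ s i
      Aa′bG s (inj₂ (inj₁ i)) = inj₂ (inj₁ i) , ≈.refl
      Aa′bG s (inj₂ (inj₂ i)) = inj₂ (inj₂ (inj₁ i)) , ≈.refl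
      T⫝ : T ⫝[ A ∪ a′ ] (b ∪ G)
      T⫝ = ⫝-mono T A (b ∪ (G ∪ a′)) (A ∪ a′) (b ∪ G) (⊆-∪ˡ A a′) Aa′bG (proj₁ (proj₂ tail))
      E V : Tuple
      E = A ∪ T
      V = A ∪ (T ∪ a′)
      E⊆V : E ⊆ V
      E⊆V s (inj₁ i) = inj₁ i , ≈.refl
      E⊆V s (inj₂ i) = inj₂ (inj₁ i) , ≈.refl
      Aa′⊆V : A ∪ a′ ⊆ V
      Aa′⊆V s (inj₁ i) = inj₁ i , ≈.refl
      Aa′⊆V s (inj₂ i) = inj₂ (inj₂ i) , ≈.refl
      φ′ : Formula L (ctx b ⊕ ctx V)
      φ′ = reparam (A ∪ a′) V Aa′⊆V φ
      forking′ : Forks w (λ x → ⊨ φ′ [ x ++ elt V ]) E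
      forking′ = forksʷ-mono {P = λ x → ⊨ φ [ x ++ elt (A ∪ a′) ]} E
        (λ x → from (⊨-reparam (A ∪ a′) V Aa′⊆V φ))
        -- T is independent over A from a set containing `a′`, so the forking of φ(x, A, a′) over A
        -- persists over `A ∪ T` with the same patterns.
        (forks-over A (b ∪ (G ∪ a′)) T (A ∪ a′) φ (proj₁ (proj₂ tail)) Aa′ forking)
      rank : ∀ m → TypeRank≥ w (elt b) V m → TypeRank≥ w (elt b) A (suc (suc n) + m)
      -- Passing from `A ∪ (T ∪ a′)` to `A ∪ T` gains one, and `tail` gains n+1 more on the way to
      -- A.
      rank m r = subst (TypeRank≥ w (elt b) A) (ℕ.+-suc (suc n) m)
        (proj₂ (proj₂ tail) (suc m)
          (rank-step w (elt b) E V m E⊆V φ′ (to (⊨-reparam (A ∪ a′) V Aa′⊆V φ) satisfied) forking′ r))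

    unbounded : ∀ n → TypeRank≥ w (elt b) A n
    unbounded zero    θ θb = elt b , θb
    unbounded (suc n) = subst (TypeRank≥ w (elt b) A) (ℕ.+-identityʳ (suc n))
      -- The chain starts with `A` in place of an empty set of predecessors; rank 0 over `A ∪ T`
      -- only asks that b satisfy θ.
      (proj₂ (proj₂ (chain n A)) zero λ θ θb → elt b , θb)

  -- Left transitivity read through symmetry: C is independent from b over B, and B from b over A,
  -- so CB is independent from b over A.
  ⫝-trans : ∀ A B C b → A ⊆ B → B ⊆ C → b ⫝[ A ] B → b ⫝[ B ] C → b ⫝[ A ] C
  ⫝-trans A B C b A⊆B B⊆C b⫝B b⫝C =
    ⫝-monoʳ b A (C ∪ B) C (∪-mono {A} {A} {C} {C ∪ B} (⊆-refl A) (⊆-∪ˡ C B))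
      (⫝-sym (C ∪ B) A b (left-transitivity C B A b C⫝b (⫝-sym b A B b⫝B)))
    where
    C⫝b : C ⫝[ A ∪ B ] b
    C⫝b = ⫝-mono C B b (A ∪ B) b (⊆-∪ʳ A B)
      (∪-mono {A ∪ B} {B} {b} {b} (∪-⊆ {A} {B} {B} A⊆B (⊆-refl B)) (⊆-refl b)) (⫝-sym b B C b⫝C)

  finite-character⇒ : ∀ A B C d → d ⊆ C → C ⫝[ A ] B → d ⫝[ A ] B
  finite-character⇒ A B C d d⊆C ind (φ , φd , ψs , ds , h) = ind
    ( rename (onLeft r) φ
    , to (⊨-rename φ (onLeft r) (onLeft-≋ (elt A ++ elt B))) φd
    , map pull ψs , All.map⁺ (All.map (λ {ψ} → dividing ψ) ds)
    , λ x p → Any.map⁺ (Any.map (λ {ψ} → to (⊨-pull x ψ)) (h (x ∘ʳ r) (from (⊨-rename φ (onLeft r) (onLeft-++ r x _)) p))))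
    where
    r : Ren (ctx d) (ctx C)
    r s i = proj₁ (d⊆C s i)
    onLeft-≋ : ∀ {Y : Ctx S} (y : Env Y) → (elt d ++ y) ≋ ((elt C ++ y) ∘ʳ onLeft r)
    onLeft-≋ y s (inj₁ i) = proj₂ (d⊆C s i)
    onLeft-≋ y s (inj₂ v) = ≈.refl
    pull : ParFormula (ctx d) → ParFormula (ctx C)
    pull ψ = rename (onLeft r) (formula ψ) ⟪ param ψ ⟫
    ⊨-pull : ∀ x ψ → ((x ∘ʳ r) ⊩ ψ) ⇔ (x ⊩ pull ψ)
    ⊨-pull x ψ = ⊨-rename (formula ψ) (onLeft r) (onLeft-++ r x (param ψ))
    dividing : ∀ ψ → Þ-divides ψ A → Þ-divides (pull ψ) A
    dividing ψ (e , inf , k , inc) = e , inf , k , λ as ps ds′ (x , q) → inc as ps ds′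
      (x ∘ʳ r , λ i → from (⊨-rename (formula ψ) (onLeft r) (onLeft-++ r x (as i))) (q i))

  -- Forking is witnessed by φ and finitely many disjuncts, which mention finitely many coordinates
  -- of C.
  finite-character⇐ : ∀ A B C → (∀ d → FiniteTuple d → d ⊆ C → d ⫝[ A ] B) → C ⫝[ A ] B
  finite-character⇐ A B C ind (φ , φC , forks) = ind d d-finite d⊆C
    ( φ′ , to (⊨-narrow φ vs φ-vars ≋-refl) φC
    , tabulate (λ j → δ′ j ⟪ point j ⟫) , All.tabulate⁺ dividing
    , λ f p → let x , e = override unique (elt C) f
                  j , q = covers x (from (⊨-narrow φ vs φ-vars e) p)
              in Any.tabulate⁺ j (to (⊨-narrow (δ j) vs (δ-vars j) e) q))
    where
    forks′ = Þ-forks⇒forks A (φ ⟪ elt A ++ elt B ⟫) forks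
    w = proj₁ (proj₂ forks′)
    F : Forks w (_⊩ (φ ⟪ elt A ++ elt B ⟫)) A
    F = proj₂ (proj₂ forks′)
    open Forks F
    module Shape j = Pattern (w j)
    open Shape
    vs : Vars (ctx C)
    -- The variables of every `δ j` are included besides those of φ: the covering of φ by the
    -- disjuncts has to be read in one common tuple of variables.
    vs = dedupe (fvˡ (ctx C) φ ++ˡ concat (tabulate λ j → fvˡ (ctx C) (δ j)))
    unique : Unique vs
    unique = dedupe-unique (fvˡ (ctx C) φ ++ˡ concat (tabulate λ j → fvˡ (ctx C) (δ j)))
    φ-vars : ∀ {v} → v ∈ fvˡ (ctx C) φ → v ∈ vs
    φ-vars m = ∈-dedupe (∈-++⁺ˡ m)
    δ-vars : ∀ j {v} → v ∈ fvˡ (ctx C) (δ j) → v ∈ vs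
    δ-vars j m = ∈-dedupe (∈-++⁺ʳ (fvˡ (ctx C) φ) (∈-concat⁺′ m (∈-tabulate⁺ j)))
    d : Tuple
    d = ⟨ elt C ∘ʳ varOf vs ⟩
    d-finite : FiniteTuple d
    d-finite = tabulate (λ i → _ , pos i) , λ { _ (pos i) → ∈-tabulate⁺ i }
    d⊆C : d ⊆ C
    d⊆C s i = varOf vs s i , ≈.refl
    φ′ : Formula L (ctxOf vs ⊕ (ctx A ⊕ ctx B))
    φ′ = narrow φ vs φ-vars
    δ′ : ∀ j → Formula L (ctxOf vs ⊕ Param j)
    δ′ j = narrow (δ j) vs (δ-vars j)
    dividing : ∀ j → Þ-divides (δ′ j ⟪ point j ⟫) A
    dividing j =
      let z , inf , k , inc = divides⇒Þ-divides (w j) A (divides j) in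
      z , inf , k , λ as ps ds (f , q) → let x , e = override unique (elt C) f in
        inc as ps ds (x , λ i → from (⊨-narrow (δ j) vs (δ-vars j) e) (q i))

  -- Replacing a by a conjugate a′ over AB drags D along to some D′. `D*` lists, for each element of
  -- D, all solutions of its algebraic formula over B, so D′ stays inside `D*`; choosing a′
  -- independent from `B ∪ D*` and conjugating back gives the claim.
  ⫝-acl : ∀ a A B D → (∀ s i → acl B s (elt D s i)) → a ⫝[ A ] B → a ⫝[ A ] D
  ⫝-acl a A B D algebraic ind =
    ⫝-invariant a′ (elt a) (elt A) (elt A) D′ (elt D)
      (≡ᵗ-reindex ADa (≡ᵗ-sym h) (ADa-++ a′ D′) (ADa-++ (elt a) (elt D)))
      (⫝-monoʳ ⟨ a′ ⟩ A (B ∪ D*) ⟨ D′ ⟩ D′⊆ (proj₂ (proj₂ ext)))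
    where
    conjugates : ∀ s (i : ctx D s) → List (Env (∅ ▸ s))
    conjugates s i = proj₁ (proj₂ (proj₂ (algebraic s i)))
    D* : Tuple
    D* = ⟨_⟩ {λ s → Σ (ctx D s) λ i → Fin (length (conjugates s i))}
           λ s (i , n) → lookup (conjugates s i) n s (inj₂ refl)
    ext = extension a A B D* ind
    a′ : Env (ctx a)
    a′ = proj₁ ext
    AB : Env (ctx A ⊕ ctx B)
    AB = elt A ++ elt B
    back : ∃[ D′ ] ((AB ++ elt a) ++ elt D) ≡ᵗ ((AB ++ a′) ++ D′)
    back = extend (proj₁ (proj₂ ext)) (elt D)
    D′ : Env (ctx D)
    D′ = proj₁ back
    h : ((AB ++ elt a) ++ elt D) ≡ᵗ ((AB ++ a′) ++ D′)
    h = proj₂ back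
    ADa : Ren ((ctx A ⊕ ctx D) ⊕ ctx a) (((ctx A ⊕ ctx B) ⊕ ctx a) ⊕ ctx D)
    ADa s (inj₁ (inj₁ v)) = inj₁ (inj₁ (inj₁ v))
    ADa s (inj₁ (inj₂ v)) = inj₂ v
    ADa s (inj₂ v)        = inj₁ (inj₂ v)
    ADa-++ : ∀ y z → ((elt A ++ z) ++ y) ≋ (((AB ++ y) ++ z) ∘ʳ ADa)
    ADa-++ y z s (inj₁ (inj₁ v)) = ≈.refl
    ADa-++ y z s (inj₁ (inj₂ v)) = ≈.refl
    ADa-++ y z s (inj₂ v)        = ≈.refl
    at : ∀ {s} → ctx D s → Ren (∅ ▸ s ⊕ ctx B) (((ctx A ⊕ ctx B) ⊕ ctx a) ⊕ ctx D)
    at i _ (inj₁ (inj₂ refl)) = inj₂ i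
    at i _ (inj₂ v)           = inj₁ (inj₁ (inj₂ v))
    at-++ : ∀ {s} (i : ctx D s) y z → ((ε ,, z s i) ++ elt B) ≋ (((AB ++ y) ++ z) ∘ʳ at i)
    at-++ i y z _ (inj₁ (inj₂ refl)) = ≈.refl
    at-++ i y z _ (inj₂ v)           = ≈.refl
    listed : ∀ s (i : ctx D s) → Any ((ε ,, D′ s i) ≋_) (conjugates s i)
    listed s i = let φ , φd , bs , finite = algebraic s i in
      finite (ε ,, D′ s i) (≡ᵗ-reindex (at i) h (at-++ i (elt a) (elt D)) (at-++ i a′ D′) φ φd)
    D′⊆ : A ∪ ⟨ D′ ⟩ ⊆ A ∪ (B ∪ D*)
    D′⊆ s (inj₁ i) = inj₁ i , ≈.refl
    D′⊆ s (inj₂ i) = inj₂ (inj₂ (i , Any.index (listed s i))) , Any.lookup-index (listed s i) s (inj₂ refl)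

  reflexivity⇐ : ∀ A B → (∀ s i → acl A s (elt B s i)) → B ⫝[ A ] B
  reflexivity⇐ A B algebraic = ⫝-acl B A A B algebraic (⫝-base B A)

  reflexivity⇒ : ∀ A B → B ⫝[ A ] B → ∀ s i → acl A s (elt B s i)
  reflexivity⇒ A B ind s i = byContradiction λ transcendental → ind
    ( (var (inj₁ i) ≐ var (inj₂ (inj₂ i))) , ≈.refl
    , ((var (inj₁ i) ≐ var (inj₂ (pos zero))) ⟪ e ⟫ ∷ [])
    -- Two distinct parameters cannot both equal x, whence 2; the extra tuple of þ-dividing is
    -- filled with A itself, whence `V = A ∪ A`.
    , ((A , infinite transcendental , 2 , λ as ps ds (x , q) → ds zero (suc zero) (λ ())
         λ { _ (pos zero) → ≈.trans (≈.sym (q zero)) (q (suc zero)) }) ∷ [])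
    , λ x p → here p )
    where
    ss : Fin 1 → S
    ss _ = s
    e : Env (Pos ss)
    e _ (pos _) = elt B s i
    V : Tuple
    V = A ∪ A
    single : Ren (Pos ss ⊕ ctx V) (∅ ▸ s ⊕ ctx A)
    single _ (inj₁ (pos _))  = inj₁ (inj₂ refl)
    single _ (inj₂ (inj₁ v)) = inj₂ v
    single _ (inj₂ (inj₂ v)) = inj₂ v
    one : ∣_∣ s → Env (Pos ss)
    one a _ (pos _) = a
    single-++ : ∀ a → (one a ++ elt V) ≋ (((ε ,, a) ++ elt A) ∘ʳ single)
    single-++ a _ (inj₁ (pos _))  = ≈.refl
    single-++ a _ (inj₂ (inj₁ v)) = ≈.refl
    single-++ a _ (inj₂ (inj₂ v)) = ≈.refl
    ⊨-single : ∀ (χ : Formula L (Pos ss ⊕ ctx V)) a →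
               (⊨ χ [ one a ++ elt V ]) ⇔ (⊨ rename single χ [ (ε ,, a) ++ elt A ])
    ⊨-single χ a = ⊨-rename χ single (single-++ a)
    one-η : ∀ (y : Env (Pos ss)) → y ≋ one (y _ (pos zero))
    one-η y _ (pos zero) = ≈.refl
    infinite : ¬ acl A s (elt B s i) → Infinite (Conjugate V e)
    infinite transcendental = many⇒infinite λ k → many-conjugates e (elt V) k λ χ χe →
      infinite⇒many {P = λ y → ⊨ χ [ y ++ elt V ]} (λ (bs , cover) → transcendental
        ( rename single χ , to (⊨-single χ (elt B s i)) (⊨-resp χ (++-cong (one-η e) ≋-refl) χe)
        , map (λ b → ε ,, b _ (pos zero)) bs
        , λ x p → Any.map⁺ (Any.map (λ {b} → near x b)
            (cover (one (x _ (inj₂ refl))) (from (⊨-single χ (x _ (inj₂ refl)))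
              (⊨-resp (rename single χ) (++-cong (bind-η x) ≋-refl) p)))))) k
      where
      bind-η : ∀ (x : Env (∅ ▸ s)) → x ≋ (ε ,, x _ (inj₂ refl))
      bind-η x _ (inj₂ refl) = ≈.refl
      near : ∀ (x : Env (∅ ▸ s)) b → one (x _ (inj₂ refl)) ≋ b → x ≋ (ε ,, b _ (pos zero))
      near x b h _ (inj₂ refl) = h _ (pos zero)

-- The nine properties of þ-independence in C^eq

corollary4p1p2 : (∀ {i} → ExcludedMiddle i) →
    ∀ {ℓ c} {S : Set ℓ} (L : Signature S) (T : Theory L) → Complete T →
    (C : Structure L c) (C⊨T : Semantics.Models C T) → Semantics.Saturated C →
    let open Thorn (_ᵉ T C C⊨T) in
    Rosy →
    (∀ {X} (A : Tuple) (p : Type X A) → IsCompleteType A p → ¬ Þ-forksᵗ A p A)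
    × (∀ {X} (A B : Tuple) → A ⊆ B → (p : Type X B) → IsPartialType B p → ¬ Þ-forksᵗ B p A →
    ∃[ q ] IsCompleteType {X} B q × (∀ φ → p φ → q φ) × ¬ Þ-forksᵗ B q A)
    × (∀ (A B : Tuple) → (B ⫝[ A ] B) ⇔ (∀ s i → acl A s (elt B s i)))
    × (∀ {X} (A B D : Tuple) (B⊆D : B ⊆ D) (p : Type X D) (q : Type X B) →
    IsPartialType D p → IsPartialType B q →
    (∀ φ → q φ → p (reparam B D B⊆D φ)) →
    ¬ Þ-forksᵗ D p A → ¬ Þ-forksᵗ B q A)
    × (∀ (A B C : Tuple) → (C ⫝[ A ] B) ⇔ (∀ d → FiniteTuple d → d ⊆ C → d ⫝[ A ] B))
    × (∀ (A B C : Tuple) → (C ⫝[ A ] B) ⇔ (B ⫝[ A ] C))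
    × (∀ (A B C b : Tuple) → A ⊆ B → B ⊆ C → (b ⫝[ A ] C) ⇔ ((b ⫝[ A ] B) × (b ⫝[ B ] C)))
    × (∀ {X} (A a b : Tuple) (δ : Formula (Lᵉ T) (X ⊕ ctx a)) → a ⫝[ A ] b →
    Þ-forks {X} (δ ⟪ elt a ⟫) A → Þ-forks {X} (δ ⟪ elt a ⟫) (A ∪ b))
    × (∀ (A B D a : Tuple) → A ⊆ B → Enumerates-acl D B → a ⫝[ A ] B → a ⫝[ A ] D)
corollary4p1p2 em {ℓ} {c} L T _ C C⊨T saturated rosy =
    -- A realisation x of p places the forking formula in tp(x/A).
    (λ {X} A p complete (φ , pφ , forks) →
       let x , h = saturatedᵉ A p (IsPartialType.consistent (IsCompleteType.isPartialType complete))
       in existence ⟨ x ⟩ A (φ , h φ pφ , forks))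
  , (λ {X} A B _ p partial-type nonforking →
       let module p = IsPartialType partial-type
           x , h , ind = avoid-forking A B {I = Σ _ p} proj₁ (⊤′ , p.⊤-closed)
             (λ (φ , pφ) (ψ , pψ) → (φ ∧′ ψ , p.∧-closed pφ pψ) , λ _ r → r)
             (λ (φ , pφ) forks → nonforking (φ , pφ , forks))
       in tp ⟨ x ⟩ B , tp-complete ⟨ x ⟩ B , (λ φ pφ → h (φ , pφ)) , ind)
  , (λ A B → mk⇔ (reflexivity⇒ A B) (reflexivity⇐ A B))
  , (λ A B D B⊆D p q _ _ q⊆p nonforking (φ , qφ , forks) → nonforking
       (reparam B D B⊆D φ , q⊆p φ qφ ,
        forks-⊆ A (reparam B D B⊆D φ ⟪ elt D ⟫) (φ ⟪ elt B ⟫) (λ x → from (⊨-reparam B D B⊆D φ)) forks))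
  , (λ A B C → mk⇔ (λ ind d _ d⊆C → finite-character⇒ A B C d d⊆C ind) (finite-character⇐ A B C))
  , (λ A B C → mk⇔ (⫝-sym C A B) (⫝-sym B A C))
  , (λ A B C b A⊆B B⊆C → mk⇔
       (λ ind → ⫝-monoʳ b A C B (∪-mono {A} {A} {B} {C} (⊆-refl A) B⊆C) ind
              , ⫝-mono b A C B C A⊆B (∪-⊆ {B} {C} {A ∪ C} (⊆-trans {B} {C} {A ∪ C} B⊆C (⊆-∪ʳ A C)) (⊆-∪ʳ A C)) ind)
       (λ (b⫝B , b⫝C) → ⫝-trans A B C b A⊆B B⊆C b⫝B b⫝C))
  -- Symmetry makes b independent from a over A, which is the side on which `forks-over` takes the
  -- tuple to be added to the base.
  , (λ A a b δ ind forks → let m , w , F = Þ-forks⇒forks A (δ ⟪ elt a ⟫) forks in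
       forks⇒Þ-forks w (A ∪ b) (δ ⟪ elt a ⟫)
         (forks-over A a b a δ (⫝-sym a A b ind) (⊆-∪ʳ A a) F))
  , (λ A B D a _ enumerates ind → ⫝-acl a A B D (proj₁ enumerates) ind)
  where
  M : Structure (Lᵉ T) c
  M = _ᵉ T C C⊨T
  saturatedᴹ : Semantics.Saturated M
  saturatedᴹ = Imaginaries.eq-saturated em T C C⊨T saturated
  open Thorn-forking em M saturatedᴹ
  open Calculus em M saturatedᴹ
  open Transitivity em M saturatedᴹ
  open Properties em M saturatedᴹ rosy
  saturatedᵉ : ∀ {X : Ctx (EqSort T)} A (p : Type X A) → Consistent (elt A) p → ∃ (Realises A p)
  saturatedᵉ A p = saturatedᴹ (elt A) p
  tp-complete : ∀ x B → IsCompleteType B (tp x B)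
  tp-complete x B = record
    { isPartialType = record { consistent = λ φs ps → elt x , ps ; ⊤-closed = λ z → z ; ∧-closed = λ p q → p , q }
    ; decides = λ φ → decide φ em }
    where
    decide : ∀ φ → Dec (⊨ φ [ elt x ++ elt B ]) → tp x B φ ⊎ tp x B (¬′ φ)
    decide φ (yes p) = inj₁ p
    decide φ (no q)  = inj₂ λ p → lift (q p)
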